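{- For $h\geq 1$ let $L_h=\sum_{W}p_h^U(W)\,|W|$ be the expected length of a growing self-avoiding walk on $\mathcal G_h$ starting at $(0,h-1)$ under the uniform model, the sum being over all GSAWs on $\mathcal G_h$ starting at $(0,h-1)$. Then $$L_3=\frac{486414801}{25317287},$$ $$L_4=\frac{36398762646457399797278201924184927631185786219507599165631529}{1584271961568506676402164217848452838298247680057676502545715},$$ and $L_5$ is a rational number whose value rounded to 10 decimal places is $26.5182848508$.
   Context: $\mathcal G_h$ is the half-infinite grid graph with vertex set $\mathbb N\times\{0,\dots,h-1\}$ ($0\in\mathbb N$), with an edge between two points exactly when they are at Euclidean distance $1$. A growing self-avoiding walk (GSAW) is a finite directed walk that visits no vertex twice and whose final vertex is trapped, i.e. all of its neighbors are visited by the walk. $|W|$ is the number of edges of $W$. Uniform model: at each step the next vertex is chosen uniformly at random among the not-yet-visited neighbors of the current endpoint; $p_h^U(W)$ is the product over the steps of $W$ of $1/m$, where $m$ is the number of unvisited neighbors of the current endpoint just before that step. -}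

module Defs where

open import Data.Fin using (Fin; toℕ; fromℕ)
import Data.Fin.Properties as Fin
open import Data.Integer using (+_)
open import Data.List using (List; []; _∷_; map; foldr; filter; length; head; last; upTo; allFin; cartesianProduct)
open import Data.List.Membership.Propositional using (_∈_)
import Data.List.Membership.DecPropositional as DecMembership
open import Data.List.Membership.Propositional.Properties using (∈-filter⁺; ∈-filter⁻; ∈-cartesianProduct⁺; ∈-upTo⁺; ∈-allFin)
open import Data.List.Relation.Binary.Subset.Propositional using (_⊆_)
open import Data.List.Relation.Unary.All using (All)
open import Data.List.Relation.Unary.Linked using (Linked)
open import Data.List.Relation.Unary.Unique.Propositional using (Unique)
import Data.List.Relation.Unary.Unique.Propositional.Properties as Unique
open import Data.Maybe using (just)
open import Data.Nat as ℕ using (ℕ; zero; suc; pred; NonZero; _^_; s≤s)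
import Data.Nat.Properties as ℕ
open import Data.Product using (_×_; _,_; ∃-syntax; proj₂)
open import Data.Product.Properties using (≡-dec)
open import Data.Rational using (ℚ; 0ℚ; 1ℚ; _+_; _*_; _-_; _/_; _<_; ∣_∣)
open import Relation.Binary.Definitions using (Decidable; DecidableEquality)
open import Relation.Binary.PropositionalEquality using (_≡_; cong)
open import Relation.Nullary using (¬?)

------------------------------------------------------------------------
-- The half-infinite grid graph

Vertex : ℕ → Set
Vertex h = ℕ × Fin h

distance² : ∀ {h} → Vertex h → Vertex h → ℕ
distance² (x , y) (x′ , y′) = ℕ.∣ x - x′ ∣ ^ 2 ℕ.+ ℕ.∣ toℕ y - toℕ y′ ∣ ^ 2

-- The coordinates are integers, so Euclidean distance 1 is the same as
-- squared Euclidean distance 1, which avoids square roots.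
Adjacent : ∀ {h} → Vertex h → Vertex h → Set
Adjacent v w = distance² v w ≡ 1

_≟ᵛ_ : ∀ {h} → DecidableEquality (Vertex h)
_≟ᵛ_ = ≡-dec ℕ._≟_ Fin._≟_

adjacent? : ∀ {h} → Decidable (Adjacent {h})
adjacent? v w = distance² v w ℕ.≟ 1

-- Searching columns 0 , … , x + 1 suffices; ∈-neighbours⁺, ∈-neighbours⁻
-- and neighbours-unique show that every neighbour is listed exactly once.
neighbours : ∀ {h} → Vertex h → List (Vertex h)
neighbours {h} v@(x , _) =
  filter (adjacent? v) (cartesianProduct (upTo (2 ℕ.+ x)) (allFin h))

∈-neighbours⁺ : ∀ {h} {v w : Vertex h} → Adjacent v w → w ∈ neighbours v
∈-neighbours⁺ {v = v@(x , y)} {w@(x′ , y′)} vw =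
  ∈-filter⁺ (adjacent? v)
    (∈-cartesianProduct⁺ (∈-upTo⁺ (s≤s x′≤1+x)) (∈-allFin y′)) vw
  where
  open ℕ.≤-Reasoning

  n≤n² : ∀ n → n ℕ.≤ n ^ 2
  n≤n² zero    = ℕ.z≤n
  n≤n² (suc n) = ℕ.m≤m*n (suc n) (suc n ^ 1)

  x′≤1+x : x′ ℕ.≤ suc x
  x′≤1+x = begin
    x′                        ≤⟨ ℕ.m≤n+∣n-m∣ x′ x ⟩
    x ℕ.+ ℕ.∣ x - x′ ∣          ≤⟨ ℕ.+-monoʳ-≤ x (n≤n² _) ⟩
    x ℕ.+ ℕ.∣ x - x′ ∣ ^ 2      ≤⟨ ℕ.+-monoʳ-≤ x (ℕ.m≤m+n _ _) ⟩
    x ℕ.+ distance² v w       ≡⟨ cong (x ℕ.+_) vw ⟩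
    x ℕ.+ 1                   ≡⟨ ℕ.+-comm x 1 ⟩
    suc x                     ∎

∈-neighbours⁻ : ∀ {h} {v w : Vertex h} → w ∈ neighbours v → Adjacent v w
∈-neighbours⁻ {v = v@(x , _)} w∈ =
  proj₂ (∈-filter⁻ (adjacent? v) {xs = cartesianProduct (upTo (2 ℕ.+ x)) (allFin _)} w∈)

neighbours-unique : ∀ {h} (v : Vertex h) → Unique (neighbours v)
neighbours-unique {h} v@(x , _) =
  Unique.filter⁺ (adjacent? v)
    (Unique.cartesianProduct⁺ (Unique.upTo⁺ (2 ℕ.+ x)) (Unique.allFin⁺ h))

------------------------------------------------------------------------
-- Growing self-avoiding walks

-- Vertices in the order in which they are visited.
Walk : ℕ → Set
Walk h = List (Vertex h)

∣_∣ʷ : ∀ {h} → Walk h → ℕ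
∣ W ∣ʷ = pred (length W)

Trapped : ∀ {h} → Walk h → Vertex h → Set
Trapped W v = ∀ {u} → Adjacent v u → u ∈ W

record IsGSAW {h} (start : Vertex h) (W : Walk h) : Set where
  field
    starts       : head W ≡ just start
    steps        : Linked Adjacent W
    selfAvoiding : Unique W
    trapped      : ∃[ v ] (last W ≡ just v × Trapped W v)

------------------------------------------------------------------------
-- The uniform model

unvisitedNeighbours : ∀ {h} → List (Vertex h) → Vertex h → List (Vertex h)
unvisitedNeighbours visited v = filter (λ u → ¬? (u ∈? visited)) (neighbours v)
  where open DecMembership _≟ᵛ_

-- The value at 0 is never used on a self-avoiding walk: the vertex
-- reached by a step is itself an unvisited neighbour.
1/′_ : ℕ → ℚ
1/′ zero  = 0ℚ
1/′ suc m = + 1 / suc m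

-- The list `visited` holds the vertices preceding the remaining walk.
stepProduct : ∀ {h} → List (Vertex h) → Walk h → ℚ
stepProduct visited []          = 1ℚ
stepProduct visited (_ ∷ [])    = 1ℚ
stepProduct visited (v ∷ w ∷ W) =
  1/′ length (unvisitedNeighbours (v ∷ visited) v) * stepProduct (v ∷ visited) (w ∷ W)

pᵁ : ∀ {h} → Walk h → ℚ
pᵁ = stepProduct []

------------------------------------------------------------------------
-- Sums of rational families

sumℚ : List ℚ → ℚ
sumℚ = foldr _+_ 0ℚ

-- Unconditional summation: the sums of f over the finite subsets of
-- { a ∣ P a }, directed by inclusion, converge to s. Finite subsets are
-- lists without repetition.
HasSum : {A : Set} (P : A → Set) (f : A → ℚ) (s : ℚ) → Set
HasSum P f s =
  ∀ ε → 0ℚ < ε →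
  ∃[ F₀ ] (All P F₀ ×
    (∀ F → Unique F → All P F → F₀ ⊆ F → ∣ sumℚ (map f F) - s ∣ < ε))

------------------------------------------------------------------------
-- The expected length

corner : ∀ h .{{_ : NonZero h}} → Vertex h
corner (suc n) = 0 , fromℕ n

-- L h ≔ q states that the series defining L_h converges with sum q.
L_≔_ : ∀ h .{{_ : NonZero h}} → ℚ → Set
L h ≔ q = HasSum (IsGSAW (corner h)) (λ W → pᵁ W * (+ ∣ W ∣ʷ / 1)) q

-- Cut the strip between two columns. The part of a walk to the right of the cut is
-- a sequence of excursions, and it interacts with the part to the left only through
-- the rows of the crossings and the question which of the two vertices next to the
-- cut in a row was visited first. Hence the total weight of the right parts with a
-- given transcript of the crossings satisfies, as a function of the number of
-- columns, a linear recursion x ↦ T x over the transcripts, of which 29, 166 and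
-- 1122 are reachable for h = 3, 4 and 5. The transcript with a single crossing next
-- to a completely visited column gives the expected number of visited vertices,
-- which is one more than the expected length.
--
-- A weight v on the transcripts with T v ≤ (19/20) v makes the recursion contract:
-- x = T x has a unique solution, the truncated weights converge to it, and by a
-- maximum principle sub- and supersolutions bound it. Explicit bounds are checked
-- by evaluation; they coincide for h = 3 and h = 4 and determine the rounded value
-- for h = 5.

module Submission where

open import Defs
import Data.Bool as Bool
open import Data.Bool using (Bool; true; false; if_then_else_; _∧_; _∨_; not)
import Data.Bool.Properties as Bool
open import Data.Empty using (⊥; ⊥-elim)
open import Data.Fin using (Fin; toℕ; zero; suc; fromℕ)
import Data.Fin.Properties as Fin
import Data.Integer as ℤ
open import Data.Integer using (+_)
import Data.Integer.DivMod as ℤ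
import Data.Integer.Properties as ℤ
open import Data.List using (List; []; _∷_; _++_; map; concatMap; cartesianProduct; upTo; last; head; filter; filterᵇ; allFin; length)
import Data.List.Membership.DecPropositional as DecMembership
open import Data.List.Membership.Propositional using (_∈_; _∉_)
open import Data.List.Membership.Propositional.Properties using (∈-++⁺ˡ; ∈-++⁺ʳ; ∈-++⁻; ∈-∃++; ∈-cartesianProduct⁻; ∈-upTo⁻; ∈-concatMap⁺; ∈-concatMap⁻; ∈-map⁺; ∈-map⁻; ∈-filter⁺; ∈-filter⁻; ∈-allFin)
open import Data.List.Membership.Propositional.Properties.WithK using (unique∧set⇒bag)
open import Data.List.Properties using (map-tabulate; filter-++; length-++; length-map)
open import Data.List.Relation.Binary.BagAndSetEquality using (∼bag⇒↭)
import Data.List.Relation.Binary.Permutation.Propositional as ↭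
open import Data.List.Relation.Binary.Permutation.Propositional using (_↭_; ↭-refl; ↭-trans)
open import Data.List.Relation.Binary.Permutation.Propositional.Properties using (filter-↭; ↭-length; shift)
open import Data.List.Relation.Binary.Subset.Propositional using (_⊆_)
open import Data.List.Relation.Unary.All as All using (All; []; _∷_)
open import Data.List.Relation.Unary.AllPairs using ([]; _∷_)
open import Data.List.Relation.Unary.Any using (Any; here; there)
open import Data.List.Relation.Unary.Linked using (Linked; []; [-]; _∷_)
open import Data.List.Relation.Unary.Unique.Propositional using (Unique)
import Data.List.Relation.Unary.Unique.Propositional.Properties as Unique
open import Data.Maybe using (Maybe; just; nothing)
open import Data.Maybe.Properties using (just-injective)
import Data.Nat as ℕ
open import Data.Nat using (ℕ; zero; suc; _+_; _∸_; _^_; _≤_; _<_; s≤s; z≤n; _⊔_; ∣_-_∣; _≡ᵇ_; _≤ᵇ_; _<ᵇ_)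
import Data.Nat.Properties as ℕ
open import Data.Nat.Solver renaming (module +-*-Solver to ℕ-Solver)
open import Data.Product using (_×_; _,_; ∃; proj₁; proj₂; ∃-syntax)
open import Data.Rational as ℚ using (ℚ; 0ℚ; 1ℚ; _*_; _/_; 1/_; round)
import Data.Rational.Properties as ℚ
open import Data.Rational.Solver using (module +-*-Solver)
import Data.Rational.Unnormalised as ℚᵘ
import Data.Rational.Unnormalised.Properties as ℚᵘ
open import Data.Sum using (_⊎_; inj₁; inj₂)
open import Data.Unit using (⊤; tt)
open import Data.Vec using (Vec; []; _∷_; lookup; zipWith; replicate; _[_]≔_)
open import Data.Vec.Properties using (≡-dec; lookup-zipWith; lookup-replicate; lookup∘update; lookup∘update′)
open import Function using (case_of_)
open import Function.Bundles using (mk⇔)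
open import Relation.Binary.Definitions using (DecidableEquality)
open import Relation.Binary.PropositionalEquality using (_≡_; _≢_; refl; sym; trans; cong; cong₂; subst; subst₂; module ≡-Reasoning)
open import Relation.Nullary using (Dec; yes; no; does; ¬_; ¬?; contradiction)
open import Relation.Nullary.Decidable using (dec-true; dec-false; does-⇔; toWitness)

-- Columns and transcripts

-- The expected number of visited vertices is a sum over prefixes: every self-avoiding walk from the
-- corner, trapped or not, contributes its probability. A transcript therefore describes a prefix,
-- and `end` says on which side of the cut its last vertex lies.
--
-- ℚ is not complete, so the sum of the series cannot be introduced as the limit of its truncations:
-- a rational limit has to be at hand beforehand. It is obtained by eliminating the transcripts one
-- at a time from the linear system; the contracting weight keeps every pivot away from 0. This
-- gives the rationality for h = 5 without ever computing the exact value.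
--
-- The series itself runs over trapped walks only and is cut off by length, while the recursion is
-- cut off by columns. Passing between the two needs that f times the probability of surviving 2f
-- steps tends to 0, which follows from the boundedness of the expected number of visits.

Column : ℕ → Set
Column h = Vec Bool h

∅ : ∀ {h} → Column h
∅ = replicate _ false

full : ∀ {h} → Column h
full = replicate _ true

_∖_ : ∀ {h} → Column h → Column h → Column h
_∖_ = zipWith (λ p q → not q ∧ p)

_∪_ : ∀ {h} → Column h → Column h → Column h
_∪_ = zipWith _∨_

mark : ∀ {h} → Fin h → Column h → Column h
mark a c = c [ a ]≔ true

beside : ∀ {h} → Fin h → Fin h → Bool
beside a r = ∣ toℕ a - toℕ r ∣ ≡ᵇ 1

freeRows : ∀ {h} → Column h → Fin h → List (Fin h)
freeRows c a = filterᵇ (λ r → beside a r ∧ not (lookup c r)) (allFin _)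

-- For use after an excursion to the right: `ν` holds the rows that the right side visited first
-- before it, `c` the rows visited on the right after it. The left side did not move meanwhile, so
-- the rows where the left vertex came first are still those of `λₗ`.
merge : ∀ {h} → Column h → Column h → Column h → Column h
merge ν c λₗ = (ν ∪ c) ∖ λₗ

-- A transcript of the crossings of a cut between two columns, as seen from the
-- right: the walk crosses from left to right in row a (enter λₗ a) or from right
-- to left in row b (exit b μ). Here λₗ and μ mark the rows at the cut whose left,
-- respectively right, vertex was visited before the other one. Under end the last
-- vertex lies to the right of the cut, under stop there is no further crossing.
mutual
  data Test (h : ℕ) : Set where
    stop  : Test h
    enter : Column h → Fin h → Goal h → Test h

  data Goal (h : ℕ) : Set where
    end  : Goal h
    exit : Fin h → Column h → Test h → Goal h

_≡ᶠ_ : ∀ {h} → Fin h → Fin h → Bool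
zero ≡ᶠ zero = true
suc a ≡ᶠ suc b = a ≡ᶠ b
_ ≡ᶠ _ = false

_≡ᶜ_ : ∀ {h} → Vec Bool h → Vec Bool h → Bool
[] ≡ᶜ [] = true
(true ∷ p) ≡ᶜ (true ∷ q) = p ≡ᶜ q
(false ∷ p) ≡ᶜ (false ∷ q) = p ≡ᶜ q
_ ≡ᶜ _ = false

-- When row `a` is being visited, its neighbour across a cut is already visited exactly if it came
-- first. The order bits of the two cuts thus give the number of unvisited neighbours.
options : ∀ {h} → Column h → Column h → Fin h → List (Fin h) → ℕ
options ν λₗ a rs =
  (if lookup λₗ a then 0 else 1) + (length rs + (if lookup ν a then 0 else 1))

-- The sets that `merge ν c λₗ` can take as `c` varies: rows of `λₗ` are out, other rows of `ν` are
-- in, and the remaining rows are free.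
between : ∀ {h} → Column h → Column h → List (Column h)
between [] [] = [] ∷ []
between (true ∷ λₗ) (_ ∷ ν) = map (false ∷_) (between λₗ ν)
between (false ∷ λₗ) (true ∷ ν) = map (true ∷_) (between λₗ ν)
between (false ∷ λₗ) (false ∷ ν) = concatMap (λ μ → (false ∷ μ) ∷ (true ∷ μ) ∷ []) (between λₗ ν)

newRows : ∀ {h} → Column h → Column h → List (Fin h)
newRows ν μ = filterᵇ (λ b → lookup μ b ∧ not (lookup ν b)) (allFin _)

-- What happens in the columns to the right is not known yet, so every conceivable return is
-- guessed: its row and the resulting order bits. The guess becomes part of the transcript demanded
-- at the next cut, and `leave` verifies it there.
replies : ∀ {h} → Column h → Column h → List (Fin h × Column h)
replies λₗ ν = concatMap (λ μ → map (_, μ) (newRows ν μ)) (between λₗ ν)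

Weighted : Set → Set
Weighted A = List (ℕ × A)

scale : ∀ {A : Set} → ℕ → Weighted A → Weighted A
scale m = map λ (d , x) → m ℕ.* d , x

relabel : ∀ {A B : Set} → (A → B) → Weighted A → Weighted B
relabel f = map λ (d , x) → d , f x

ending : ∀ {h} → Goal h → Weighted (Test h)
ending end = (1 , stop) ∷ []
ending (exit _ _ _) = []

escape : ∀ {h} → Column h → Fin h → Goal h → Weighted (Test h)
escape λₗ a end = (1 , enter λₗ a end) ∷ []
escape λₗ a (exit _ _ _) = []

-- expand T η c ν lists the ways to meet the transcript T at the left cut of a
-- column, together with the transcripts they need at its right cut; an entry
-- (d , U) has weight 1/d. The visited rows of the column are c, and η and ν mark
-- the rows that the right side visited first at the left and the right cut. The
-- argument k of explore bounds the number of rows still to be visited.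
mutual
  expand : ∀ {h} → Test h → Column h → Column h → Column h → Weighted (Test h)
  expand stop η c ν = (1 , stop) ∷ []
  expand {h} (enter λₗ a g) η c ν = explore h g η c ν λₗ a

  explore : ∀ {h} → ℕ → Goal h → Column h → Column h → Column h → Column h → Fin h → Weighted (Test h)
  explore zero g η c ν λₗ a = []
  explore (suc k) g η c ν λₗ a = visit k g η (mark a c) ν λₗ a (mark a c ∖ ν) (freeRows (mark a c) a)

  visit : ∀ {h} → ℕ → Goal h → Column h → Column h → Column h → Column h → Fin h →
          Column h → List (Fin h) → Weighted (Test h)
  visit k g η c ν λₗ a λᵣ rs =
    ending g ++ scale (options ν λₗ a rs)
      ((if lookup λₗ a then [] else leave g η c ν λₗ a)
      ++ (concatMap (explore k g η c ν λₗ) rs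
      ++ (if lookup ν a then [] else
           (escape λᵣ a g ++
            concatMap (λ (b , μ) → relabel (λ T → enter λᵣ a (exit b μ T)) (explore k g η c μ λₗ b))
              (replies λᵣ ν)))))

  leave : ∀ {h} → Goal h → Column h → Column h → Column h → Column h → Fin h → Weighted (Test h)
  leave end η c ν λₗ a = []
  leave (exit b μ T) η c ν λₗ a =
    if (a ≡ᶠ b) ∧ (merge η c λₗ ≡ᶜ μ) then expand T μ c ν else []

step : ∀ {h} → Test h → Weighted (Test h)
step T = expand T ∅ ∅ ∅

-- Finite sums

∑ : ∀ {A : Set} → List A → (A → ℚ) → ℚ
∑ [] f = 0ℚ
∑ (x ∷ xs) f = f x ℚ.+ ∑ xs f

∑-cong : ∀ {A : Set} (xs : List A) {f g : A → ℚ} → (∀ {x} → x ∈ xs → f x ≡ g x) → ∑ xs f ≡ ∑ xs g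
∑-cong [] fg = refl
∑-cong (x ∷ xs) fg = cong₂ ℚ._+_ (fg (here refl)) (∑-cong xs λ x∈ → fg (there x∈))

∑-++ : ∀ {A : Set} (xs : List A) {ys} {f : A → ℚ} → ∑ (xs ++ ys) f ≡ ∑ xs f ℚ.+ ∑ ys f
∑-++ [] = sym (ℚ.+-identityˡ _)
∑-++ (x ∷ xs) {ys} {f} = trans (cong (f x ℚ.+_) (∑-++ xs)) (sym (ℚ.+-assoc (f x) _ _))

∑-map : ∀ {A B : Set} (xs : List A) {g : A → B} {f : B → ℚ} → ∑ (map g xs) f ≡ ∑ xs (λ x → f (g x))
∑-map [] = refl
∑-map (x ∷ xs) {g} {f} = cong (f (g x) ℚ.+_) (∑-map xs)

∑-concatMap : ∀ {A B : Set} (xs : List A) {g : A → List B} {f : B → ℚ} →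
  ∑ (concatMap g xs) f ≡ ∑ xs (λ x → ∑ (g x) f)
∑-concatMap [] = refl
∑-concatMap (x ∷ xs) {g} {f} = trans (∑-++ (g x)) (cong (∑ (g x) f ℚ.+_) (∑-concatMap xs))

∑-0 : ∀ {A : Set} (xs : List A) → ∑ xs (λ _ → 0ℚ) ≡ 0ℚ
∑-0 [] = refl
∑-0 (x ∷ xs) = trans (ℚ.+-identityˡ _) (∑-0 xs)

module _ where
  open +-*-Solver

  interchange : ∀ a b c d e → (c * a ℚ.+ b) ℚ.+ (c * d ℚ.+ e) ≡ c * (a ℚ.+ d) ℚ.+ (b ℚ.+ e)
  interchange = solve 5 (λ a b c d e → (c :* a :+ b) :+ (c :* d :+ e) := c :* (a :+ d) :+ (b :+ e)) refl

∑-linear : ∀ {A : Set} (xs : List A) c {f g : A → ℚ} →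
  ∑ xs (λ x → c * f x ℚ.+ g x) ≡ c * ∑ xs f ℚ.+ ∑ xs g
∑-linear [] c = sym (trans (ℚ.+-identityʳ _) (ℚ.*-zeroʳ c))
∑-linear (x ∷ xs) c {f} {g} = trans (cong ((c * f x ℚ.+ g x) ℚ.+_) (∑-linear xs c)) (interchange (f x) (g x) c _ _)

∑-*ˡ : ∀ {A : Set} (xs : List A) c {f : A → ℚ} → ∑ xs (λ x → c * f x) ≡ c * ∑ xs f
∑-*ˡ [] c = sym (ℚ.*-zeroʳ c)
∑-*ˡ (x ∷ xs) c {f} = trans (cong (c * f x ℚ.+_) (∑-*ˡ xs c)) (sym (ℚ.*-distribˡ-+ c (f x) _))

1/′-* : ∀ m n → 1/′ (m ℕ.* n) ≡ 1/′ m * 1/′ n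
1/′-* zero n = sym (ℚ.*-zeroˡ (1/′ n))
1/′-* (suc m) zero = trans (cong 1/′_ (ℕ.*-zeroʳ m)) (sym (ℚ.*-zeroʳ (1/′ suc m)))
1/′-* (suc m) (suc n) = ℚ.toℚᵘ-injective (begin
  ℚ.toℚᵘ (+ 1 / (suc m ℕ.* suc n))                     ≈⟨ ℚ.toℚᵘ-fromℚᵘ (ℚᵘ.mkℚᵘ (+ 1) _) ⟩
  ℚᵘ.mkℚᵘ (+ 1) m ℚᵘ.* ℚᵘ.mkℚᵘ (+ 1) n                 ≈⟨ ℚᵘ.*-cong (ℚᵘ.≃-sym (ℚ.toℚᵘ-fromℚᵘ (ℚᵘ.mkℚᵘ (+ 1) m))) (ℚᵘ.≃-sym (ℚ.toℚᵘ-fromℚᵘ (ℚᵘ.mkℚᵘ (+ 1) n))) ⟩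
  ℚ.toℚᵘ (1/′ suc m) ℚᵘ.* ℚ.toℚᵘ (1/′ suc n)           ≈⟨ ℚᵘ.≃-sym (ℚ.toℚᵘ-homo-* (1/′ suc m) (1/′ suc n)) ⟩
  ℚ.toℚᵘ (1/′ suc m * 1/′ suc n)                     ∎)
  where open ℚᵘ.≃-Reasoning

⟨_,_⟩ : ∀ {A : Set} → Weighted A → (A → ℚ) → ℚ
⟨ ws , f ⟩ = ∑ ws λ (d , x) → 1/′ d * f x

⟨scale⟩ : ∀ {A : Set} m (ws : Weighted A) {f : A → ℚ} → ⟨ scale m ws , f ⟩ ≡ 1/′ m * ⟨ ws , f ⟩
⟨scale⟩ m [] = sym (ℚ.*-zeroʳ (1/′ m))
⟨scale⟩ m ((d , x) ∷ ws) {f} =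
  trans (cong₂ ℚ._+_ (trans (cong (ℚ._* f x) (1/′-* m d)) (ℚ.*-assoc (1/′ m) (1/′ d) (f x))) (⟨scale⟩ m ws))
        (sym (ℚ.*-distribˡ-+ (1/′ m) (1/′ d * f x) _))

1*-identity : ∀ x → 1/′ 1 * x ℚ.+ 0ℚ ≡ x
1*-identity x = trans (ℚ.+-identityʳ _) (ℚ.*-identityˡ x)

-- Regions of columns

-- For each column: the visited rows, and the rows in which the vertex to the right
-- was visited first.
Region : ℕ → ℕ → Set
Region h zero    = ⊤
Region h (suc n) = Column h × Column h × Region h n

fresh : ∀ {h} n → Region h n
fresh zero    = tt
fresh (suc n) = ∅ , ∅ , fresh n

front : ∀ {h} n → Region h n → Column h
front zero    _       = ∅
front (suc n) (c , _) = c

module _ {h : ℕ} where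

  Exits : ℕ → Set
  Exits n = Fin h → Region h n → ℚ

  -- The weight of the walks entering a region of n columns from the left in row a:
  -- e for each vertex they visit, κ b st when they leave it to the left from row b,
  -- and nothing when they run off its right end.
  mutual
    value : ∀ n → ℚ → Exits n → Region h n → Column h → Fin h → ℚ
    value zero    e κ st λₗ a = 0ℚ
    value (suc n) e κ (c , ν , st) λₗ a = column n h e κ c ν st λₗ a

    -- Every visit to the column uses up one of its rows, so starting the counter at `h` loses no
    -- walk. It also carries on through excursions to the right, which makes the recursion
    -- structural.
    column : ∀ n → ℕ → ℚ → Exits (suc n) → Column h → Column h → Region h n → Column h → Fin h → ℚ
    column n zero    e κ c ν st λₗ a = 0ℚ
    column n (suc k) e κ c ν st λₗ a = atRow n k e κ (mark a c) ν st λₗ a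

    atRow : ∀ n → ℕ → ℚ → Exits (suc n) → Column h → Column h → Region h n → Column h → Fin h → ℚ
    atRow n k e κ c ν st λₗ a =
      e ℚ.+ 1/′ (options ν λₗ a (freeRows c a)) ℚ.*
        ((if lookup λₗ a then 0ℚ else κ a (c , ν , st)) ℚ.+
         (∑ (freeRows c a) (column n k e κ c ν st λₗ) ℚ.+
          (if lookup ν a then 0ℚ else value n e (resume n k e κ c ν λₗ) st (c ∖ ν) a)))

    -- The guard asks that row `b` is unvisited in this column and was reached by the excursion just
    -- made. Returns of actual walks always satisfy it; it restricts the terms to those listed by
    -- `replies`.
    resume : ∀ n → ℕ → ℚ → Exits (suc n) → Column h → Column h → Column h → Exits n
    resume n k e κ c ν λₗ b st =
      if lookup (merge ν (front n st) (c ∖ ν)) b ∧ not (lookup ν b)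
      then column n k e κ c (merge ν (front n st) (c ∖ ν)) st λₗ b
      else 0ℚ

  -- The weight of the behaviours of the region that agree with a transcript.
  mutual
    score : ∀ n → Column h → Region h n → Test h → ℚ
    score n ν st stop           = 1ℚ
    score n ν st (enter λₗ a g) = value n (endings g) (exits n g ν λₗ) st λₗ a

    endings : Goal h → ℚ
    endings end          = 1ℚ
    endings (exit _ _ _) = 0ℚ

    exits : ∀ n → Goal h → Column h → Column h → Exits n
    exits n end          ν λₗ a st = 0ℚ
    exits n (exit b μ T) ν λₗ a st =
      if (a ≡ᶠ b) ∧ (merge ν (front n st) λₗ ≡ᶜ μ) then score n μ st T else 0ℚ

  if-linear : ∀ p x {X Y Z} → X ≡ x * Y ℚ.+ Z →
    (if p then 0ℚ else X) ≡ x * (if p then 0ℚ else Y) ℚ.+ (if p then 0ℚ else Z)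
  if-linear true  x eq = sym (trans (ℚ.+-identityʳ _) (ℚ.*-zeroʳ x))
  if-linear false x eq = eq

  linear-lemma : ∀ x w e₁ e₂ l₁ l₂ s₁ s₂ r₁ r₂ →
    (x * e₁ ℚ.+ e₂) ℚ.+ w * ((x * l₁ ℚ.+ l₂) ℚ.+ ((x * s₁ ℚ.+ s₂) ℚ.+ (x * r₁ ℚ.+ r₂)))
    ≡ x * (e₁ ℚ.+ w * (l₁ ℚ.+ (s₁ ℚ.+ r₁))) ℚ.+ (e₂ ℚ.+ w * (l₂ ℚ.+ (s₂ ℚ.+ r₂)))
  linear-lemma = solve 10 (λ x w e₁ e₂ l₁ l₂ s₁ s₂ r₁ r₂ →
    (x :* e₁ :+ e₂) :+ w :* ((x :* l₁ :+ l₂) :+ ((x :* s₁ :+ s₂) :+ (x :* r₁ :+ r₂)))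
    := x :* (e₁ :+ w :* (l₁ :+ (s₁ :+ r₁))) :+ (e₂ :+ w :* (l₂ :+ (s₂ :+ r₂)))) refl
    where open +-*-Solver

  mutual
    -- Linearity holds jointly in the reward `e` and the exit weights `κ`. The shape x · first +
    -- second treats sums and multiples in one induction.
    value-linear : ∀ n x {e e₁ e₂ κ κ₁ κ₂} → e ≡ x * e₁ ℚ.+ e₂ →
      (∀ b s → κ b s ≡ x * κ₁ b s ℚ.+ κ₂ b s) → ∀ st λₗ a →
      value n e κ st λₗ a ≡ x * value n e₁ κ₁ st λₗ a ℚ.+ value n e₂ κ₂ st λₗ a
    value-linear zero    x eq κ≡ st λₗ a = sym (trans (ℚ.+-identityʳ _) (ℚ.*-zeroʳ x))
    value-linear (suc n) x eq κ≡ (c , ν , st) λₗ a = column-linear n h x eq κ≡ c ν st λₗ a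

    column-linear : ∀ n k x {e e₁ e₂ κ κ₁ κ₂} → e ≡ x * e₁ ℚ.+ e₂ →
      (∀ b s → κ b s ≡ x * κ₁ b s ℚ.+ κ₂ b s) → ∀ c ν st λₗ a →
      column n k e κ c ν st λₗ a ≡ x * column n k e₁ κ₁ c ν st λₗ a ℚ.+ column n k e₂ κ₂ c ν st λₗ a
    column-linear n zero    x eq κ≡ c ν st λₗ a = sym (trans (ℚ.+-identityʳ _) (ℚ.*-zeroʳ x))
    column-linear n (suc k) x {e} {e₁} {e₂} {κ} {κ₁} {κ₂} eq κ≡ c₀ ν st λₗ a = trans
      (cong₂ (λ u v → u ℚ.+ w * v) eq
        (cong₂ ℚ._+_ (if-linear (lookup λₗ a) x (κ≡ a (c , ν , st)))
          (cong₂ ℚ._+_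
            (trans (∑-cong rs λ {r} _ → column-linear n k x eq κ≡ c ν st λₗ r) (∑-linear rs x))
            (if-linear (lookup ν a) x (value-linear n x eq resume-linear st (c ∖ ν) a)))))
      (linear-lemma x w e₁ e₂ _ _ _ _ _ _)
      where
      c = mark a c₀
      rs = freeRows c a
      w = 1/′ (options ν λₗ a rs)
      resume-linear : ∀ b s → resume n k e κ c ν λₗ b s ≡
        x * resume n k e₁ κ₁ c ν λₗ b s ℚ.+ resume n k e₂ κ₂ c ν λₗ b s
      resume-linear b s with lookup (merge ν (front n s) (c ∖ ν)) b ∧ not (lookup ν b)
      ... | true  = column-linear n k x eq κ≡ c _ s λₗ b
      ... | false = sym (trans (ℚ.+-identityʳ _) (ℚ.*-zeroʳ x))

  value-∑ : ∀ {A : Set} n (xs : List A) (w : A → ℚ) (κ : A → Exits n) st λₗ a →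
    value n 0ℚ (λ b s → ∑ xs λ x → w x * κ x b s) st λₗ a ≡ ∑ xs (λ x → w x * value n 0ℚ (κ x) st λₗ a)
  value-∑ n [] w κ st λₗ a = trans
    -- Linearity with factor -1 and all rewards and exit weights 0 gives z = -z + z, hence z = 0.
    (value-linear n (ℚ.- 1ℚ) {0ℚ} {0ℚ} {0ℚ} {λ _ _ → 0ℚ} {λ _ _ → 0ℚ} {λ _ _ → 0ℚ} refl (λ _ _ → refl) st λₗ a)
    (trans (cong (ℚ._+ z) (trans (sym (ℚ.neg-distribˡ-* 1ℚ z)) (cong ℚ.-_ (ℚ.*-identityˡ z)))) (ℚ.+-inverseˡ z))
    where z = value n 0ℚ (λ _ _ → 0ℚ) st λₗ a
  value-∑ n (x ∷ xs) w κ st λₗ a = trans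
    (value-linear n (w x) (sym (trans (ℚ.+-identityʳ _) (ℚ.*-zeroʳ (w x)))) (λ _ _ → refl) st λₗ a)
    (cong (w x * value n 0ℚ (κ x) st λₗ a ℚ.+_) (value-∑ n xs w κ st λₗ a))

-- The recursion over the columns

∑-filterᵇ : ∀ {A : Set} p (xs : List A) {f} → ∑ (filterᵇ p xs) f ≡ ∑ xs (λ x → if p x then f x else 0ℚ)
∑-filterᵇ p [] = refl
∑-filterᵇ p (x ∷ xs) {f} with p x
... | true  = cong (f x ℚ.+_) (∑-filterᵇ p xs)
... | false = trans (∑-filterᵇ p xs) (sym (ℚ.+-identityˡ _))

pick-row : ∀ {h} (b : Fin h) (f : Fin h → ℚ) → ∑ (allFin h) (λ r → if b ≡ᶠ r then f r else 0ℚ) ≡ f b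
pick-row {suc h} b f =
  trans (cong (λ rs → (if b ≡ᶠ zero then f zero else 0ℚ) ℚ.+ ∑ rs g) (sym (map-tabulate (λ i → i) suc)))
  (trans (cong ((if b ≡ᶠ zero then f zero else 0ℚ) ℚ.+_) (∑-map (allFin h))) (pick b))
  where
  g = λ r → if b ≡ᶠ r then f r else 0ℚ
  pick : ∀ b → (if b ≡ᶠ zero then f zero else 0ℚ) ℚ.+
    ∑ (allFin h) (λ r → if b ≡ᶠ suc r then f (suc r) else 0ℚ) ≡ f b
  pick zero    = trans (cong (f zero ℚ.+_) (∑-0 (allFin h))) (ℚ.+-identityʳ _)
  pick (suc b) = trans (ℚ.+-identityˡ _) (pick-row b λ r → f (suc r))

-- `merge ν c λₗ` occurs exactly once in `between λₗ ν`: a row determined by `λₗ` or `ν` offers one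
-- value, and each free row offers both.
pick-reply : ∀ {h} (λₗ ν c : Column h) (f : Column h → ℚ) →
  ∑ (between λₗ ν) (λ μ → if merge ν c λₗ ≡ᶜ μ then f μ else 0ℚ) ≡ f (merge ν c λₗ)
pick-reply [] [] [] f = ℚ.+-identityʳ _
pick-reply (true ∷ λₗ) (_ ∷ ν) (_ ∷ c) f =
  trans (∑-map (between λₗ ν)) (pick-reply λₗ ν c λ μ → f (false ∷ μ))
pick-reply (false ∷ λₗ) (true ∷ ν) (_ ∷ c) f =
  trans (∑-map (between λₗ ν)) (pick-reply λₗ ν c λ μ → f (true ∷ μ))
pick-reply (false ∷ λₗ) (false ∷ ν) (false ∷ c) f = trans (∑-concatMap (between λₗ ν))
  (trans (∑-cong (between λₗ ν) λ _ → ℚ.+-identityʳ _) (pick-reply λₗ ν c λ μ → f (false ∷ μ)))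
pick-reply (false ∷ λₗ) (false ∷ ν) (true ∷ c) f = trans (∑-concatMap (between λₗ ν))
  (trans (∑-cong (between λₗ ν) λ _ → trans (ℚ.+-identityˡ _) (ℚ.+-identityʳ _)) (pick-reply λₗ ν c λ μ → f (true ∷ μ)))

pick-exit : ∀ {h} (λₗ ν c : Column h) (b : Fin h) (f : Fin h → Column h → ℚ) →
  ∑ (replies λₗ ν) (λ (b′ , μ) → if (b ≡ᶠ b′) ∧ (merge ν c λₗ ≡ᶜ μ) then f b′ μ else 0ℚ)
  ≡ (if lookup (merge ν c λₗ) b ∧ not (lookup ν b) then f b (merge ν c λₗ) else 0ℚ)
pick-exit {h} λₗ ν c b f = trans (∑-concatMap (between λₗ ν))
  (trans (∑-cong (between λₗ ν) λ {μ} _ → inner μ)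
         (pick-reply λₗ ν c λ μ → if lookup μ b ∧ not (lookup ν b) then f b μ else 0ℚ))
  where
  swap : ∀ p q r {x : ℚ} → (if p then (if q ∧ r then x else 0ℚ) else 0ℚ) ≡
    (if q then (if r then (if p then x else 0ℚ) else 0ℚ) else 0ℚ)
  swap true  true  true  = refl
  swap true  true  false = refl
  swap true  false r     = refl
  swap false true  true  = refl
  swap false true  false = refl
  swap false false r     = refl
  inner : ∀ μ →
    ∑ (map (_, μ) (newRows ν μ)) (λ (b′ , μ) → if (b ≡ᶠ b′) ∧ (merge ν c λₗ ≡ᶜ μ) then f b′ μ else 0ℚ)
    ≡ (if merge ν c λₗ ≡ᶜ μ then (if lookup μ b ∧ not (lookup ν b) then f b μ else 0ℚ) else 0ℚ)
  inner μ = trans (∑-map (newRows ν μ)) (trans (∑-filterᵇ _ (allFin h))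
    (trans (∑-cong (allFin h) λ {r} _ → swap (lookup μ r ∧ not (lookup ν r)) (b ≡ᶠ r) (merge ν c λₗ ≡ᶜ μ))
    (pick-row b λ r → if merge ν c λₗ ≡ᶜ μ then (if lookup μ r ∧ not (lookup ν r) then f r μ else 0ℚ) else 0ℚ)))

⟨++⟩ : ∀ {A : Set} (ws : Weighted A) {ws′ f} → ⟨ ws ++ ws′ , f ⟩ ≡ ⟨ ws , f ⟩ ℚ.+ ⟨ ws′ , f ⟩
⟨++⟩ ws = ∑-++ ws

module _ {h : ℕ} where

  mutual
    score-expand : ∀ T n η c ν (st : Region h n) →
      score (suc n) η (c , ν , st) T ≡ ⟨ expand T η c ν , score n ν st ⟩
    score-expand stop            n η c ν st = sym (1*-identity 1ℚ)
    score-expand (enter λₗ a g) n η c ν st = column-explore h g n η c ν st λₗ a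

    -- Both sides follow the same recursion over the rows; only excursions to the right need an
    -- argument. Their exit weights `resume` are split into a sum over the guessed returns and the
    -- transcripts needed afterwards, and linearity takes this sum out of `value`, where each term
    -- becomes the score of one longer transcript.
    column-explore : ∀ k g n η c ν (st : Region h n) λₗ a →
      column n k (endings g) (exits (suc n) g η λₗ) c ν st λₗ a
      ≡ ⟨ explore k g η c ν λₗ a , score n ν st ⟩
    column-explore zero    g n η c  ν st λₗ a = refl
    column-explore (suc k) g n η c₀ ν st λₗ a = begin
      endings g ℚ.+ w * (lhs₁ ℚ.+ (lhs₂ ℚ.+ lhs₃))
        ≡⟨ cong₂ (λ u v → u ℚ.+ w * v) (ending≡ g) (cong₂ ℚ._+_ left≡ (cong₂ ℚ._+_ rows≡ right≡)) ⟩
      ⟨ ending g , X ⟩ ℚ.+ w * (⟨ lefts , X ⟩ ℚ.+ (⟨ ups , X ⟩ ℚ.+ ⟨ rights , X ⟩))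
        ≡⟨ cong (λ u → ⟨ ending g , X ⟩ ℚ.+ w * (⟨ lefts , X ⟩ ℚ.+ u)) (⟨++⟩ ups) ⟨
      ⟨ ending g , X ⟩ ℚ.+ w * (⟨ lefts , X ⟩ ℚ.+ ⟨ ups ++ rights , X ⟩)
        ≡⟨ cong (λ u → ⟨ ending g , X ⟩ ℚ.+ w * u) (⟨++⟩ lefts) ⟨
      ⟨ ending g , X ⟩ ℚ.+ w * ⟨ lefts ++ (ups ++ rights) , X ⟩
        ≡⟨ cong (⟨ ending g , X ⟩ ℚ.+_) (⟨scale⟩ m (lefts ++ (ups ++ rights))) ⟨
      ⟨ ending g , X ⟩ ℚ.+ ⟨ scale m (lefts ++ (ups ++ rights)) , X ⟩
        ≡⟨ ⟨++⟩ (ending g) ⟨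
      ⟨ ending g ++ scale m (lefts ++ (ups ++ rights)) , X ⟩ ∎
      where
      open ≡-Reasoning
      X = score n ν st
      c = mark a c₀
      λᵣ = c ∖ ν
      rs = freeRows c a
      m = options ν λₗ a rs
      w = 1/′ m
      e = endings g
      κ = exits (suc n) g η λₗ
      lefts = if lookup λₗ a then [] else leave g η c ν λₗ a
      ups = concatMap (explore k g η c ν λₗ) rs
      returns = concatMap (λ (b , μ) → relabel (λ T → enter λᵣ a (exit b μ T)) (explore k g η c μ λₗ b))
        (replies λᵣ ν)
      rights = if lookup ν a then [] else (escape λᵣ a g ++ returns)
      lhs₁ = if lookup λₗ a then 0ℚ else κ a (c , ν , st)
      lhs₂ = ∑ rs (column n k e κ c ν st λₗ)
      lhs₃ = if lookup ν a then 0ℚ else value n e (resume n k e κ c ν λₗ) st λᵣ a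

      ending≡ : ∀ g → endings g ≡ ⟨ ending g , X ⟩
      ending≡ end          = sym (1*-identity 1ℚ)
      ending≡ (exit _ _ _) = refl

      leave≡ : ∀ g → exits (suc n) g η λₗ a (c , ν , st) ≡ ⟨ leave g η c ν λₗ a , X ⟩
      leave≡ end          = refl
      leave≡ (exit b μ T) with (a ≡ᶠ b) ∧ (merge η c λₗ ≡ᶜ μ)
      ... | true  = score-expand T n μ c ν st
      ... | false = refl

      left≡ : lhs₁ ≡ ⟨ lefts , X ⟩
      left≡ with lookup λₗ a
      ... | true  = refl
      ... | false = leave≡ g

      rows≡ : lhs₂ ≡ ⟨ ups , X ⟩
      rows≡ = trans (∑-cong rs λ {r} _ → column-explore k g n η c ν st λₗ r) (sym (∑-concatMap rs))

      answer : Fin h → Column h → Exits n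
      answer b′ μ b s = ∑ (explore k g η c μ λₗ b′) λ (d , T) → 1/′ d * exits n (exit b′ μ T) ν λᵣ b s

      pull : ∀ p (ws : Weighted (Test h)) (f : Test h → ℚ) →
        ∑ ws (λ (d , T) → 1/′ d * (if p then f T else 0ℚ)) ≡ (if p then ⟨ ws , f ⟩ else 0ℚ)
      pull true  ws f = refl
      pull false ws f = trans (∑-cong ws λ {(d , _)} _ → ℚ.*-zeroʳ (1/′ d)) (∑-0 ws)

      resume≡ : ∀ b s → resume n k e κ c ν λₗ b s ≡ ∑ (replies λᵣ ν) (λ (b′ , μ) → 1ℚ * answer b′ μ b s)
      resume≡ b s = begin
        (if ok then column n k e κ c x s λₗ b else 0ℚ)
          ≡⟨ cong (λ u → if ok then u else 0ℚ) (column-explore k g n η c x s λₗ b) ⟩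
        (if ok then ⟨ explore k g η c x λₗ b , score n x s ⟩ else 0ℚ)
          ≡⟨ pick-exit λᵣ ν (front n s) b (λ b μ → ⟨ explore k g η c μ λₗ b , score n μ s ⟩) ⟨
        ∑ (replies λᵣ ν) (λ (b′ , μ) → if (b ≡ᶠ b′) ∧ (x ≡ᶜ μ) then ⟨ explore k g η c μ λₗ b′ , score n μ s ⟩ else 0ℚ)
          ≡⟨ ∑-cong (replies λᵣ ν) (λ {(b′ , μ)} _ → trans (ℚ.*-identityˡ _)
               (pull ((b ≡ᶠ b′) ∧ (x ≡ᶜ μ)) (explore k g η c μ λₗ b′) (score n μ s))) ⟨
        ∑ (replies λᵣ ν) (λ (b′ , μ) → 1ℚ * answer b′ μ b s) ∎
        where
        x = merge ν (front n s) λᵣ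
        ok = lookup x b ∧ not (lookup ν b)

      escape≡ : ∀ g → value n (endings g) (λ _ _ → 0ℚ) st λᵣ a ≡ ⟨ escape λᵣ a g , X ⟩
      escape≡ end          = sym (1*-identity _)
      -- The empty sum in `value-∑` shows that no reward and no exit weight give the value 0.
      escape≡ (exit _ _ _) = value-∑ n ([] {A = ℕ}) (λ _ → 0ℚ) (λ _ _ _ → 0ℚ) st λᵣ a

      answer≡ : ∀ b μ → value n 0ℚ (answer b μ) st λᵣ a
        ≡ ⟨ relabel (λ T → enter λᵣ a (exit b μ T)) (explore k g η c μ λₗ b) , X ⟩
      answer≡ b μ = trans
        (value-∑ n (explore k g η c μ λₗ b) (λ (d , _) → 1/′ d) (λ (_ , T) → exits n (exit b μ T) ν λᵣ) st λᵣ a)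
        (sym (∑-map (explore k g η c μ λₗ b)))

      right≡ : lhs₃ ≡ ⟨ rights , X ⟩
      right≡ with lookup ν a
      ... | true  = refl
      ... | false = begin
        value n e (resume n k e κ c ν λₗ) st λᵣ a
          ≡⟨ value-linear n 1ℚ {κ₂ = λ b s → ∑ (replies λᵣ ν) (λ (b′ , μ) → 1ℚ * answer b′ μ b s)}
               (sym (trans (ℚ.+-identityʳ _) (ℚ.*-identityˡ e)))
               (λ b s → trans (resume≡ b s) (sym (ℚ.+-identityˡ _))) st λᵣ a ⟩
        1ℚ * value n e (λ _ _ → 0ℚ) st λᵣ a ℚ.+ value n 0ℚ _ st λᵣ a
          ≡⟨ cong₂ ℚ._+_ (trans (ℚ.*-identityˡ _) (escape≡ g))
               (value-∑ n (replies λᵣ ν) (λ _ → 1ℚ) (λ (b , μ) → answer b μ) st λᵣ a) ⟩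
        ⟨ escape λᵣ a g , X ⟩ ℚ.+ ∑ (replies λᵣ ν) (λ (b , μ) → 1ℚ * value n 0ℚ (answer b μ) st λᵣ a)
          ≡⟨ cong (⟨ escape λᵣ a g , X ⟩ ℚ.+_)
               (trans (∑-cong (replies λᵣ ν) λ {(b , μ)} _ → trans (ℚ.*-identityˡ _) (answer≡ b μ))
                      (sym (∑-concatMap (replies λᵣ ν)))) ⟩
        ⟨ escape λᵣ a g , X ⟩ ℚ.+ ⟨ returns , X ⟩
          ≡⟨ ⟨++⟩ (escape λᵣ a g) ⟨
        ⟨ escape λᵣ a g ++ returns , X ⟩ ∎

  score-step : ∀ T n → score (suc n) ∅ (fresh (suc n)) T ≡ ⟨ step T , score n ∅ (fresh n) ⟩
  score-step T n = score-expand T n ∅ ∅ ∅ (fresh n)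

-- Neighbours

∑-↭ : ∀ {A : Set} {xs ys : List A} (f : A → ℚ) → xs ↭ ys → ∑ xs f ≡ ∑ ys f
∑-↭ f ↭.refl = refl
∑-↭ f (↭.prep x p) = cong (f x ℚ.+_) (∑-↭ f p)
∑-↭ f (↭.swap {xs} {ys} x y p) =
  trans (sym (ℚ.+-assoc (f x) (f y) (∑ xs f)))
  (trans (cong₂ ℚ._+_ (ℚ.+-comm (f x) (f y)) (∑-↭ f p)) (ℚ.+-assoc (f y) (f x) (∑ ys f)))
∑-↭ f (↭.trans p q) = trans (∑-↭ f p) (∑-↭ f q)

squares≡1 : ∀ p q → p ^ 2 + q ^ 2 ≡ 1 → (p ≡ 1 × q ≡ 0) ⊎ (p ≡ 0 × q ≡ 1)
squares≡1 zero          (suc zero)    eq = inj₂ (refl , refl)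
squares≡1 zero          (suc (suc q)) ()
squares≡1 (suc zero)    zero          eq = inj₁ (refl , refl)
squares≡1 (suc (suc p)) q             ()

∣-∣≡1 : ∀ m n → ∣ m - n ∣ ≡ 1 → n ≡ suc m ⊎ m ≡ suc n
∣-∣≡1 zero    n       eq = inj₁ eq
∣-∣≡1 (suc m) zero    eq = inj₂ eq
∣-∣≡1 (suc m) (suc n) eq with ∣-∣≡1 m n eq
... | inj₁ n≡ = inj₁ (cong suc n≡)
... | inj₂ m≡ = inj₂ (cong suc m≡)

∣n-1+n∣≡1 : ∀ n → ∣ n - suc n ∣ ≡ 1
∣n-1+n∣≡1 zero    = refl
∣n-1+n∣≡1 (suc n) = ∣n-1+n∣≡1 n

∈-filterᵇ⁻ : ∀ {A : Set} (p : A → Bool) {x} xs → x ∈ filterᵇ p xs → x ∈ xs × p x ≡ true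
∈-filterᵇ⁻ p (y ∷ xs) x∈ with p y in eq
∈-filterᵇ⁻ p (y ∷ xs) (here refl) | true = here refl , eq
∈-filterᵇ⁻ p (y ∷ xs) (there x∈)  | true = let x∈xs , px = ∈-filterᵇ⁻ p xs x∈ in there x∈xs , px
∈-filterᵇ⁻ p (y ∷ xs) x∈          | false = let x∈xs , px = ∈-filterᵇ⁻ p xs x∈ in there x∈xs , px

∈-filterᵇ⁺ : ∀ {A : Set} (p : A → Bool) {x xs} → x ∈ xs → p x ≡ true → x ∈ filterᵇ p xs
∈-filterᵇ⁺ p {x} (here refl) px with p x
∈-filterᵇ⁺ p (here refl) refl | true = here refl
∈-filterᵇ⁺ p {xs = y ∷ xs} (there x∈) px with p y
... | true  = there (∈-filterᵇ⁺ p x∈ px)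
... | false = ∈-filterᵇ⁺ p x∈ px

module _ {h : ℕ} where

  open DecMembership (_≟ᵛ_ {h}) using (_∈?_)

  visited : List (Vertex h) → Vertex h → Bool
  visited V v = does (v ∈? V)

  leftNeighbour : Vertex h → List (Vertex h)
  leftNeighbour (zero  , a) = []
  leftNeighbour (suc x , a) = (x , a) ∷ []

  neighbourList : Vertex h → List (Vertex h)
  neighbourList (x , a) = leftNeighbour (x , a) ++ (map (x ,_) (filterᵇ (beside a) (allFin h)) ++ (suc x , a) ∷ [])

  beside-true : ∀ (a r : Fin h) → ∣ toℕ a - toℕ r ∣ ≡ 1 → beside a r ≡ true
  beside-true a r eq rewrite eq = refl

  true-beside : ∀ (a r : Fin h) → beside a r ≡ true → ∣ toℕ a - toℕ r ∣ ≡ 1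
  true-beside a r eq with ∣ toℕ a - toℕ r ∣
  true-beside a r eq | suc zero = refl

  distance²-right : ∀ x (a : Fin h) → distance² (x , a) (suc x , a) ≡ 1
  distance²-right x a rewrite ∣n-1+n∣≡1 x | ℕ.∣n-n∣≡0 (toℕ a) = refl

  distance²-left : ∀ x (a : Fin h) → distance² (suc x , a) (x , a) ≡ 1
  distance²-left x a rewrite ℕ.∣-∣-comm (suc x) x | ∣n-1+n∣≡1 x | ℕ.∣n-n∣≡0 (toℕ a) = refl

  ∈-neighbourList⁺ : ∀ v w → Adjacent v w → w ∈ neighbourList v
  ∈-neighbourList⁺ (x , a) (x′ , r) vw with squares≡1 ∣ x - x′ ∣ ∣ toℕ a - toℕ r ∣ vw
  ... | inj₂ (x≡ , a~r) with refl ← ℕ.∣m-n∣≡0⇒m≡n {x} {x′} x≡ =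
    ∈-++⁺ʳ (leftNeighbour (x , a)) (∈-++⁺ˡ (∈-map⁺ (x ,_) (∈-filterᵇ⁺ (beside a) (∈-allFin r) (beside-true a r a~r))))
  ... | inj₁ (x~x′ , a≡) with Fin.toℕ-injective (ℕ.∣m-n∣≡0⇒m≡n {toℕ a} a≡) | ∣-∣≡1 x x′ x~x′
  ...   | refl | inj₁ refl =
    ∈-++⁺ʳ (leftNeighbour (x , a)) (∈-++⁺ʳ (map (x ,_) (filterᵇ (beside a) (allFin h))) (here refl))
  ...   | refl | inj₂ refl = here refl

  ∈-neighbourList⁻ : ∀ v w → w ∈ neighbourList v → Adjacent v w
  ∈-neighbourList⁻ (x , a) w w∈ with ∈-++⁻ (leftNeighbour (x , a)) w∈
  ∈-neighbourList⁻ (suc x , a) _ _ | inj₁ (here refl) = distance²-left x a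
  ... | inj₂ w∈′ with ∈-++⁻ (map (x ,_) (filterᵇ (beside a) (allFin h))) w∈′
  ...   | inj₂ (here refl) = distance²-right x a
  ...   | inj₁ w∈″ with ∈-map⁻ (x ,_) w∈″
  ...     | r , r∈ , refl
    rewrite ℕ.∣n-n∣≡0 x | true-beside a r (proj₂ (∈-filterᵇ⁻ (beside a) (allFin h) r∈)) = refl

  neighbourList-unique : ∀ v → Unique (neighbourList v)
  neighbourList-unique (x , a) = Unique.++⁺ (left! x) (Unique.++⁺
      (Unique.map⁺ (cong proj₂) (Unique.filter⁺ _ (Unique.allFin⁺ h))) ([] ∷ [])
      λ { (w∈ , here refl) → case ∈-map⁻ (x ,_) w∈ of λ { (_ , _ , ()) } })
    (disjoint x)
    where
    left! : ∀ x → Unique (leftNeighbour (x , a))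
    left! zero    = []
    left! (suc x) = [] ∷ []
    disjoint : ∀ x {w} → ¬ (w ∈ leftNeighbour (x , a) × w ∈ map (x ,_) (filterᵇ (beside a) (allFin h)) ++ (suc x , a) ∷ [])
    disjoint (suc x) (here refl , w∈) with ∈-++⁻ (map (suc x ,_) (filterᵇ (beside a) (allFin h))) w∈
    ... | inj₁ w∈′ = case ∈-map⁻ (suc x ,_) w∈′ of λ { (_ , _ , ()) }
    ... | inj₂ (here ())
    ... | inj₂ (there ())

  neighbours↭ : ∀ v → neighbours v ↭ neighbourList v
  neighbours↭ v = ∼bag⇒↭ (unique∧set⇒bag (neighbours-unique v) (neighbourList-unique v)
    (λ {w} → mk⇔ (λ w∈ → ∈-neighbourList⁺ v w (∈-neighbours⁻ {v = v} w∈)) (λ w∈ → ∈-neighbours⁺ {v = v} (∈-neighbourList⁻ v w w∈))))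

  -- Counting the missing left neighbours of column 0 as visited lets the boundary of the grid be
  -- treated as a cut with order bits `full`.
  leftVisited : List (Vertex h) → Vertex h → Bool
  leftVisited V (zero  , a) = true
  leftVisited V (suc x , a) = visited V (x , a)

  -- The order bits are compared with the visited vertices in row `a` only, since in rows visited
  -- earlier they may differ.
  unvisitedNeighbours↭ : ∀ V x a (c ν λₗ : Column h) →
    (∀ r → lookup c r ≡ visited V (x , r)) →
    lookup ν a ≡ visited V (suc x , a) → lookup λₗ a ≡ leftVisited V (x , a) →
    unvisitedNeighbours V (x , a) ↭
      (if lookup λₗ a then [] else leftNeighbour (x , a)) ++
      (map (x ,_) (freeRows c a) ++ (if lookup ν a then [] else (suc x , a) ∷ []))
  unvisitedNeighbours↭ V x a c ν λₗ c≡ ν≡ λ≡ = ↭-trans (filter-↭ P? (neighbours↭ (x , a)))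
    (subst (_↭ _) (sym eq) ↭-refl)
    where
    P? = λ (u : Vertex h) → ¬? (u ∈? V)
    rows = filterᵇ (beside a) (allFin h)
    open ≡-Reasoning

    left≡ : ∀ x → lookup λₗ a ≡ leftVisited V (x , a) →
      filter P? (leftNeighbour (x , a)) ≡ (if lookup λₗ a then [] else leftNeighbour (x , a))
    left≡ zero    eq rewrite eq = refl
    left≡ (suc x) eq rewrite eq with visited V (x , a)
    ... | true  = refl
    ... | false = refl

    right≡ : filter P? ((suc x , a) ∷ []) ≡ (if lookup ν a then [] else (suc x , a) ∷ [])
    right≡ rewrite ν≡ with visited V (suc x , a)
    ... | true  = refl
    ... | false = refl

    rows≡ : ∀ rs → filter P? (map (x ,_) (filterᵇ (beside a) rs)) ≡
      map (x ,_) (filterᵇ (λ r → beside a r ∧ not (lookup c r)) rs)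
    rows≡ [] = refl
    rows≡ (r ∷ rs) with beside a r
    ... | false = rows≡ rs
    ... | true rewrite c≡ r with visited V (x , r)
    ...   | true  = rows≡ rs
    ...   | false = cong ((x , r) ∷_) (rows≡ rs)

    eq : filter P? (neighbourList (x , a)) ≡
      (if lookup λₗ a then [] else leftNeighbour (x , a)) ++
      (map (x ,_) (freeRows c a) ++ (if lookup ν a then [] else (suc x , a) ∷ []))
    eq = trans (filter-++ P? (leftNeighbour (x , a)) _)
      (cong₂ _++_ (left≡ x λ≡) (trans (filter-++ P? (map (x ,_) rows) _) (cong₂ _++_ (rows≡ (allFin h)) right≡)))

-- The walk and the regions

true≢false : ∀ {p} → p ≡ true → p ≡ false → ⊥
true≢false refl ()

false-if : ∀ {p q} → (p ≡ true → q ≡ true) → q ≡ false → p ≡ false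
false-if {true}  pq q≡ = trans (sym (pq refl)) q≡
false-if {false} pq q≡ = refl

if-true : ∀ {A : Set} {p} {x y : A} → p ≡ true → (if p then x else y) ≡ x
if-true refl = refl

does⇒ : ∀ {A : Set} (a? : Dec A) → does a? ≡ true → A
does⇒ (yes a) eq = a

unmarked : ∀ {h} → Column h → ℕ
unmarked []          = 0
unmarked (true ∷ c)  = unmarked c
unmarked (false ∷ c) = suc (unmarked c)

unmarked≤h : ∀ {h} (c : Column h) → unmarked c ≤ h
unmarked≤h []          = z≤n
unmarked≤h (true ∷ c)  = ℕ.m≤n⇒m≤1+n (unmarked≤h c)
unmarked≤h (false ∷ c) = s≤s (unmarked≤h c)

unmarked-mark : ∀ {h} (c : Column h) a → lookup c a ≡ false → unmarked c ≡ suc (unmarked (mark a c))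
unmarked-mark (false ∷ c) zero    eq = refl
unmarked-mark (true ∷ c)  (suc a) eq = unmarked-mark c a eq
unmarked-mark (false ∷ c) (suc a) eq = cong suc (unmarked-mark c a eq)

lookup-∖ : ∀ {h} (p q : Column h) r → lookup (p ∖ q) r ≡ not (lookup q r) ∧ lookup p r
lookup-∖ p q r = lookup-zipWith _ r p q

lookup-merge : ∀ {h} (ν c λₗ : Column h) r →
  lookup (merge ν c λₗ) r ≡ not (lookup λₗ r) ∧ (lookup ν r ∨ lookup c r)
lookup-merge ν c λₗ r = trans (lookup-∖ (ν ∪ c) λₗ r) (cong (not (lookup λₗ r) ∧_) (lookup-zipWith _ r ν c))

module _ {h : ℕ} where

  open DecMembership (_≟ᵛ_ {h}) using (_∈?_)

  -- The expected number of those among the first f vertices of the walk that come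
  -- before its first visit to column N.
  visits : ℕ → ℕ → List (Vertex h) → Vertex h → ℚ
  visits N zero    V v = 0ℚ
  visits N (suc f) V v = if proj₁ v <ᵇ N
    then 1ℚ ℚ.+ 1/′ (length (unvisitedNeighbours (v ∷ V) v)) ℚ.*
      ∑ (unvisitedNeighbours (v ∷ V) v) (visits N f (v ∷ V))
    else 0ℚ

  mutual
    -- A number of steps after which `visits` has reached the value that `value` assigns to a region
    -- of `n` columns. It copies the recursion of `value`; `g` is the number of steps needed once
    -- the region has been left to the left.
    valueBound : ℕ → ℕ → ℕ
    valueBound zero    g = 0
    valueBound (suc n) g = columnBound n h g

    columnBound : ℕ → ℕ → ℕ → ℕ
    columnBound n zero    g = 0
    columnBound n (suc j) g = suc (g ⊔ (columnBound n j g ⊔ valueBound n (columnBound n j g)))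

  visited-here : ∀ V v → visited (v ∷ V) v ≡ true
  visited-here V v = dec-true (v ∈? (v ∷ V)) (here refl)

  visited-there : ∀ V v u → u ≢ v → visited (v ∷ V) u ≡ visited V u
  visited-there V v u u≢v = does-⇔ (mk⇔ (λ { (here u≡) → contradiction u≡ u≢v ; (there u∈) → u∈ }) there)
    (u ∈? (v ∷ V)) (u ∈? V)

  visited-mono : ∀ V v u → visited V u ≡ true → visited (v ∷ V) u ≡ true
  visited-mono V v u eq = dec-true (u ∈? (v ∷ V)) (there (does⇒ (u ∈? V) eq))

  record Extends (k : ℕ) (V V′ : List (Vertex h)) : Set where
    field
      mono : ∀ v → visited V v ≡ true → visited V′ v ≡ true
      keep : ∀ v → proj₁ v < k → visited V′ v ≡ visited V v
  open Extends

  extends-trans : ∀ {k l V V′ V″} → k ≤ l → Extends k V V′ → Extends l V′ V″ → Extends k V V″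
  extends-trans k≤l e e′ .mono v v∈ = mono e′ v (mono e v v∈)
  extends-trans k≤l e e′ .keep v v< = trans (keep e′ v (ℕ.<-≤-trans v< k≤l)) (keep e v v<)

  extends-∷ : ∀ k V a → Extends k V ((k , a) ∷ V)
  extends-∷ k V a .mono = visited-mono V (k , a)
  extends-∷ k V a .keep u u<k = visited-there V (k , a) u λ { refl → ℕ.<-irrefl refl u<k }

  -- `ν` has to be exact only in rows still unvisited in column `k`. In visited rows it records an
  -- order of visits, which membership in `V` does not show. The second clause makes `ν` false
  -- wherever the right vertex is unvisited, and this gives the next column its `LeftView`.
  Describes : ∀ n → ℕ → List (Vertex h) → Region h n → Set
  Describes zero    k V _            = ⊤
  Describes (suc n) k V (c , ν , st) =
    (∀ r → lookup c r ≡ visited V (k , r)) ×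
    (∀ r → lookup ν r ≡ true → visited V (suc k , r) ≡ true) ×
    (∀ r → lookup c r ≡ false → lookup ν r ≡ visited V (suc k , r)) ×
    Describes n (suc k) V st

  describes-resp : ∀ n k {V V′} st → (∀ v → k ≤ proj₁ v → visited V′ v ≡ visited V v) →
    Describes n k V st → Describes n k V′ st
  describes-resp zero    k st V≡ d = tt
  describes-resp (suc n) k (c , ν , st) V≡ (c≡ , ν⇒ , ν≡ , d) =
    (λ r → trans (c≡ r) (sym (V≡ (k , r) ℕ.≤-refl))) ,
    (λ r p → trans (V≡ (suc k , r) (ℕ.n≤1+n k)) (ν⇒ r p)) ,
    (λ r p → trans (ν≡ r p) (sym (V≡ (suc k , r) (ℕ.n≤1+n k)))) ,
    describes-resp n (suc k) st (λ v k<v → V≡ v (ℕ.<⇒≤ k<v)) d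

  describes-fresh : ∀ n k → Describes n k [] (fresh n)
  describes-fresh zero    k = tt
  describes-fresh (suc n) k =
    (λ r → lookup-replicate r false) ,
    (λ r p → ⊥-elim (true≢false p (lookup-replicate r false))) ,
    (λ r _ → lookup-replicate r false) ,
    describes-fresh n (suc k)

  record Excursion n k (V V′ : List (Vertex h)) (b : Fin h) (st : Region h n) : Set where
    field
      extends   : Extends k V V′
      describes : Describes n k V′ st
      front≡    : ∀ r → lookup (front n st) r ≡ visited V′ (k , r)
      new       : visited V (k , b) ≡ false
      reached   : visited V′ (k , b) ≡ true
  open Excursion

  excursion-from : ∀ {n k V V′ V″ b st} → Extends k V V′ → Excursion n k V′ V″ b st → Excursion n k V V″ b st
  excursion-from e x .extends   = extends-trans ℕ.≤-refl e (extends x)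
  excursion-from e x .describes = describes x
  excursion-from e x .front≡    = front≡ x
  excursion-from e x .new       = false-if (mono e _) (new x)
  excursion-from e x .reached   = reached x

  LeftView : ℕ → List (Vertex h) → Column h → Set
  LeftView k V λₗ = ∀ r → visited V (k , r) ≡ false → lookup λₗ r ≡ leftVisited V (k , r)

  module _ (N : ℕ) where

    -- The future of the walk as a continuation: once the region has been left to the left from row
    -- `b` in state `st`, `κ b st` is the expected number of visits still to come.
    Continues : ∀ n → ℕ → List (Vertex h) → ℕ → Exits n → Set
    Continues n k V g κ = ∀ x V′ b st f → k ≡ suc x → g ≤ f → Excursion n k V V′ b st →
      visited V′ (x , b) ≡ false → visits N f V′ (x , b) ≡ κ b st

    leftVisited-keep : ∀ {V V′ k} a → Extends k V V′ → leftVisited V′ (k , a) ≡ leftVisited V (k , a)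
    leftVisited-keep {k = zero}  a e = refl
    leftVisited-keep {k = suc k} a e = keep e (k , a) ℕ.≤-refl

    mutual
      -- The walk and the recursion make the same moves. A move to the right is covered by the claim
      -- for the remaining columns, with `resume` as the new continuation; proving that `resume` is
      -- a valid continuation uses the claim for the present column with fewer rows left.
      visits-value : ∀ n k V st λₗ a κ g → k + n ≡ N → Describes n k V st → LeftView k V λₗ →
        visited V (k , a) ≡ false → Continues n k V g κ →
        ∀ f → valueBound n g ≤ f → visits N f V (k , a) ≡ value n 1ℚ κ st λₗ a
      visits-value zero    k V st λₗ a κ g k≡ d l a∉ next zero    _ = refl
      visits-value zero    k V st λₗ a κ g k≡ d l a∉ next (suc f) _
        rewrite dec-false (k ℕ.<? N) (λ k<N → ℕ.<-irrefl (trans (sym (ℕ.+-identityʳ k)) k≡) k<N) = refl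
      visits-value (suc n) k V (c , ν , st) λₗ a κ g k≡ d l a∉ next f f≥ =
        visits-column n h k V c ν st λₗ a κ g k≡ d l a∉ (unmarked≤h c) next f f≥

      visits-column : ∀ n j k V c ν st λₗ a κ g → k + suc n ≡ N → Describes (suc n) k V (c , ν , st) →
        LeftView k V λₗ → visited V (k , a) ≡ false → unmarked c ≤ j → Continues (suc n) k V g κ →
        ∀ f → columnBound n j g ≤ f → visits N f V (k , a) ≡ column n j 1ℚ κ c ν st λₗ a
      visits-column n zero k V c ν st λₗ a κ g k≡ d l a∉ c≤ next f f≥ =
        contradiction (subst (_≤ 0) (unmarked-mark c a (trans (proj₁ d a) a∉)) c≤) λ ()
      visits-column n (suc j) k V c₀ ν st λₗ a κ g k≡ (c₀≡ , ν⇒ , ν≡ , d) l a∉ c≤ next (suc f) (s≤s f≥)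
        rewrite dec-true (k ℕ.<? N) (ℕ.<-≤-trans (ℕ.m<m+n k (s≤s z≤n)) (ℕ.≤-reflexive k≡)) =
        cong (1ℚ ℚ.+_) (cong₂ _*_ (cong 1/′_ options≡) (begin
          ∑ us F                                         ≡⟨ ∑-↭ F us↭ ⟩
          ∑ (lefts ++ (map (k ,_) rs ++ rights)) F       ≡⟨ ∑-++ lefts ⟩
          ∑ lefts F ℚ.+ ∑ (map (k ,_) rs ++ rights) F    ≡⟨ cong (∑ lefts F ℚ.+_) (∑-++ (map (k ,_) rs)) ⟩
          ∑ lefts F ℚ.+ (∑ (map (k ,_) rs) F ℚ.+ ∑ rights F)
            ≡⟨ cong₂ ℚ._+_ left≡ (cong₂ ℚ._+_ rows≡ right≡) ⟩
          _ ∎))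
        where
        open ≡-Reasoning
        v = k , a
        V₁ = v ∷ V
        c = mark a c₀
        us = unvisitedNeighbours V₁ v
        F = visits N f V₁
        rs = freeRows c a
        lefts = if lookup λₗ a then [] else leftNeighbour v
        rights = if lookup ν a then [] else (suc k , a) ∷ []
        ext = extends-∷ k V a

        other : ∀ u → proj₁ u ≢ k → visited V₁ u ≡ visited V u
        other u u≢ = visited-there V v u λ { refl → u≢ refl }

        c≡ : ∀ r → lookup c r ≡ visited V₁ (k , r)
        c≡ r with r Fin.≟ a
        ... | yes refl = trans (lookup∘update a c₀ true) (sym (visited-here V v))
        ... | no  r≢a  = trans (lookup∘update′ r≢a c₀ true)
          (trans (c₀≡ r) (sym (visited-there V v (k , r) λ { refl → r≢a refl })))

        c₀-false : ∀ r → lookup c r ≡ false → lookup c₀ r ≡ false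
        c₀-false r p = trans (c₀≡ r) (false-if (mono ext (k , r)) (trans (sym (c≡ r)) p))

        right-other : ∀ r → visited V₁ (suc k , r) ≡ visited V (suc k , r)
        right-other r = other (suc k , r) (ℕ.1+n≢n)

        d₁ : Describes (suc n) k V₁ (c , ν , st)
        d₁ = c≡ , (λ r p → trans (right-other r) (ν⇒ r p)) ,
          (λ r p → trans (ν≡ r (c₀-false r p)) (sym (right-other r))) ,
          describes-resp n (suc k) st (λ u k<u → other u (ℕ.>⇒≢ k<u)) d

        νa≡ : lookup ν a ≡ visited V₁ (suc k , a)
        νa≡ = trans (ν≡ a (trans (c₀≡ a) a∉)) (sym (right-other a))

        λa≡ : lookup λₗ a ≡ leftVisited V₁ v
        λa≡ = trans (l a a∉) (sym (leftVisited-keep a ext))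

        us↭ : us ↭ lefts ++ (map (k ,_) rs ++ rights)
        us↭ = unvisitedNeighbours↭ V₁ k a c ν λₗ c≡ νa≡ λa≡

        length-lefts : ∀ k p → p ≡ leftVisited V₁ (k , a) →
          length (if p then [] else leftNeighbour (k , a)) ≡ (if p then 0 else 1)
        length-lefts zero    p refl = refl
        length-lefts (suc k) true  eq = refl
        length-lefts (suc k) false eq = refl

        length-rights : length rights ≡ (if lookup ν a then 0 else 1)
        length-rights with lookup ν a
        ... | true  = refl
        ... | false = refl

        options≡ : length us ≡ options ν λₗ a rs
        options≡ = trans (↭-length us↭) (trans (length-++ lefts) (cong₂ _+_ (length-lefts k _ λa≡)
          (trans (length-++ (map (k ,_) rs)) (cong₂ _+_ (length-map (k ,_) rs) length-rights))))

        f≥g : g ≤ f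
        f≥g = ℕ.≤-trans (ℕ.m≤m⊔n g _) f≥
        f≥column : columnBound n j g ≤ f
        f≥column = ℕ.≤-trans (ℕ.m≤m⊔n (columnBound n j g) _) (ℕ.≤-trans (ℕ.m≤n⊔m g _) f≥)
        f≥value : valueBound n (columnBound n j g) ≤ f
        f≥value = ℕ.≤-trans (ℕ.m≤n⊔m (columnBound n j g) _) (ℕ.≤-trans (ℕ.m≤n⊔m g _) f≥)

        c≤j : unmarked c ≤ j
        c≤j = ℕ.≤-pred (subst (_≤ suc j) (unmarked-mark c₀ a (trans (c₀≡ a) a∉)) c≤)

        leaving : Excursion (suc n) k V V₁ a (c , ν , st)
        leaving .extends   = ext
        leaving .describes = d₁
        leaving .front≡    = c≡
        leaving .new       = a∉
        leaving .reached   = visited-here V v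

        left≡ : ∑ lefts F ≡ (if lookup λₗ a then 0ℚ else κ a (c , ν , st))
        left≡ = go k refl _ λa≡
          where
          go : ∀ k′ → k ≡ k′ → ∀ p → p ≡ leftVisited V₁ (k′ , a) →
            ∑ (if p then [] else leftNeighbour (k′ , a)) F ≡ (if p then 0ℚ else κ a (c , ν , st))
          go k′       k≡ true  eq = refl
          go (suc k′) k≡ false eq = trans (ℚ.+-identityʳ _) (next k′ V₁ a (c , ν , st) f k≡ f≥g leaving (sym eq))

        view : ∀ {V′} → Extends k V V′ → LeftView k V′ λₗ
        view e r r∉ = trans (l r (false-if (mono e (k , r)) r∉)) (sym (leftVisited-keep r e))

        continues : ∀ {V′} → Extends k V V′ → Continues (suc n) k V′ g κ
        continues e x V″ b st f k≡ g≤f exc = next x V″ b st f k≡ g≤f (excursion-from e exc)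

        rows≡ : ∑ (map (k ,_) rs) F ≡ ∑ rs (column n j 1ℚ κ c ν st λₗ)
        rows≡ = trans (∑-map rs) (∑-cong rs λ {r} r∈ →
          visits-column n j k V₁ c ν st λₗ r κ g k≡ d₁ (view ext) (row∉ r r∈) c≤j (continues {V₁} ext) f f≥column)
          where
          row∉ : ∀ r → r ∈ rs → visited V₁ (k , r) ≡ false
          row∉ r r∈ = trans (sym (c≡ r)) (free (beside a r) _
            (proj₂ (∈-filterᵇ⁻ (λ r → beside a r ∧ not (lookup c r)) (allFin h) r∈)))
            where
            free : ∀ p q → p ∧ not q ≡ true → q ≡ false
            free true false eq = refl

        λᵣ = c ∖ ν

        right-view : LeftView (suc k) V₁ λᵣ
        right-view r r∉ = trans (lookup-∖ c ν r) (trans (cong (λ p → not p ∧ lookup c r)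
          (false-if (proj₁ (proj₂ d₁) r) r∉)) (c≡ r))

        right-continues : Continues n (suc k) V₁ (columnBound n j g) (resume n j 1ℚ κ c ν λₗ)
        right-continues x V′ b s f′ refl f′≥ exc b∉ = trans
          (visits-column n j k V′ c μ s λₗ b κ g k≡ d′ (view e′) b∉ c≤j (continues {V′} e′) f′ f′≥) (sym (if-true ok))
          where
          μ = merge ν (front n s) λᵣ
          e′ : Extends k V V′
          e′ = extends-trans (ℕ.n≤1+n k) ext (extends exc)

          c≡′ : ∀ r → lookup c r ≡ visited V′ (k , r)
          c≡′ r = trans (c≡ r) (sym (keep (extends exc) (k , r) ℕ.≤-refl))

          -- In a row unvisited in this column `λᵣ` is false, so `merge` reduces to a union, and the
          -- union is exactly what is visited on the right. This restores the invariant after the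
          -- excursion.
          μ≡ : ∀ r → lookup c r ≡ false → lookup μ r ≡ lookup ν r ∨ lookup (front n s) r
          μ≡ r p = trans (lookup-merge ν (front n s) λᵣ r) (cong (λ q → not q ∧ _) (trans (lookup-∖ c ν r) (∧-false (not (lookup ν r)) p)))
            where
            ∧-false : ∀ p {q} → q ≡ false → p ∧ q ≡ false
            ∧-false true  eq = eq
            ∧-false false eq = refl

          ν-mono : ∀ r → lookup ν r ≡ true → visited V′ (suc k , r) ≡ true
          ν-mono r p = mono (extends exc) (suc k , r) (proj₁ (proj₂ d₁) r p)

          ∨≡ : ∀ r → lookup ν r ∨ lookup (front n s) r ≡ visited V′ (suc k , r)
          ∨≡ r with lookup ν r in eq
          ... | true  = sym (ν-mono r eq)
          ... | false = front≡ exc r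

          μ⇒ : ∀ r → lookup μ r ≡ true → visited V′ (suc k , r) ≡ true
          μ⇒ r p = trans (sym (∨≡ r)) (second (not (lookup λᵣ r)) (trans (sym (lookup-merge ν (front n s) λᵣ r)) p))
            where
            second : ∀ p {q} → p ∧ q ≡ true → q ≡ true
            second true eq = eq

          d′ : Describes (suc n) k V′ (c , μ , s)
          d′ = c≡′ , μ⇒ , (λ r p → trans (μ≡ r p) (∨≡ r)) , describes exc

          cb : lookup c b ≡ false
          cb = trans (c≡′ b) b∉

          -- The guard of `resume` holds: (k, b) is unvisited, so `ν` in row `b` tells truly that (k
          -- + 1, b) was unvisited before the excursion, and the excursion reached it.
          ok : lookup μ b ∧ not (lookup ν b) ≡ true
          ok = cong₂ (λ p q → p ∧ not q) (trans (μ≡ b cb) (trans (∨≡ b) (reached exc)))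
            (trans (proj₁ (proj₂ (proj₂ d₁)) b cb) (new exc))

        right≡ : ∑ rights F ≡ (if lookup ν a then 0ℚ else value n 1ℚ (resume n j 1ℚ κ c ν λₗ) st λᵣ a)
        right≡ with lookup ν a in eq
        ... | true  = refl
        ... | false = trans (ℚ.+-identityʳ _)
          (visits-value n (suc k) V₁ st λᵣ a (resume n j 1ℚ κ c ν λₗ) (columnBound n j g)
            (trans (sym (ℕ.+-suc k n)) k≡) (proj₂ (proj₂ (proj₂ d₁))) right-view (trans (sym νa≡) eq)
            right-continues f f≥value)

  visits≡score : ∀ N a f → valueBound N 0 ≤ f →
    visits N f [] (0 , a) ≡ score N ∅ (fresh N) (enter full a end)
  visits≡score N a f = visits-value N N 0 [] (fresh N) full a (λ _ _ → 0ℚ) 0 refl (describes-fresh N 0)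
    (λ r _ → lookup-replicate r true) refl (λ x V′ b st f ()) f

-- Averages and the expected number of visits

-- Turns a linear inequality into an identity for the ring solver: the known inequalities are added
-- up to a ≤ b, and then only the differences have to agree.
≤-by : ∀ {a b c d} → a ℚ.≤ b → d ℚ.- c ≡ b ℚ.- a → c ℚ.≤ d
≤-by {a} {b} {c} {d} a≤b eq = subst₂ ℚ._≤_ (ℚ.+-identityˡ c)
  (trans (cong (ℚ._+ c) (sym eq)) (trans (ℚ.+-assoc d (ℚ.- c) c) (trans (cong (d ℚ.+_) (ℚ.+-inverseˡ c)) (ℚ.+-identityʳ d))))
  (ℚ.+-monoˡ-≤ c {0ℚ} {b ℚ.- a} (subst (ℚ._≤ b ℚ.- a) (ℚ.+-inverseʳ a) (ℚ.+-monoˡ-≤ (ℚ.- a) a≤b)))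

*-monoˡ : ∀ {c a b} → 0ℚ ℚ.≤ c → a ℚ.≤ b → c * a ℚ.≤ c * b
*-monoˡ {c} 0≤c = ℚ.*-monoˡ-≤-nonNeg c {{ℚ.nonNegative 0≤c}}

*-nonNeg : ∀ {a b} → 0ℚ ℚ.≤ a → 0ℚ ℚ.≤ b → 0ℚ ℚ.≤ a * b
*-nonNeg {a} {b} 0≤a 0≤b = subst (ℚ._≤ a * b) (ℚ.*-zeroʳ a) (*-monoˡ 0≤a 0≤b)

+-nonNeg : ∀ {a b} → 0ℚ ℚ.≤ a → 0ℚ ℚ.≤ b → 0ℚ ℚ.≤ a ℚ.+ b
+-nonNeg 0≤a 0≤b = ℚ.+-mono-≤ 0≤a 0≤b

0≤/ : ∀ n d → 0ℚ ℚ.≤ + n / suc d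
0≤/ n d = ℚ.nonNegative⁻¹ (+ n / suc d) {{ℚ.normalize-nonNeg n (suc d)}}

0≤1/′ : ∀ m → 0ℚ ℚ.≤ 1/′ m
0≤1/′ zero    = ℚ.≤-refl
0≤1/′ (suc m) = 0≤/ 1 m

ι : ℕ → ℚ
ι n = + n / 1

0≤ι : ∀ n → 0ℚ ℚ.≤ ι n
0≤ι n = 0≤/ n 0

/≡ : ∀ m d n e → m ℕ.* suc e ≡ n ℕ.* suc d → + m / suc d ≡ + n / suc e
/≡ m d n e eq = ℚ.toℚᵘ-injective (ℚᵘ.≃-trans (ℚ.toℚᵘ-fromℚᵘ (ℚᵘ.mkℚᵘ (+ m) d))
  (ℚᵘ.≃-trans (ℚᵘ.*≡* (trans (sym (ℤ.pos-* m (suc e))) (trans (cong +_ eq) (ℤ.pos-* n (suc d)))))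
    (ℚᵘ.≃-sym (ℚ.toℚᵘ-fromℚᵘ (ℚᵘ.mkℚᵘ (+ n) e)))))

/-+ : ∀ m n d → + m / suc d ℚ.+ + n / suc d ≡ + (m + n) / suc d
/-+ m n d = ℚ.toℚᵘ-injective (begin
  ℚ.toℚᵘ (+ m / suc d ℚ.+ + n / suc d)               ≈⟨ ℚ.toℚᵘ-homo-+ (+ m / suc d) (+ n / suc d) ⟩
  ℚ.toℚᵘ (+ m / suc d) ℚᵘ.+ ℚ.toℚᵘ (+ n / suc d)
    ≈⟨ ℚᵘ.+-cong (ℚ.toℚᵘ-fromℚᵘ (ℚᵘ.mkℚᵘ (+ m) d)) (ℚ.toℚᵘ-fromℚᵘ (ℚᵘ.mkℚᵘ (+ n) d)) ⟩
  ℚᵘ.mkℚᵘ (+ m) d ℚᵘ.+ ℚᵘ.mkℚᵘ (+ n) d                   ≈⟨ ℚᵘ.*≡* eq ⟩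
  ℚᵘ.mkℚᵘ (+ (m + n)) d                                  ≈⟨ ℚ.toℚᵘ-fromℚᵘ (ℚᵘ.mkℚᵘ (+ (m + n)) d) ⟨
  ℚ.toℚᵘ (+ (m + n) / suc d)                           ∎)
  where
  open ℚᵘ.≃-Reasoning
  eq : (+ m ℤ.* + suc d ℤ.+ + n ℤ.* + suc d) ℤ.* + suc d ≡ + (m + n) ℤ.* + (suc d ℕ.* suc d)
  eq = trans (cong (ℤ._* + suc d) (sym (ℤ.*-distribʳ-+ (+ suc d) (+ m) (+ n))))
    (trans (ℤ.*-assoc (+ (m + n)) (+ suc d) (+ suc d)) (cong (+ (m + n) ℤ.*_) (sym (ℤ.pos-* (suc d) (suc d)))))

/-* : ∀ m d n e → (+ m / suc d) * (+ n / suc e) ≡ + (m ℕ.* n) / (suc d ℕ.* suc e)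
/-* m d n e = ℚ.toℚᵘ-injective (begin
  ℚ.toℚᵘ (+ m / suc d * (+ n / suc e))             ≈⟨ ℚ.toℚᵘ-homo-* (+ m / suc d) (+ n / suc e) ⟩
  ℚ.toℚᵘ (+ m / suc d) ℚᵘ.* ℚ.toℚᵘ (+ n / suc e)
    ≈⟨ ℚᵘ.*-cong (ℚ.toℚᵘ-fromℚᵘ (ℚᵘ.mkℚᵘ (+ m) d)) (ℚ.toℚᵘ-fromℚᵘ (ℚᵘ.mkℚᵘ (+ n) e)) ⟩
  ℚᵘ.mkℚᵘ (+ m) d ℚᵘ.* ℚᵘ.mkℚᵘ (+ n) e                   ≈⟨ ℚᵘ.*≡* (cong (ℤ._* + (suc d ℕ.* suc e)) (sym (ℤ.pos-* m n))) ⟩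
  ℚᵘ.mkℚᵘ (+ (m ℕ.* n)) (e + d ℕ.* suc e)                    ≈⟨ ℚ.toℚᵘ-fromℚᵘ (ℚᵘ.mkℚᵘ (+ (m ℕ.* n)) (e + d ℕ.* suc e)) ⟨
  ℚ.toℚᵘ (+ (m ℕ.* n) / (suc d ℕ.* suc e))                 ∎)
  where open ℚᵘ.≃-Reasoning

ι-suc : ∀ n → ι (suc n) ≡ 1ℚ ℚ.+ ι n
ι-suc n = sym (/-+ 1 n 0)

1/′-inverse : ∀ m → 1/′ suc m * ι (suc m) ≡ 1ℚ
1/′-inverse m = trans (/-* 1 m (suc m) 0) (/≡ (1 ℕ.* suc m) (0 + m ℕ.* 1) 1 0 (trans (ℕ.*-identityʳ _) (trans (ℕ.*-identityˡ _) (sym (trans (ℕ.*-identityˡ _) (cong suc (ℕ.*-identityʳ m)))))))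

∑-mono : ∀ {A : Set} (xs : List A) {f g : A → ℚ} → (∀ {x} → x ∈ xs → f x ℚ.≤ g x) → ∑ xs f ℚ.≤ ∑ xs g
∑-mono []       fg = ℚ.≤-refl
∑-mono (x ∷ xs) fg = ℚ.+-mono-≤ (fg (here refl)) (∑-mono xs λ x∈ → fg (there x∈))

∑-nonNeg : ∀ {A : Set} (xs : List A) {f : A → ℚ} → (∀ x → 0ℚ ℚ.≤ f x) → 0ℚ ℚ.≤ ∑ xs f
∑-nonNeg []       0≤f = ℚ.≤-refl
∑-nonNeg (x ∷ xs) 0≤f = +-nonNeg (0≤f x) (∑-nonNeg xs 0≤f)

∑-⊆ : ∀ {A : Set} {xs ys : List A} {f : A → ℚ} → (∀ x → 0ℚ ℚ.≤ f x) → Unique xs → xs ⊆ ys → ∑ xs f ℚ.≤ ∑ ys f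
∑-⊆ {xs = []}     {ys} 0≤f u xs⊆ys = ∑-nonNeg ys 0≤f
∑-⊆ {xs = x ∷ xs} {ys} {f} 0≤f (x∉ ∷ u) xs⊆ys with ∈-∃++ (xs⊆ys (here refl))
... | as , bs , refl = subst (f x ℚ.+ ∑ xs f ℚ.≤_) (sym (∑-↭ f (shift x as bs)))
  (ℚ.+-monoʳ-≤ (f x) (∑-⊆ 0≤f u rest))
  where
  rest : xs ⊆ as ++ bs
  rest {z} z∈ with ∈-++⁻ as (xs⊆ys (there z∈))
  ... | inj₁ z∈as         = ∈-++⁺ˡ z∈as
  ... | inj₂ (there z∈bs) = ∈-++⁺ʳ as z∈bs
  ... | inj₂ (here refl)  = ⊥-elim (All.lookup x∉ z∈ refl)

∑-1 : ∀ {A : Set} (xs : List A) → ∑ xs (λ _ → 1ℚ) ≡ ι (length xs)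
∑-1 []       = refl
∑-1 (x ∷ xs) = trans (cong (1ℚ ℚ.+_) (∑-1 xs)) (sym (ι-suc (length xs)))

average : ∀ {A : Set} → List A → (A → ℚ) → ℚ
average xs f = 1/′ (length xs) * ∑ xs f

average-mono : ∀ {A : Set} (xs : List A) {f g : A → ℚ} → (∀ {x} → x ∈ xs → f x ℚ.≤ g x) → average xs f ℚ.≤ average xs g
average-mono xs fg = *-monoˡ (0≤1/′ (length xs)) (∑-mono xs fg)

average-nonNeg : ∀ {A : Set} (xs : List A) {f : A → ℚ} → (∀ x → 0ℚ ℚ.≤ f x) → 0ℚ ℚ.≤ average xs f
average-nonNeg xs 0≤f = *-nonNeg (0≤1/′ (length xs)) (∑-nonNeg xs 0≤f)

average-1 : ∀ {A : Set} (x : A) xs → average (x ∷ xs) (λ _ → 1ℚ) ≡ 1ℚ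
average-1 x xs = trans (cong (1/′ suc (length xs) *_) (∑-1 (x ∷ xs))) (1/′-inverse (length xs))

average≤1 : ∀ {A : Set} (xs : List A) → average xs (λ _ → 1ℚ) ℚ.≤ 1ℚ
average≤1 []       = 0≤ι 1
average≤1 (x ∷ xs) = ℚ.≤-reflexive (average-1 x xs)

module _ {h : ℕ} where

  moves : List (Vertex h) → Vertex h → List (Vertex h)
  moves V v = unvisitedNeighbours (v ∷ V) v

  expectedVisits : ℕ → List (Vertex h) → Vertex h → ℚ
  expectedVisits zero    V v = 0ℚ
  expectedVisits (suc f) V v = 1ℚ ℚ.+ average (moves V v) (expectedVisits f (v ∷ V))

  -- The probability of making f + 1 further steps.
  survival : ℕ → List (Vertex h) → Vertex h → ℚ
  survival zero    V v = average (moves V v) (λ _ → 1ℚ)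
  survival (suc f) V v = average (moves V v) (survival f (v ∷ V))

  expectedVisits-nonNeg : ∀ f V v → 0ℚ ℚ.≤ expectedVisits f V v
  expectedVisits-nonNeg zero    V v = ℚ.≤-refl
  expectedVisits-nonNeg (suc f) V v =
    +-nonNeg {1ℚ} (0≤ι 1) (average-nonNeg (moves V v) (expectedVisits-nonNeg f (v ∷ V)))

  visits≤ : ∀ N f V v → visits N f V v ℚ.≤ expectedVisits f V v
  visits≤ N zero    V v = ℚ.≤-refl
  visits≤ N (suc f) V v with proj₁ v <ᵇ N
  ... | true  = ℚ.+-monoʳ-≤ 1ℚ (average-mono (moves V v) λ {u} _ → visits≤ N f (v ∷ V) u)
  ... | false = expectedVisits-nonNeg (suc f) V v

  moves-≤ : ∀ V v {u} → u ∈ moves V v → proj₁ u ≤ suc (proj₁ v)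
  moves-≤ V v@(x , _) u∈ with ∈-filter⁻ _ {xs = neighbours v} u∈
  ... | u∈′ , _ with ∈-filter⁻ (adjacent? v) {xs = cartesianProduct (upTo (2 + x)) (allFin h)} u∈′
  ...   | u∈″ , _ = ℕ.≤-pred (∈-upTo⁻ (proj₁ (∈-cartesianProduct⁻ (upTo (2 + x)) (allFin h) u∈″)))

  -- A step moves at most one column to the right, so the first f vertices of a walk from column x
  -- lie to the left of column x + f, and the cut-off at column `N` does not affect them.
  ≤visits : ∀ N f V v → proj₁ v + f ≤ N → expectedVisits f V v ℚ.≤ visits N f V v
  ≤visits N zero    V v v≤ = ℚ.≤-refl
  ≤visits N (suc f) V v v≤ rewrite dec-true (proj₁ v ℕ.<? N)
    (ℕ.≤-trans (ℕ.m≤m+n (suc (proj₁ v)) f) (ℕ.≤-trans (ℕ.≤-reflexive (sym (ℕ.+-suc (proj₁ v) f))) v≤)) =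
    ℚ.+-monoʳ-≤ 1ℚ (average-mono (moves V v) λ {u} u∈ → ≤visits N f (v ∷ V) u
      (ℕ.≤-trans (ℕ.+-monoˡ-≤ f (moves-≤ V v u∈)) (ℕ.≤-trans (ℕ.≤-reflexive (sym (ℕ.+-suc (proj₁ v) f))) v≤)))

  visits-mono : ∀ N {f f′} V v → f ≤ f′ → visits N f V v ℚ.≤ visits N f′ V v
  visits-mono N {zero}  {zero}   V v f≤ = ℚ.≤-refl
  visits-mono N {zero}  {suc f′} V v f≤ = visits-nonNeg (suc f′) V v
    where
    visits-nonNeg : ∀ f V v → 0ℚ ℚ.≤ visits N f V v
    visits-nonNeg zero    V v = ℚ.≤-refl
    visits-nonNeg (suc f) V v with proj₁ v <ᵇ N
    ... | true  = +-nonNeg {1ℚ} (0≤ι 1) (average-nonNeg (moves V v) (visits-nonNeg f (v ∷ V)))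
    ... | false = ℚ.≤-refl
  visits-mono N {suc f} {suc f′} V v (s≤s f≤) with proj₁ v <ᵇ N
  ... | true  = ℚ.+-monoʳ-≤ 1ℚ (average-mono (moves V v) λ {u} _ → visits-mono N (v ∷ V) u f≤)
  ... | false = ℚ.≤-refl

  -- Together with `expectedVisits≤score`: truncations by columns and truncations by steps dominate
  -- each other, so bounds and limits pass from one family to the other.
  score≤expectedVisits : ∀ N a → ∃[ f ] score N ∅ (fresh N) (enter full a end) ℚ.≤ expectedVisits f [] (0 , a)
  score≤expectedVisits N a = valueBound {h} N 0 ,
    subst (ℚ._≤ expectedVisits (valueBound {h} N 0) [] (0 , a)) (visits≡score N a _ ℕ.≤-refl) (visits≤ N (valueBound {h} N 0) [] (0 , a))

  expectedVisits≤score : ∀ f a → expectedVisits f [] (0 , a) ℚ.≤ score f ∅ (fresh f) (enter full a end)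
  expectedVisits≤score f a = ℚ.≤-trans (≤visits f f [] (0 , a) ℕ.≤-refl)
    (subst (visits f f [] (0 , a) ℚ.≤_) (visits≡score f a _ (ℕ.m≤n⊔m f (valueBound {h} f 0)))
      (visits-mono f [] (0 , a) (ℕ.m≤m⊔n f (valueBound {h} f 0))))

  average-+ : ∀ (us : List (Vertex h)) {f g : Vertex h → ℚ} → average us (λ u → f u ℚ.+ g u) ≡ average us f ℚ.+ average us g
  average-+ us {f} {g} = trans (cong (1/′ (length us) *_)
    (trans (∑-cong us λ {u} _ → cong (ℚ._+ g u) (sym (ℚ.*-identityˡ (f u))))
           (trans (∑-linear us 1ℚ) (cong (ℚ._+ ∑ us g) (ℚ.*-identityˡ (∑ us f))))))
    (ℚ.*-distribˡ-+ (1/′ (length us)) (∑ us f) (∑ us g))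

  average-cong : ∀ (us : List (Vertex h)) {f g : Vertex h → ℚ} → (∀ {u} → u ∈ us → f u ≡ g u) → average us f ≡ average us g
  average-cong us fg = cong (1/′ (length us) *_) (∑-cong us fg)

  average-*ˡ : ∀ (us : List (Vertex h)) c {f : Vertex h → ℚ} → average us (λ u → c * f u) ≡ c * average us f
  average-*ˡ us c {f} = trans (cong (1/′ (length us) *_) (∑-*ˡ us c))
    (trans (sym (ℚ.*-assoc w c S)) (trans (cong (ℚ._* S) (ℚ.*-comm w c)) (ℚ.*-assoc c w S)))
    where
    w = 1/′ (length us)
    S = ∑ us f

  -- The walk has a vertex with number f + 2 exactly if it makes f + 1 steps.
  expectedVisits-suc : ∀ f V v → expectedVisits (2 + f) V v ≡ expectedVisits (1 + f) V v ℚ.+ survival f V v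
  expectedVisits-suc zero V v = begin
    1ℚ ℚ.+ average us (λ u → 1ℚ ℚ.+ average (moves (v ∷ V) u) (λ _ → 0ℚ))
      ≡⟨ cong (1ℚ ℚ.+_) (trans (average-cong us λ {u} _ → cong (1ℚ ℚ.+_) (zero≡ (moves (v ∷ V) u))) (cong (1/′ (length us) *_) (∑-cong us λ _ → refl))) ⟩
    1ℚ ℚ.+ average us (λ _ → 1ℚ)                          ≡⟨ cong (ℚ._+ average us (λ _ → 1ℚ)) (cong (1ℚ ℚ.+_) (zero≡ us)) ⟨
    (1ℚ ℚ.+ average us (λ _ → 0ℚ)) ℚ.+ average us (λ _ → 1ℚ) ∎
    where
    open ≡-Reasoning
    us = moves V v
    zero≡ : ∀ (us : List (Vertex h)) → average us (λ _ → 0ℚ) ≡ 0ℚ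
    zero≡ us = trans (cong (1/′ (length us) *_) (∑-0 us)) (ℚ.*-zeroʳ (1/′ (length us)))
  expectedVisits-suc (suc f) V v = trans
    (cong (1ℚ ℚ.+_) (trans (average-cong us λ {u} _ → expectedVisits-suc f (v ∷ V) u) (average-+ us)))
    (sym (ℚ.+-assoc 1ℚ (average us (expectedVisits (suc f) (v ∷ V))) (average us (survival f (v ∷ V)))))
    where us = moves V v

  survival-antitone : ∀ f V v → survival (suc f) V v ℚ.≤ survival f V v
  survival-antitone zero    V v = average-mono (moves V v) λ {u} _ → average≤1 (moves (v ∷ V) u)
  survival-antitone (suc f) V v = average-mono (moves V v) λ {u} _ → survival-antitone f (v ∷ V) u

  survival-nonNeg : ∀ f V v → 0ℚ ℚ.≤ survival f V v
  survival-nonNeg zero    V v = average-nonNeg (moves V v) λ _ → 0≤ι 1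
  survival-nonNeg (suc f) V v = average-nonNeg (moves V v) (survival-nonNeg f (v ∷ V))

-- Growing self-avoiding walks

∉⇒[] : ∀ {A : Set} (xs : List A) → (∀ x → x ∉ xs) → xs ≡ []
∉⇒[] []       ∉xs = refl
∉⇒[] (x ∷ xs) ∉xs = ⊥-elim (∉xs x (here refl))

-- `key` recovers from an element the x whose list contains it, so the lists are disjoint.
concatMap-unique : ∀ {A B : Set} (key : B → Maybe A) (f : A → List B) {xs} → Unique xs →
  (∀ x → Unique (f x)) → (∀ x {y} → y ∈ f x → key y ≡ just x) → Unique (concatMap f xs)
concatMap-unique key f {[]} u f! key≡ = []
concatMap-unique key f {x ∷ xs} (x∉ ∷ u) f! key≡ = Unique.++⁺ (f! x) (concatMap-unique key f u f! key≡)
  λ (y∈ , y∈′) → disjoint y∈ (∈-concatMap⁻ f {xs = xs} y∈′) x∉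
  where
  disjoint : ∀ {y xs} → y ∈ f x → Any (λ x′ → y ∈ f x′) xs → All (x ≢_) xs → ⊥
  disjoint y∈ (here y∈′) (x≢ ∷ _) = x≢ (just-injective (trans (sym (key≡ x y∈)) (key≡ _ y∈′)))
  disjoint y∈ (there p)  (_ ∷ x∉) = disjoint y∈ p x∉

module _ {h : ℕ} where

  open DecMembership (_≟ᵛ_ {h}) using (_∈?_)

  -- A form of `IsGSAW` relative to the vertices visited before. It recurses like `stepProduct`:
  -- each step is one of the available moves, and at the end there are none.
  Completes : List (Vertex h) → Walk h → Set
  Completes V []          = ⊥
  Completes V (v ∷ [])    = moves V v ≡ []
  Completes V (v ∷ w ∷ W) = w ∈ moves V v × Completes (v ∷ V) (w ∷ W)

  stuck : List (Vertex h) → Vertex h → List (Walk h)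
  stuck []      v = (v ∷ []) ∷ []
  stuck (_ ∷ _) v = []

  -- The possible completions with at most f further edges.
  gsaws : ℕ → List (Vertex h) → Vertex h → List (Walk h)
  gsaws zero    V v = stuck (moves V v) v
  gsaws (suc f) V v = stuck (moves V v) v ++ map (v ∷_) (concatMap (gsaws f (v ∷ V)) (moves V v))

  ∈-stuck⁻ : ∀ us {v W} → W ∈ stuck us v → W ≡ v ∷ [] × us ≡ []
  ∈-stuck⁻ [] (here refl) = refl , refl

  ∈-gsaws⁻ : ∀ f V v {W} → W ∈ gsaws f V v → head W ≡ just v × Completes V W
  ∈-gsaws⁻ zero V v W∈ with ∈-stuck⁻ (moves V v) W∈
  ... | refl , us≡ = refl , us≡
  ∈-gsaws⁻ (suc f) V v W∈ with ∈-++⁻ (stuck (moves V v) v) W∈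
  ... | inj₁ W∈′ with ∈-stuck⁻ (moves V v) W∈′
  ...   | refl , us≡ = refl , us≡
  ∈-gsaws⁻ (suc f) V v W∈ | inj₂ W∈′ with ∈-map⁻ (v ∷_) W∈′
  ... | W′ , W′∈ , refl with satisfied′ (∈-concatMap⁻ (gsaws f (v ∷ V)) {xs = moves V v} W′∈)
    where
    satisfied′ : ∀ {W xs} → Any (λ u → W ∈ gsaws f (v ∷ V) u) xs → ∃[ u ] (u ∈ xs × W ∈ gsaws f (v ∷ V) u)
    satisfied′ (here W∈)  = _ , here refl , W∈
    satisfied′ (there p) = let u , u∈ , W∈ = satisfied′ p in u , there u∈ , W∈
  ...   | u , u∈ , W′∈u with W′ | ∈-gsaws⁻ f (v ∷ V) u W′∈u
  ...     | _ ∷ _ | refl , c = refl , u∈ , c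

  ∈-gsaws⁺ : ∀ f V v W → Completes V (v ∷ W) → length W ≤ f → v ∷ W ∈ gsaws f V v
  ∈-gsaws⁺ zero    V v []      c _ rewrite c = here refl
  ∈-gsaws⁺ (suc f) V v []      c _ rewrite c = here refl
  ∈-gsaws⁺ (suc f) V v (w ∷ W) (w∈ , c) (s≤s W≤) = ∈-++⁺ʳ (stuck (moves V v) v)
    (∈-map⁺ (v ∷_) (∈-concatMap⁺ (gsaws f (v ∷ V)) (lift w∈)))
    where
    lift : ∀ {us} → w ∈ us → Any (λ u → w ∷ W ∈ gsaws f (v ∷ V) u) us
    lift (here refl) = here (∈-gsaws⁺ f (v ∷ V) w W c W≤)
    lift (there w∈)  = there (lift w∈)

  stuck-unique : ∀ us v → Unique (stuck us v)
  stuck-unique []      v = [] ∷ []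
  stuck-unique (_ ∷ _) v = []

  gsaws-unique : ∀ f V v → Unique (gsaws f V v)
  gsaws-unique zero    V v = stuck-unique (moves V v) v
  gsaws-unique (suc f) V v = go (moves V v) (Unique.filter⁺ _ (neighbours-unique v))
    where
    go : ∀ us → Unique us → Unique (stuck us v ++ map (v ∷_) (concatMap (gsaws f (v ∷ V)) us))
    go []       u = [] ∷ []
    go (w ∷ us) u = Unique.map⁺ (λ { refl → refl }) (concatMap-unique head (gsaws f (v ∷ V)) u
      (gsaws-unique f (v ∷ V)) (λ u W∈ → proj₁ (∈-gsaws⁻ f (v ∷ V) u W∈)))

  ∈-moves⁻ : ∀ V v {u} → u ∈ moves V v → Adjacent v u × u ∉ v ∷ V
  ∈-moves⁻ V v u∈ with ∈-filter⁻ (λ u → ¬? (u ∈? (v ∷ V))) {xs = neighbours v} u∈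
  ... | u∈′ , u∉ = ∈-neighbours⁻ {v = v} u∈′ , u∉

  ∈-moves⁺ : ∀ V v {u} → Adjacent v u → u ∉ v ∷ V → u ∈ moves V v
  ∈-moves⁺ V v vu u∉ = ∈-filter⁺ (λ u → ¬? (u ∈? (v ∷ V))) (∈-neighbours⁺ {v = v} vu) u∉

  completes : ∀ V v W → Linked Adjacent (v ∷ W) → Unique (v ∷ W) → (∀ {u} → u ∈ v ∷ W → u ∉ V) →
    ∃[ z ] (last (v ∷ W) ≡ just z × (∀ u → Adjacent z u → u ∈ v ∷ W ⊎ u ∈ V)) → Completes V (v ∷ W)
  completes V v [] l u V# (z , refl , trapped) = ∉⇒[] (moves V v) none
    where
    none : ∀ u → u ∉ moves V v
    none u u∈ with ∈-moves⁻ V v u∈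
    ... | vu , u∉ with trapped u vu
    ...   | inj₁ (here refl) = u∉ (here refl)
    ...   | inj₂ u∈V         = u∉ (there u∈V)
  completes V v (w ∷ W) (vw ∷ l) (v∉ ∷ u) V# (z , z≡ , trapped) =
    ∈-moves⁺ V v vw (λ { (here refl) → All.lookup v∉ (here refl) refl ; (there w∈V) → V# (there (here refl)) w∈V }) ,
    completes (v ∷ V) w W l u
      (λ { u∈ (here refl) → All.lookup v∉ u∈ refl ; u∈ (there u∈V) → V# (there u∈) u∈V })
      (z , z≡ , λ u zu → case trapped u zu of λ
        { (inj₁ (here refl)) → inj₂ (here refl) ; (inj₁ (there u∈)) → inj₁ u∈ ; (inj₂ u∈V) → inj₂ (there u∈V) })

  completed : ∀ V v W → v ∉ V → Completes V (v ∷ W) → Linked Adjacent (v ∷ W) × Unique (v ∷ W) ×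
    (∀ {u} → u ∈ v ∷ W → u ∉ V) × ∃[ z ] (last (v ∷ W) ≡ just z × (∀ u → Adjacent z u → u ∈ v ∷ W ⊎ u ∈ V))
  completed V v [] v∉ us≡ = [-] , [] ∷ [] , (λ { (here refl) → v∉ }) , v , refl , trapped
    where
    trapped : ∀ u → Adjacent v u → u ∈ v ∷ [] ⊎ u ∈ V
    trapped u vu with u ∈? (v ∷ V)
    ... | yes (here refl) = inj₁ (here refl)
    ... | yes (there u∈V) = inj₂ u∈V
    ... | no  u∉          = case subst (u ∈_) us≡ (∈-moves⁺ V v vu u∉) of λ ()
  completed V v (w ∷ W) v∉ (w∈ , c) with ∈-moves⁻ V v w∈
  ... | vw , w∉ with completed (v ∷ V) w W w∉ c
  ...   | l , u , V# , z , z≡ , trapped =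
    vw ∷ l ,
    All.tabulate (λ { u∈ refl → V# u∈ (here refl) }) ∷ u ,
    (λ { (here refl) → v∉ ; (there u∈) u∈V → V# u∈ (there u∈V) }) ,
    z , z≡ , λ u zu → case trapped u zu of λ
      { (inj₁ u∈) → inj₁ (there u∈) ; (inj₂ (here refl)) → inj₁ (here refl) ; (inj₂ (there u∈V)) → inj₂ u∈V }

  isGSAW⇒∈ : ∀ v W → IsGSAW v W → ∀ f → length W ≤ suc f → W ∈ gsaws f [] v
  isGSAW⇒∈ v (_ ∷ W) record { starts = refl ; steps = l ; selfAvoiding = u ; trapped = z , z≡ , t } f (s≤s W≤) =
    ∈-gsaws⁺ f [] v W (completes [] v W l u (λ _ ()) (z , z≡ , λ u zu → inj₁ (t zu))) W≤

  ∈⇒isGSAW : ∀ v {W} f → W ∈ gsaws f [] v → IsGSAW v W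
  ∈⇒isGSAW v {W} f W∈ with W | ∈-gsaws⁻ f [] v W∈
  ... | _ ∷ W | refl , c with completed [] v W (λ ()) c
  ...   | l , u , _ , z , z≡ , t = record
    { starts = refl ; steps = l ; selfAvoiding = u
    ; trapped = z , z≡ , λ {u} zu → case t u zu of λ { (inj₁ u∈) → u∈ } }

  totalLength : ℕ → ℚ → List (Vertex h) → Vertex h → ℚ
  totalLength f ℓ V v = ∑ (gsaws f V v) λ W → stepProduct V W * (ℓ ℚ.+ ι ∣ W ∣ʷ)

  -- The average of the constant 1 is 1 if there is a move and 0 if there is none, so the right side
  -- is ℓ for a trapped vertex and 0 otherwise.
  stuck-length : ∀ us V v ℓ → ∑ (stuck us v) (λ W → stepProduct V W * (ℓ ℚ.+ ι ∣ W ∣ʷ)) ≡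
    ℓ ℚ.- ℓ * average us (λ _ → 1ℚ)
  stuck-length [] V v ℓ = trans (ℚ.+-identityʳ _) (trans (ℚ.*-identityˡ _)
    (cong (ℓ ℚ.+_) (sym (trans (cong ℚ.-_ (ℚ.*-zeroʳ ℓ)) refl))))
  stuck-length (u ∷ us) V v ℓ = sym (trans (cong (λ t → ℓ ℚ.- ℓ * t) (average-1 u us))
    (trans (cong (λ t → ℓ ℚ.- t) (ℚ.*-identityʳ ℓ)) (ℚ.+-inverseʳ ℓ)))

  -- With ℓ steps made and T steps to come, the sum is the mean of ℓ + T over the event T ≤ f. Now
  -- `expectedVisits (suc f)` is 1 plus the mean of min(T, f), and `survival f` is the probability
  -- of T > f. On that event ℓ + min(T, f) equals ℓ + f, which is the part subtracted.
  totalLength≡ : ∀ f ℓ V v → totalLength f ℓ V v ≡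
    (ℓ ℚ.+ (expectedVisits (suc f) V v ℚ.+ ℚ.- (ℓ ℚ.+ ι f) * survival f V v)) ℚ.- 1ℚ
  totalLength≡ zero ℓ V v = trans (stuck-length us V v ℓ) (trans
    (ring ℓ (average us (λ _ → 1ℚ)) 1ℚ)
    (cong (λ z → (ℓ ℚ.+ ((1ℚ ℚ.+ z) ℚ.+ ℚ.- (ℓ ℚ.+ 0ℚ) * average us (λ _ → 1ℚ))) ℚ.- 1ℚ)
      (sym (trans (cong (1/′ (length us) *_) (∑-0 us)) (ℚ.*-zeroʳ (1/′ (length us)))))))
    where
    us = moves V v
    ring : ∀ ℓ t o → ℓ ℚ.- ℓ * t ≡ (ℓ ℚ.+ ((o ℚ.+ 0ℚ) ℚ.+ ℚ.- (ℓ ℚ.+ 0ℚ) * t)) ℚ.- o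
    ring = solve 3 (λ ℓ t o → ℓ :- ℓ :* t := (ℓ :+ ((o :+ con 0ℚ) :+ (:- (ℓ :+ con 0ℚ)) :* t)) :- o) refl
      where open +-*-Solver
  totalLength≡ (suc f) ℓ V v = begin
    ∑ (stuck us v ++ map (v ∷_) Ws) T
      ≡⟨ ∑-++ (stuck us v) ⟩
    ∑ (stuck us v) T ℚ.+ ∑ (map (v ∷_) Ws) T
      ≡⟨ cong₂ ℚ._+_ (stuck-length us V v ℓ) (trans (∑-map Ws) (∑-concatMap us)) ⟩
    (ℓ ℚ.- ℓ * t) ℚ.+ ∑ us (λ u → ∑ (gsaws f (v ∷ V) u) (λ W → T (v ∷ W)))
      ≡⟨ cong ((ℓ ℚ.- ℓ * t) ℚ.+_) (trans (∑-cong us λ {u} _ → extend u) (∑-*ˡ us w)) ⟩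
    (ℓ ℚ.- ℓ * t) ℚ.+ average us (totalLength f (ℓ ℚ.+ 1ℚ) (v ∷ V))
      ≡⟨ cong ((ℓ ℚ.- ℓ * t) ℚ.+_) (average-cong us λ {u} _ →
           trans (totalLength≡ f (ℓ ℚ.+ 1ℚ) (v ∷ V) u) (rearrange ℓ 1ℚ (ι f) (H u) (P u))) ⟩
    (ℓ ℚ.- ℓ * t) ℚ.+ average us (λ u → ℓ ℚ.+ (H u ℚ.+ c * P u))
      ≡⟨ cong ((ℓ ℚ.- ℓ * t) ℚ.+_) (trans (average-+ us) (cong₂ ℚ._+_
           (trans (average-cong us λ _ → sym (ℚ.*-identityʳ ℓ)) (average-*ˡ us ℓ))
           (trans (average-+ us) (cong (average us H ℚ.+_) (average-*ˡ us c))))) ⟩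
    (ℓ ℚ.- ℓ * t) ℚ.+ (ℓ * t ℚ.+ (average us H ℚ.+ c * average us P))
      ≡⟨ collect ℓ t 1ℚ (ι f) (average us H) (average us P) ⟩
    (ℓ ℚ.+ ((1ℚ ℚ.+ average us H) ℚ.+ ℚ.- (ℓ ℚ.+ (1ℚ ℚ.+ ι f)) * average us P)) ℚ.- 1ℚ
      ≡⟨ cong (λ n → (ℓ ℚ.+ ((1ℚ ℚ.+ average us H) ℚ.+ ℚ.- (ℓ ℚ.+ n) * average us P)) ℚ.- 1ℚ) (ι-suc f) ⟨
    (ℓ ℚ.+ ((1ℚ ℚ.+ average us H) ℚ.+ ℚ.- (ℓ ℚ.+ ι (suc f)) * average us P)) ℚ.- 1ℚ ∎
    where
    open ≡-Reasoning
    us = moves V v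
    w = 1/′ (length us)
    t = average us (λ _ → 1ℚ)
    Ws = concatMap (gsaws f (v ∷ V)) us
    T = λ W → stepProduct V W * (ℓ ℚ.+ ι ∣ W ∣ʷ)
    H = expectedVisits (suc f) (v ∷ V)
    P = survival f (v ∷ V)
    c = ℚ.- ((ℓ ℚ.+ 1ℚ) ℚ.+ ι f)

    extend-walk : ∀ W {u} → head W ≡ just u → T (v ∷ W) ≡ w * (stepProduct (v ∷ V) W * ((ℓ ℚ.+ 1ℚ) ℚ.+ ι ∣ W ∣ʷ))
    extend-walk (u ∷ W) refl = trans
      (cong (λ n → (w * stepProduct (v ∷ V) (u ∷ W)) * n)
        (trans (cong (ℓ ℚ.+_) (ι-suc (length W))) (sym (ℚ.+-assoc ℓ 1ℚ (ι (length W))))))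
      (ℚ.*-assoc w (stepProduct (v ∷ V) (u ∷ W)) ((ℓ ℚ.+ 1ℚ) ℚ.+ ι (length W)))

    extend : ∀ u → ∑ (gsaws f (v ∷ V) u) (λ W → T (v ∷ W)) ≡ w * totalLength f (ℓ ℚ.+ 1ℚ) (v ∷ V) u
    extend u = trans (∑-cong (gsaws f (v ∷ V) u) λ {W} W∈ → extend-walk W (proj₁ (∈-gsaws⁻ f (v ∷ V) u W∈)))
      (∑-*ˡ (gsaws f (v ∷ V) u) w)

    rearrange : ∀ ℓ o n H P → ((ℓ ℚ.+ o) ℚ.+ (H ℚ.+ ℚ.- ((ℓ ℚ.+ o) ℚ.+ n) * P)) ℚ.- o ≡
      ℓ ℚ.+ (H ℚ.+ ℚ.- ((ℓ ℚ.+ o) ℚ.+ n) * P)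
    rearrange = solve 5 (λ ℓ o n H P → ((ℓ :+ o) :+ (H :+ (:- ((ℓ :+ o) :+ n)) :* P)) :- o :=
      ℓ :+ (H :+ (:- ((ℓ :+ o) :+ n)) :* P)) refl
      where open +-*-Solver

    collect : ∀ ℓ t o n H P → (ℓ ℚ.- ℓ * t) ℚ.+ (ℓ * t ℚ.+ (H ℚ.+ ℚ.- ((ℓ ℚ.+ o) ℚ.+ n) * P)) ≡
      (ℓ ℚ.+ ((o ℚ.+ H) ℚ.+ ℚ.- (ℓ ℚ.+ (o ℚ.+ n)) * P)) ℚ.- o
    collect = solve 6 (λ ℓ t o n H P → (ℓ :- ℓ :* t) :+ (ℓ :* t :+ (H :+ (:- ((ℓ :+ o) :+ n)) :* P)) :=
      (ℓ :+ ((o :+ H) :+ (:- (ℓ :+ (o :+ n))) :* P)) :- o) refl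
      where open +-*-Solver

-- Unconditional convergence of the series over the walks

sumℚ-map : ∀ {A : Set} (f : A → ℚ) xs → sumℚ (map f xs) ≡ ∑ xs f
sumℚ-map f []       = refl
sumℚ-map f (x ∷ xs) = cong (f x ℚ.+_) (sumℚ-map f xs)

∣-∣<-intro : ∀ {s q ε} → s ℚ.≤ q → 0ℚ ℚ.< ε → q ℚ.< s ℚ.+ ε → ℚ.∣ s ℚ.- q ∣ ℚ.< ε
∣-∣<-intro {s} {q} {ε} s≤q 0<ε q<s+ε with ℚ.∣p∣≡p∨∣p∣≡-p (s ℚ.- q)
... | inj₁ eq = subst (ℚ._< ε) (sym eq) (ℚ.≤-<-trans
  (subst (s ℚ.- q ℚ.≤_) (ℚ.+-inverseʳ q) (ℚ.+-monoˡ-≤ (ℚ.- q) s≤q)) 0<ε)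
... | inj₂ eq = subst (ℚ._< ε) (sym eq) (subst₂ ℚ._<_ (lhs s q) (rhs s ε) (ℚ.+-monoˡ-< (ℚ.- s) q<s+ε))
  where
  open +-*-Solver
  lhs : ∀ s q → q ℚ.- s ≡ ℚ.- (s ℚ.- q)
  lhs = solve 2 (λ s q → q :- s := :- (s :- q)) refl
  rhs : ∀ s ε → s ℚ.+ ε ℚ.- s ≡ ε
  rhs = solve 2 (λ s ε → s :+ ε :- s := ε) refl

quarters : ∀ ε → let δ = ℚ.½ * (ℚ.½ * ε) in (δ ℚ.+ δ) ℚ.+ (δ ℚ.+ δ) ≡ ε
quarters = solve 1 (λ ε → (con ℚ.½ :* (con ℚ.½ :* ε) :+ con ℚ.½ :* (con ℚ.½ :* ε)) :+
  (con ℚ.½ :* (con ℚ.½ :* ε) :+ con ℚ.½ :* (con ℚ.½ :* ε)) := ε) refl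
  where open +-*-Solver

halve-pos : ∀ {ε} → 0ℚ ℚ.< ε → 0ℚ ℚ.< ℚ.½ * ε
halve-pos {ε} 0<ε = subst (ℚ._< ℚ.½ * ε) (ℚ.*-zeroʳ ℚ.½) (ℚ.*-monoʳ-<-pos ℚ.½ 0<ε)

module _ {h : ℕ} where

  expectedVisits-step : ∀ f V (v : Vertex h) → expectedVisits f V v ℚ.≤ expectedVisits (suc f) V v
  expectedVisits-step zero    V v = expectedVisits-nonNeg 1 V v
  expectedVisits-step (suc f) V v = subst₂ ℚ._≤_ (ℚ.+-identityʳ _) (sym (expectedVisits-suc f V v))
    (ℚ.+-monoʳ-≤ (expectedVisits (suc f) V v) (survival-nonNeg f V v))

  -- The j increments between the two sides are survival probabilities for fewer steps, each at
  -- least `survival (f + j)`.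
  expectedVisits-growth : ∀ f j V (v : Vertex h) →
    expectedVisits (suc f) V v ℚ.+ ι j * survival (f + j) V v ℚ.≤ expectedVisits (suc (f + j)) V v
  expectedVisits-growth f zero V v rewrite ℕ.+-identityʳ f = ℚ.≤-reflexive
    (trans (cong (expectedVisits (suc f) V v ℚ.+_) (ℚ.*-zeroˡ (survival f V v))) (ℚ.+-identityʳ _))
  expectedVisits-growth f (suc j) V v rewrite ℕ.+-suc f j = begin
    A ℚ.+ ι (suc j) * P′              ≡⟨ cong (λ n → A ℚ.+ n * P′) (ι-suc j) ⟩
    A ℚ.+ (1ℚ ℚ.+ ι j) * P′           ≤⟨ ℚ.+-monoʳ-≤ A (*-monoˡ (+-nonNeg {1ℚ} (0≤ι 1) (0≤ι j)) (survival-antitone (f + j) V v)) ⟩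
    A ℚ.+ (1ℚ ℚ.+ ι j) * P            ≡⟨ cong (A ℚ.+_) (trans (ℚ.*-distribʳ-+ P 1ℚ (ι j)) (cong (ℚ._+ ι j * P) (ℚ.*-identityˡ P))) ⟩
    A ℚ.+ (P ℚ.+ ι j * P)             ≡⟨ cong (A ℚ.+_) (ℚ.+-comm P (ι j * P)) ⟩
    A ℚ.+ (ι j * P ℚ.+ P)             ≡⟨ ℚ.+-assoc A (ι j * P) P ⟨
    (A ℚ.+ ι j * P) ℚ.+ P             ≤⟨ ℚ.+-monoˡ-≤ P (expectedVisits-growth f j V v) ⟩
    expectedVisits (suc (f + j)) V v ℚ.+ P ≡⟨ expectedVisits-suc (f + j) V v ⟨
    expectedVisits (suc (suc (f + j))) V v ∎
    where
    open ℚ.≤-Reasoning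
    A = expectedVisits (suc f) V v
    P = survival (f + j) V v
    P′ = survival (suc (f + j)) V v

  stepProduct-nonNeg : ∀ V (W : Walk h) → 0ℚ ℚ.≤ stepProduct V W
  stepProduct-nonNeg V []          = 0≤ι 1
  stepProduct-nonNeg V (v ∷ [])    = 0≤ι 1
  stepProduct-nonNeg V (v ∷ w ∷ W) = *-nonNeg (0≤1/′ (length (moves V v))) (stepProduct-nonNeg (v ∷ V) (w ∷ W))

  module _ (s : Vertex h) (q : ℚ)
    (upper : ∀ f → expectedVisits f [] s ℚ.≤ 1ℚ ℚ.+ q)
    (lower : ∀ ε → 0ℚ ℚ.< ε → ∃[ f ] 1ℚ ℚ.+ q ℚ.≤ expectedVisits f [] s ℚ.+ ε) where

    term : Walk h → ℚ
    term W = pᵁ W * (+ ∣ W ∣ʷ / 1)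

    term-nonNeg : ∀ W → 0ℚ ℚ.≤ term W
    term-nonNeg W = *-nonNeg (stepProduct-nonNeg [] W) (0≤ι ∣ W ∣ʷ)

    partial : ℕ → ℚ
    partial f = ∑ (gsaws f [] s) term

    partial≡ : ∀ f → partial f ≡ (expectedVisits (suc f) [] s ℚ.- ι f * survival f [] s) ℚ.- 1ℚ
    partial≡ f = trans (∑-cong (gsaws f [] s) λ {W} _ → cong (pᵁ W *_) (sym (ℚ.+-identityˡ (ι ∣ W ∣ʷ))))
      (trans (totalLength≡ f 0ℚ [] s) (ring (expectedVisits (suc f) [] s) (ι f) (survival f [] s) 1ℚ))
      where
      ring : ∀ H n P o → (0ℚ ℚ.+ (H ℚ.+ ℚ.- (0ℚ ℚ.+ n) * P)) ℚ.- o ≡ (H ℚ.- n * P) ℚ.- o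
      ring = solve 4 (λ H n P o → (con 0ℚ :+ (H :+ (:- (con 0ℚ :+ n)) :* P)) :- o := (H :- n :* P) :- o) refl
        where open +-*-Solver

    partial≤q : ∀ f → partial f ℚ.≤ q
    partial≤q f = subst (ℚ._≤ q) (sym (partial≡ f)) (≤-by
      (ℚ.+-mono-≤ (upper (suc f)) (*-nonNeg (0≤ι f) (survival-nonNeg f [] s)))
      (ring q 1ℚ (expectedVisits (suc f) [] s) (ι f * survival f [] s)))
      where
      ring : ∀ q o H X → q ℚ.- ((H ℚ.- X) ℚ.- o) ≡ ((o ℚ.+ q) ℚ.+ X) ℚ.- (H ℚ.+ 0ℚ)
      ring = solve 4 (λ q o H X → q :- ((H :- X) :- o) := ((o :+ q) :+ X) :- (H :+ con 0ℚ)) refl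
        where open +-*-Solver

    -- With E n the expected number of visits in n steps, the partial sum at
    -- 2f is E (2f + 1) − 2f · survival (2f) − 1, and f · survival (2f) is at
    -- most E (2f + 1) − E (f + 1) because survival decreases.
    q≤partial : ∀ f {δ} → 1ℚ ℚ.+ q ℚ.≤ expectedVisits f [] s ℚ.+ δ → q ℚ.≤ partial (f + f) ℚ.+ (δ ℚ.+ δ)
    q≤partial f {δ} close = subst (λ p → q ℚ.≤ p ℚ.+ (δ ℚ.+ δ)) (sym (partial≡ (f + f))) (≤-by total
      (trans (cong (λ n → ((B ℚ.- n * P) ℚ.- 1ℚ) ℚ.+ (δ ℚ.+ δ) ℚ.- q) (sym (/-+ f f 0)))
        (ring q 1ℚ A B E (ι f) P δ)))
      where
      E = expectedVisits f [] s
      A = expectedVisits (suc f) [] s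
      B = expectedVisits (suc (f + f)) [] s
      P = survival (f + f) [] s
      -- Twice `growth`, once `upper`, twice `E≤A` and twice `close`. After cancellation this reads
      -- 2 f P + 1 + q ≤ B + 2 δ.
      total : (((A ℚ.+ ι f * P) ℚ.+ (A ℚ.+ ι f * P)) ℚ.+ B) ℚ.+ ((E ℚ.+ E) ℚ.+ ((1ℚ ℚ.+ q) ℚ.+ (1ℚ ℚ.+ q))) ℚ.≤
              ((B ℚ.+ B) ℚ.+ (1ℚ ℚ.+ q)) ℚ.+ ((A ℚ.+ A) ℚ.+ ((E ℚ.+ δ) ℚ.+ (E ℚ.+ δ)))
      total = ℚ.+-mono-≤
        (ℚ.+-mono-≤ (ℚ.+-mono-≤ growth growth) (upper (suc (f + f))))
        (ℚ.+-mono-≤ (ℚ.+-mono-≤ E≤A E≤A) (ℚ.+-mono-≤ close close))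
        where
        growth = expectedVisits-growth f f [] s
        E≤A = expectedVisits-step f [] s
      ring : ∀ q o A B E n P δ →
        ((B ℚ.- (n ℚ.+ n) * P) ℚ.- o) ℚ.+ (δ ℚ.+ δ) ℚ.- q ≡
        (((B ℚ.+ B) ℚ.+ (o ℚ.+ q)) ℚ.+ ((A ℚ.+ A) ℚ.+ ((E ℚ.+ δ) ℚ.+ (E ℚ.+ δ)))) ℚ.-
        ((((A ℚ.+ n * P) ℚ.+ (A ℚ.+ n * P)) ℚ.+ B) ℚ.+ ((E ℚ.+ E) ℚ.+ ((o ℚ.+ q) ℚ.+ (o ℚ.+ q))))
      ring = solve 8 (λ q o A B E n P δ →
        ((B :- (n :+ n) :* P) :- o) :+ (δ :+ δ) :- q :=
        (((B :+ B) :+ (o :+ q)) :+ ((A :+ A) :+ ((E :+ δ) :+ (E :+ δ)))) :-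
        ((((A :+ n :* P) :+ (A :+ n :* P)) :+ B) :+ ((E :+ E) :+ ((o :+ q) :+ (o :+ q))))) refl
        where open +-*-Solver

    maxLength : List (Walk h) → ℕ
    maxLength []       = 0
    maxLength (W ∷ Ws) = length W ⊔ maxLength Ws

    length≤max : ∀ {W Ws} → W ∈ Ws → length W ≤ maxLength Ws
    length≤max {Ws = W ∷ Ws} (here refl) = ℕ.m≤m⊔n _ _
    length≤max {Ws = W ∷ Ws} (there W∈)  = ℕ.≤-trans (length≤max W∈) (ℕ.m≤n⊔m (length W) _)

    gsaws-sum : HasSum (IsGSAW s) term q
    gsaws-sum ε 0<ε = gsaws g [] s , All.tabulate (∈⇒isGSAW s g) , bound
      where
      -- A quarter of ε: the error 2 δ of `q≤partial` is then ε / 2, strictly below ε.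
      δ = ℚ.½ * (ℚ.½ * ε)
      0<δ = halve-pos (halve-pos 0<ε)
      f = proj₁ (lower δ 0<δ)
      g = f + f

      bound : ∀ F → Unique F → All (IsGSAW s) F → gsaws g [] s ⊆ F → ℚ.∣ sumℚ (map term F) ℚ.- q ∣ ℚ.< ε
      bound F F! F-gsaws ⊆F = subst (λ S → ℚ.∣ S ℚ.- q ∣ ℚ.< ε) (sym (sumℚ-map term F))
        (∣-∣<-intro
          -- F is contained in the list of all GSAWs up to its greatest length, and that partial sum
          -- is at most q because the terms are nonnegative.
          (ℚ.≤-trans (∑-⊆ term-nonNeg F! λ {W} W∈ →
              isGSAW⇒∈ s W (All.lookup F-gsaws W∈) (maxLength F) (ℕ.m≤n⇒m≤1+n (length≤max W∈)))
            (partial≤q (maxLength F)))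
          0<ε
          (begin-strict
            q                                                      ≤⟨ q≤partial f (proj₂ (lower δ 0<δ)) ⟩
            partial g ℚ.+ (δ ℚ.+ δ)                                ≤⟨ ℚ.+-monoˡ-≤ (δ ℚ.+ δ) (∑-⊆ term-nonNeg (gsaws-unique g [] s) ⊆F) ⟩
            ∑ F term ℚ.+ (δ ℚ.+ δ)                                 <⟨ ℚ.+-monoʳ-< (∑ F term) 2δ<ε ⟩
            ∑ F term ℚ.+ ε                                         ∎))
        where
        open ℚ.≤-Reasoning
        2δ<ε : δ ℚ.+ δ ℚ.< ε
        2δ<ε = subst₂ ℚ._<_ (ℚ.+-identityʳ (δ ℚ.+ δ)) (quarters ε) (ℚ.+-monoʳ-< (δ ℚ.+ δ) (ℚ.+-mono-< 0<δ 0<δ))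

-- Linear systems

⟨⟩-linear : ∀ {A : Set} (ws : Weighted A) c {f g : A → ℚ} →
  ⟨ ws , (λ x → c * f x ℚ.+ g x) ⟩ ≡ c * ⟨ ws , f ⟩ ℚ.+ ⟨ ws , g ⟩
⟨⟩-linear ws c {f} {g} = trans (∑-cong ws λ {(d , x)} _ → ring (1/′ d) c (f x) (g x)) (∑-linear ws c)
  where
  ring : ∀ w c f g → w * (c * f ℚ.+ g) ≡ c * (w * f) ℚ.+ w * g
  ring = solve 4 (λ w c f g → w :* (c :* f :+ g) := c :* (w :* f) :+ w :* g) refl
    where open +-*-Solver

⟨⟩-*ˡ : ∀ {A : Set} (ws : Weighted A) c {f : A → ℚ} → ⟨ ws , (λ x → c * f x) ⟩ ≡ c * ⟨ ws , f ⟩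
⟨⟩-*ˡ ws c {f} = trans (∑-cong ws λ {(d , x)} _ → ring (1/′ d) c (f x)) (∑-*ˡ ws c)
  where
  ring : ∀ w c f → w * (c * f) ≡ c * (w * f)
  ring = solve 3 (λ w c f → w :* (c :* f) := c :* (w :* f)) refl
    where open +-*-Solver

⟨⟩-mono : ∀ {A : Set} (ws : Weighted A) {f g : A → ℚ} →
  (∀ {d x} → (d , x) ∈ ws → f x ℚ.≤ g x) → ⟨ ws , f ⟩ ℚ.≤ ⟨ ws , g ⟩
⟨⟩-mono ws fg = ∑-mono ws λ {(d , x)} x∈ → *-monoˡ (0≤1/′ d) (fg x∈)

⟨⟩-nonNeg : ∀ {A : Set} (ws : Weighted A) {f : A → ℚ} → (∀ x → 0ℚ ℚ.≤ f x) → 0ℚ ℚ.≤ ⟨ ws , f ⟩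
⟨⟩-nonNeg ws 0≤f = ∑-nonNeg ws λ (d , x) → *-nonNeg (0≤1/′ d) (0≤f x)

quotient : ∀ p {q} → 0ℚ ℚ.< q → ∃[ m ] m * q ≡ p
quotient p {q} 0<q = p * 1/ q , trans (ℚ.*-assoc p (1/ q) q)
  (trans (cong (p *_) (ℚ.*-inverseˡ q)) (ℚ.*-identityʳ p))
  where instance
  q≢0 : ℚ.NonZero q
  q≢0 = ℚ.pos⇒nonZero q {{ℚ.positive 0<q}}

*-cancelʳ-≤ : ∀ {p q r} → 0ℚ ℚ.< r → p * r ℚ.≤ q * r → p ℚ.≤ q
*-cancelʳ-≤ {r = r} 0<r = ℚ.*-cancelʳ-≤-pos r {{ℚ.positive 0<r}}

*-pos : ∀ {p q} → 0ℚ ℚ.< p → 0ℚ ℚ.< q → 0ℚ ℚ.< p * q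
*-pos {p} {q} 0<p 0<q = subst (ℚ._< p * q) (ℚ.*-zeroʳ p) (ℚ.*-monoʳ-<-pos p {{ℚ.positive 0<p}} 0<q)

0<-intro : ∀ {p q} → p ℚ.< q → 0ℚ ℚ.< q ℚ.- p
0<-intro {p} {q} p<q = subst (ℚ._< q ℚ.- p) (ℚ.+-inverseʳ p) (ℚ.+-monoˡ-< (ℚ.- p) p<q)

module _ {I : Set} (_≟_ : DecidableEquality I) (row : I → Weighted I)
  (v : I → ℚ) (0≤v : ∀ i → 0ℚ ℚ.≤ v i) (θ : ℚ) (θ<1 : θ ℚ.< 1ℚ) where

  open DecMembership _≟_ using (_∈?_)

  Contracting : I → Set
  Contracting k = 0ℚ ℚ.< v k × ⟨ row k , v ⟩ ℚ.≤ θ * v k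

  private module _ (d : I → ℚ) where

    -- `M` is the maximum of 0 and the ratios d / v over `ks`. Including 0 makes d ≤ M v hold also
    -- at the indices outside `ks`, where d ≤ 0.
    Dominates : List I → ℚ → Set
    Dominates ks M = 0ℚ ℚ.≤ M × (∀ {k} → k ∈ ks → d k ℚ.≤ M * v k) ×
      (M ≡ 0ℚ ⊎ ∃[ k ] (k ∈ ks × d k ≡ M * v k))

    largest-ratio : ∀ ks → All Contracting ks → ∃ (Dominates ks)
    largest-ratio []       _        = 0ℚ , ℚ.≤-refl , (λ ()) , inj₁ refl
    largest-ratio (k ∷ ks) ((0<vk , _) ∷ good) with largest-ratio ks good
    ... | M , 0≤M , d≤ , attained with ℚ.≤-total (d k) (M * v k)
    ...   | inj₁ dk≤ = M , 0≤M , (λ { (here refl) → dk≤ ; (there j∈) → d≤ j∈ }) ,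
      (case attained of λ { (inj₁ eq) → inj₁ eq ; (inj₂ (j , j∈ , eq)) → inj₂ (j , there j∈ , eq) })
    ...   | inj₂ ≤dk = let M′ , M′v≡d = quotient (d k) 0<vk
                           M≤M′ = *-cancelʳ-≤ 0<vk (ℚ.≤-trans ≤dk (ℚ.≤-reflexive (sym M′v≡d))) in
      M′ , ℚ.≤-trans 0≤M M≤M′ ,
      (λ { (here refl) → ℚ.≤-reflexive (sym M′v≡d)
         ; (there {xs = xs} j∈) → ℚ.≤-trans (d≤ j∈) (ℚ.*-monoʳ-≤-nonNeg (v _) {{ℚ.nonNegative (0≤v _)}} M≤M′) }) ,
      inj₂ (k , here refl , sym M′v≡d)

  -- At an index of ks where (y − z) / v attains its maximum M, the row
  -- inequalities give M ≤ θ M, so M ≤ 0.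
  maximum-principle : ∀ {ks} → All Contracting ks → ∀ {y z : I → ℚ} →
    (∀ {k} → k ∈ ks → y k ℚ.≤ ⟨ row k , y ⟩) → (∀ {k} → k ∈ ks → ⟨ row k , z ⟩ ℚ.≤ z k) →
    (∀ i → i ∈ ks ⊎ y i ℚ.≤ z i) → ∀ i → y i ℚ.≤ z i
  maximum-principle {ks} good {y} {z} y≤ ≤z off i = ≤-by (ℚ.≤-trans (d≤Mv i) (Mv≤0 attained)) (ring (y i) (z i))
    where
    d = λ i → ℚ.- 1ℚ * z i ℚ.+ y i
    ring : ∀ y z → z ℚ.- y ≡ 0ℚ ℚ.- (ℚ.- 1ℚ * z ℚ.+ y)
    ring = solve 2 (λ y z → z :- y := con 0ℚ :- (:- con 1ℚ :* z :+ y)) refl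
      where open +-*-Solver
    ratio = largest-ratio d ks good
    M = proj₁ ratio
    0≤M = proj₁ (proj₂ ratio)
    attained = proj₂ (proj₂ (proj₂ ratio))

    d≤0 : ∀ i → y i ℚ.≤ z i → d i ℚ.≤ 0ℚ
    d≤0 i y≤z = ≤-by y≤z (ring′ (y i) (z i))
      where
      ring′ : ∀ y z → 0ℚ ℚ.- (ℚ.- 1ℚ * z ℚ.+ y) ≡ z ℚ.- y
      ring′ = solve 2 (λ y z → con 0ℚ :- (:- con 1ℚ :* z :+ y) := z :- y) refl
        where open +-*-Solver

    d≤Mv : ∀ i → d i ℚ.≤ M * v i
    d≤Mv i with off i
    ... | inj₁ i∈  = proj₁ (proj₂ (proj₂ ratio)) i∈
    ... | inj₂ y≤z = ℚ.≤-trans (d≤0 i y≤z) (*-nonNeg 0≤M (0≤v i))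

    Mv≤0 : (M ≡ 0ℚ ⊎ ∃[ k ] (k ∈ ks × d k ≡ M * v k)) → M * v i ℚ.≤ 0ℚ
    Mv≤0 (inj₁ M≡0) = ℚ.≤-reflexive (trans (cong (ℚ._* v i) M≡0) (ℚ.*-zeroˡ (v i)))
    Mv≤0 (inj₂ (k , k∈ , eq)) = subst (M * v i ℚ.≤_) (ℚ.*-zeroˡ (v i))
      (ℚ.*-monoʳ-≤-nonNeg (v i) {{ℚ.nonNegative (0≤v i)}} M≤0)
      where
      open ℚ.≤-Reasoning
      dk≤ : M * v k ℚ.≤ M * (θ * v k)
      dk≤ = begin
        M * v k                                        ≡⟨ eq ⟨
        ℚ.- 1ℚ * z k ℚ.+ y k                           ≤⟨ ℚ.+-mono-≤ {ℚ.- 1ℚ * z k} {ℚ.- 1ℚ * ⟨ row k , z ⟩} (≤-by (≤z k∈) (neg (z k) ⟨ row k , z ⟩)) (y≤ k∈) ⟩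
        ℚ.- 1ℚ * ⟨ row k , z ⟩ ℚ.+ ⟨ row k , y ⟩        ≡⟨ ⟨⟩-linear (row k) (ℚ.- 1ℚ) {z} {y} ⟨
        ⟨ row k , d ⟩                                    ≤⟨ ⟨⟩-mono (row k) (λ {_} {x} _ → d≤Mv x) ⟩
        ⟨ row k , (λ x → M * v x) ⟩                    ≡⟨ ⟨⟩-*ˡ (row k) M {v} ⟩
        M * ⟨ row k , v ⟩                              ≤⟨ *-monoˡ 0≤M (proj₂ (All.lookup good k∈)) ⟩
        M * (θ * v k)                                ∎
        where
        neg : ∀ a b → ℚ.- 1ℚ * b ℚ.- ℚ.- 1ℚ * a ≡ a ℚ.- b
        neg = solve 2 (λ a b → :- con 1ℚ :* b :- :- con 1ℚ :* a := a :- b) refl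
          where open +-*-Solver

      M≤0 : M ℚ.≤ 0ℚ
      M≤0 = *-cancelʳ-≤ (*-pos (0<-intro θ<1) (proj₁ (All.lookup good k∈)))
        (≤-by dk≤ (slack M θ (v k)))
        where
        slack : ∀ M θ v → 0ℚ * ((1ℚ ℚ.- θ) * v) ℚ.- M * ((1ℚ ℚ.- θ) * v) ≡ M * (θ * v) ℚ.- M * v
        slack = solve 3 (λ M θ v → con 0ℚ :* ((con 1ℚ :- θ) :* v) :- M :* ((con 1ℚ :- θ) :* v) := M :* (θ :* v) :- M :* v) refl
          where open +-*-Solver

  Solves : List I → (I → ℚ) → (I → ℚ) → Set
  Solves ks g x = (∀ {k} → k ∈ ks → x k ≡ ⟨ row k , x ⟩) × (∀ i → i ∈ ks ⊎ x i ≡ g i)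

  indicator : I → I → ℚ
  indicator k i = if does (i ≟ k) then 1ℚ else 0ℚ

  without : I → (I → ℚ) → I → ℚ
  without k g i = if does (i ≟ k) then 0ℚ else g i

  -- One elimination step. For x = t · e + x₀ the row of `k` reads t = t r + ⟨ row k , x₀ ⟩, so t is
  -- a quotient by 1 - r. The point is r < 1, a consequence of the contracting weight.
  augment : ∀ {k ks} → Contracting k → All Contracting ks → k ∉ ks → ∀ {g x₀ e} →
    Solves ks (without k g) x₀ → Solves ks (indicator k) e → ∃ (Solves (k ∷ ks) g)
  augment {k} {ks} contr good k∉ {g} {x₀} {e} sol₀ sol₁ = x , x≡ , x-off
    where
    r = ⟨ row k , e ⟩

    at-k : ∀ {x g : I → ℚ} → (∀ i → i ∈ ks ⊎ x i ≡ g i) → x k ≡ g k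
    at-k off with off k
    ... | inj₁ k∈ = ⊥-elim (k∉ k∈)
    ... | inj₂ eq = eq

    x₀k≡0 : x₀ k ≡ 0ℚ
    x₀k≡0 = trans (at-k (proj₂ sol₀)) (cong (λ b → if b then 0ℚ else g k) (dec-true (k ≟ k) refl))

    ek≡1 : e k ≡ 1ℚ
    ek≡1 = trans (at-k (proj₂ sol₁)) (cong (λ b → if b then 1ℚ else 0ℚ) (dec-true (k ≟ k) refl))

    c = proj₁ (quotient 1ℚ (proj₁ contr))
    cvk≡1 = proj₂ (quotient 1ℚ (proj₁ contr))
    0≤c : 0ℚ ℚ.≤ c
    0≤c = *-cancelʳ-≤ (proj₁ contr) (subst₂ ℚ._≤_ (sym (ℚ.*-zeroˡ (v k))) (sym cvk≡1) (0≤ι 1))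

    row-cv : ∀ {j} → Contracting j → ⟨ row j , (λ i → c * v i) ⟩ ℚ.≤ θ * (c * v j)
    row-cv {j} (_ , rv≤) = begin
      ⟨ row j , (λ i → c * v i) ⟩ ≡⟨ ⟨⟩-*ˡ (row j) c {v} ⟩
      c * ⟨ row j , v ⟩           ≤⟨ *-monoˡ 0≤c rv≤ ⟩
      c * (θ * v j)             ≡⟨ swap c θ (v j) ⟩
      θ * (c * v j)             ∎
      where
      open ℚ.≤-Reasoning
      swap : ∀ c θ v → c * (θ * v) ≡ θ * (c * v)
      swap = solve 3 (λ c θ v → c :* (θ :* v) := θ :* (c :* v)) refl
        where open +-*-Solver

    -- With c = 1 / v k the function c v is a supersolution with value 1 at `k`, so it dominates e.
    -- Hence r is at most ⟨ row k , c v ⟩ ≤ θ c v k = θ.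
    e≤cv : ∀ i → e i ℚ.≤ c * v i
    e≤cv = maximum-principle good (λ k∈ → ℚ.≤-reflexive (proj₁ sol₁ k∈))
      (λ {j} j∈ → ℚ.≤-trans (row-cv (All.lookup good j∈))
        (subst (θ * (c * v j) ℚ.≤_) (ℚ.*-identityˡ _)
          (ℚ.*-monoʳ-≤-nonNeg (c * v j) {{ℚ.nonNegative (*-nonNeg 0≤c (0≤v j))}} (ℚ.<⇒≤ θ<1))))
      λ i → case proj₂ sol₁ i of λ { (inj₁ i∈) → inj₁ i∈ ; (inj₂ eq) → inj₂ (subst (ℚ._≤ c * v i) (sym eq) (bound i)) }
      where
      bound : ∀ i → indicator k i ℚ.≤ c * v i
      bound i with i ≟ k
      ... | yes refl = ℚ.≤-reflexive (sym cvk≡1)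
      ... | no  _    = *-nonNeg 0≤c (0≤v i)

    r<1 : r ℚ.< 1ℚ
    r<1 = ℚ.≤-<-trans (begin
      r                              ≤⟨ ⟨⟩-mono (row k) (λ {_} {i} _ → e≤cv i) ⟩
      ⟨ row k , (λ i → c * v i) ⟩  ≤⟨ row-cv contr ⟩
      θ * (c * v k)              ≡⟨ cong (θ *_) cvk≡1 ⟩
      θ * 1ℚ                       ≡⟨ ℚ.*-identityʳ θ ⟩
      θ                              ∎) θ<1
      where open ℚ.≤-Reasoning

    t = proj₁ (quotient ⟨ row k , x₀ ⟩ (0<-intro r<1))
    t≡ = proj₂ (quotient ⟨ row k , x₀ ⟩ (0<-intro r<1))

    x : I → ℚ
    x i = t * e i ℚ.+ x₀ i

    x≡ : ∀ {j} → j ∈ k ∷ ks → x j ≡ ⟨ row j , x ⟩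
    x≡ (here refl) = begin
      t * e k ℚ.+ x₀ k                      ≡⟨ cong₂ (λ a b → t * a ℚ.+ b) ek≡1 x₀k≡0 ⟩
      t * 1ℚ ℚ.+ 0ℚ                         ≡⟨ split t r ⟩
      t * r ℚ.+ t * (1ℚ ℚ.- r)            ≡⟨ cong (t * r ℚ.+_) t≡ ⟩
      t * r ℚ.+ ⟨ row k , x₀ ⟩              ≡⟨ ⟨⟩-linear (row k) t {e} {x₀} ⟨
      ⟨ row k , x ⟩                           ∎
      where
      open ≡-Reasoning
      split : ∀ t r → t * 1ℚ ℚ.+ 0ℚ ≡ t * r ℚ.+ t * (1ℚ ℚ.- r)
      split = solve 2 (λ t r → t :* con 1ℚ :+ con 0ℚ := t :* r :+ t :* (con 1ℚ :- r)) refl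
        where open +-*-Solver
    x≡ {j} (there j∈) = trans (cong₂ (λ a b → t * a ℚ.+ b) (proj₁ sol₁ j∈) (proj₁ sol₀ j∈))
      (sym (⟨⟩-linear (row j) t {e} {x₀}))

    x-off : ∀ i → i ∈ k ∷ ks ⊎ x i ≡ g i
    x-off i = go (i ≟ k) (proj₂ sol₀ i) (proj₂ sol₁ i)
      where
      vanish : t * 0ℚ ℚ.+ g i ≡ g i
      vanish = trans (cong (ℚ._+ g i) (ℚ.*-zeroʳ t)) (ℚ.+-identityˡ (g i))

      go : (i≟k : Dec (i ≡ k)) → i ∈ ks ⊎ x₀ i ≡ (if does i≟k then 0ℚ else g i) →
        i ∈ ks ⊎ e i ≡ (if does i≟k then 1ℚ else 0ℚ) → i ∈ k ∷ ks ⊎ x i ≡ g i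
      go (yes i≡k) _          _          = inj₁ (here i≡k)
      go (no _)    (inj₁ i∈)  _          = inj₁ (there i∈)
      go (no _)    (inj₂ _)   (inj₁ i∈)  = inj₁ (there i∈)
      go (no _)    (inj₂ eq₀) (inj₂ eq₁) = inj₂ (trans (cong₂ (λ a b → t * a ℚ.+ b) eq₁ eq₀) vanish)

  -- The solution for k ∷ ks is x₀ + t · e, where x₀ and e solve the rows of ks
  -- with the value at k prescribed to be 0 and 1 respectively.
  solvable : ∀ ks → All Contracting ks → ∀ g → ∃ (Solves ks g)
  solvable []       _ g = g , (λ ()) , λ i → inj₂ refl
  solvable (k ∷ ks) (contr ∷ good) g with k ∈? ks
  ... | yes k∈ = let x , x≡ , off = solvable ks good g in x ,
    (λ { (here refl) → x≡ k∈ ; (there j∈) → x≡ j∈ }) ,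
    λ i → case off i of λ { (inj₁ i∈) → inj₁ (there i∈) ; (inj₂ eq) → inj₂ eq }
  ... | no k∉ = augment contr good k∉ (proj₂ (solvable ks good (without k g))) (proj₂ (solvable ks good (indicator k)))

-- Convergence

≤ι∣↥∣ : ∀ r → r ℚ.≤ ι ℤ.∣ ℚ.↥ r ∣
≤ι∣↥∣ r@record{} = ℚ.toℚᵘ-cancel-≤ (ℚᵘ.≤-respʳ-≃ (ℚᵘ.≃-sym (ℚ.toℚᵘ-fromℚᵘ (ℚᵘ.mkℚᵘ (+ ℤ.∣ ℚ.↥ r ∣) 0)))
  (ℚᵘ.*≤* (bound (ℚ.↥ r) (ℚ.denominator-1 r))))
  where
  bound : ∀ n d → n ℤ.* + 1 ℤ.≤ + ℤ.∣ n ∣ ℤ.* + suc d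
  bound (+ n) d = subst₂ ℤ._≤_ (sym (ℤ.*-identityʳ (+ n))) (ℤ.pos-* n (suc d)) (ℤ.+≤+ (ℕ.m≤m*n n (suc d)))
  bound ℤ.-[1+ n ] d = ℤ.-≤+

_^ℚ_ : ℚ → ℕ → ℚ
θ ^ℚ zero  = 1ℚ
θ ^ℚ suc n = θ * (θ ^ℚ n)

^ℚ-nonNeg : ∀ {θ} → 0ℚ ℚ.≤ θ → ∀ n → 0ℚ ℚ.≤ θ ^ℚ n
^ℚ-nonNeg 0≤θ zero    = 0≤ι 1
^ℚ-nonNeg 0≤θ (suc n) = *-nonNeg 0≤θ (^ℚ-nonNeg 0≤θ n)

-- Bernoulli's inequality without division. With s = 1 - θ the induction step rests on (1 + n s) -
-- (1 + (n + 1) s) θ = (n + 1) s².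
bernoulli : ∀ {θ} → 0ℚ ℚ.≤ θ → ∀ n → (1ℚ ℚ.+ ι n * (1ℚ ℚ.- θ)) * (θ ^ℚ n) ℚ.≤ 1ℚ
bernoulli {θ} 0≤θ zero = ℚ.≤-reflexive (trans (ℚ.*-identityʳ (1ℚ ℚ.+ 0ℚ * (1ℚ ℚ.- θ)))
  (trans (cong (1ℚ ℚ.+_) (ℚ.*-zeroˡ (1ℚ ℚ.- θ))) (ℚ.+-identityʳ 1ℚ)))
bernoulli {θ} 0≤θ (suc n) = begin
  (1ℚ ℚ.+ ι (suc n) * s) * (θ * P)              ≡⟨ cong (λ m → (1ℚ ℚ.+ m * s) * (θ * P)) (ι-suc n) ⟩
  (1ℚ ℚ.+ (1ℚ ℚ.+ ι n) * s) * (θ * P)           ≤⟨ ≤-by (*-nonNeg (+-nonNeg {1ℚ} (0≤ι 1) (0≤ι n)) (*-nonNeg (square s) (^ℚ-nonNeg 0≤θ n)))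
                                                            (ring θ (ι n) P) ⟩
  (1ℚ ℚ.+ ι n * s) * P                            ≤⟨ bernoulli 0≤θ n ⟩
  1ℚ                                                  ∎
  where
  open ℚ.≤-Reasoning
  s = 1ℚ ℚ.- θ
  P = θ ^ℚ n
  square : ∀ s → 0ℚ ℚ.≤ s * s
  square s with ℚ.≤-total 0ℚ s
  ... | inj₁ 0≤s = *-nonNeg 0≤s 0≤s
  ... | inj₂ s≤0 = subst (ℚ._≤ s * s) (ℚ.*-zeroʳ s) (ℚ.*-monoˡ-≤-nonPos s {{ℚ.nonPositive s≤0}} s≤0)
  ring : ∀ θ n P → (1ℚ ℚ.+ n * (1ℚ ℚ.- θ)) * P ℚ.- (1ℚ ℚ.+ (1ℚ ℚ.+ n) * (1ℚ ℚ.- θ)) * (θ * P) ≡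
    (1ℚ ℚ.+ n) * (((1ℚ ℚ.- θ) * (1ℚ ℚ.- θ)) * P) ℚ.- 0ℚ
  ring = solve 3 (λ θ n P → (con 1ℚ :+ n :* (con 1ℚ :- θ)) :* P :- (con 1ℚ :+ (con 1ℚ :+ n) :* (con 1ℚ :- θ)) :* (θ :* P) :=
    (con 1ℚ :+ n) :* (((con 1ℚ :- θ) :* (con 1ℚ :- θ)) :* P) :- con 0ℚ) refl
    where open +-*-Solver

powers-vanish : ∀ {θ V ε} → 0ℚ ℚ.≤ θ → θ ℚ.< 1ℚ → 0ℚ ℚ.≤ V → 0ℚ ℚ.< ε → ∃[ n ] (θ ^ℚ n) * V ℚ.≤ ε
powers-vanish {θ} {V} {ε} 0≤θ θ<1 0≤V 0<ε = n , (begin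
  P * V                                   ≡⟨ cong (P *_) r≡ ⟨
  P * (r * (s * ε))                   ≤⟨ *-monoˡ (^ℚ-nonNeg 0≤θ n) (ℚ.*-monoʳ-≤-nonNeg (s * ε) {{ℚ.nonNegative 0≤sε}} r≤) ⟩
  P * (ι n * (s * ε))                 ≤⟨ ≤-by (*-nonNeg (^ℚ-nonNeg 0≤θ n) (ℚ.<⇒≤ 0<ε)) (ring P (ι n) θ ε) ⟩
  ((1ℚ ℚ.+ ι n * s) * P) * ε          ≤⟨ ℚ.*-monoʳ-≤-nonNeg ε {{ℚ.nonNegative (ℚ.<⇒≤ 0<ε)}} (bernoulli 0≤θ n) ⟩
  1ℚ * ε                                  ≡⟨ ℚ.*-identityˡ ε ⟩
  ε                                         ∎)
  where
  open ℚ.≤-Reasoning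
  s = 1ℚ ℚ.- θ
  0<sε = *-pos (0<-intro θ<1) 0<ε
  0≤sε = ℚ.<⇒≤ 0<sε
  r = proj₁ (quotient V 0<sε)
  r≡ = proj₂ (quotient V 0<sε)
  -- A natural number at least r = V / ((1 - θ) ε): the absolute value of the numerator of r, the
  -- denominator being at least 1.
  n = ℤ.∣ ℚ.↥ r ∣
  r≤ = ≤ι∣↥∣ r
  P = θ ^ℚ n
  ring : ∀ P n θ ε → ((1ℚ ℚ.+ n * (1ℚ ℚ.- θ)) * P) * ε ℚ.- P * (n * ((1ℚ ℚ.- θ) * ε)) ≡ P * ε ℚ.- 0ℚ
  ring = solve 4 (λ P n θ ε → ((con 1ℚ :+ n :* (con 1ℚ :- θ)) :* P) :* ε :- P :* (n :* ((con 1ℚ :- θ) :* ε)) := P :* ε :- con 0ℚ) refl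
    where open +-*-Solver

module _ {h : ℕ} (Known : Test h → Set) (closed : ∀ {T} → Known T → ∀ {d U} → (d , U) ∈ step T → Known U)
  (x v : Test h → ℚ) {θ : ℚ} (0≤θ : 0ℚ ℚ.≤ θ) (θ<1 : θ ℚ.< 1ℚ)
  (0≤v : ∀ T → 0ℚ ℚ.≤ v T) (0≤x : ∀ T → 0ℚ ℚ.≤ x T) (x≤v : ∀ T → x T ℚ.≤ v T) (x-stop : x stop ≡ 1ℚ)
  (x-step : ∀ {T} → Known T → x T ≡ ⟨ step T , x ⟩)
  (v-step : ∀ {λₗ a g} → Known (enter λₗ a g) → ⟨ step (enter λₗ a g) , v ⟩ ℚ.≤ θ * v (enter λₗ a g)) where

  score≤x : ∀ n T → Known T → score n ∅ (fresh n) T ℚ.≤ x T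
  score≤x n       stop            k = ℚ.≤-reflexive (sym x-stop)
  score≤x zero    T@(enter _ _ _) k = 0≤x T
  score≤x (suc n) T@(enter _ _ _) k = subst₂ ℚ._≤_ (sym (score-step T n)) (sym (x-step k))
    (⟨⟩-mono (step T) λ {_} {U} U∈ → score≤x n U (closed k U∈))

  x≤score : ∀ n T → Known T → x T ℚ.≤ (θ ^ℚ n) * v T ℚ.+ score n ∅ (fresh n) T
  x≤score n stop k = subst (ℚ._≤ (θ ^ℚ n) * v stop ℚ.+ 1ℚ) (trans (ℚ.+-identityˡ 1ℚ) (sym x-stop))
    (ℚ.+-monoˡ-≤ 1ℚ (*-nonNeg (^ℚ-nonNeg 0≤θ n) (0≤v stop)))
  x≤score zero T@(enter _ _ _) k = subst (x T ℚ.≤_)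
    (sym (trans (ℚ.+-identityʳ (1ℚ * v T)) (ℚ.*-identityˡ (v T)))) (x≤v T)
  x≤score (suc n) T@(enter _ _ _) k = begin
    x T                                                      ≡⟨ x-step k ⟩
    ⟨ step T , x ⟩                                           ≤⟨ ⟨⟩-mono (step T) (λ {_} {U} U∈ → x≤score n U (closed k U∈)) ⟩
    ⟨ step T , (λ U → (θ ^ℚ n) * v U ℚ.+ X U) ⟩            ≡⟨ ⟨⟩-linear (step T) (θ ^ℚ n) {v} {X} ⟩
    (θ ^ℚ n) * ⟨ step T , v ⟩ ℚ.+ ⟨ step T , X ⟩           ≤⟨ ℚ.+-monoˡ-≤ ⟨ step T , X ⟩ (*-monoˡ (^ℚ-nonNeg 0≤θ n) (v-step k)) ⟩
    (θ ^ℚ n) * (θ * v T) ℚ.+ ⟨ step T , X ⟩              ≡⟨ cong₂ ℚ._+_ (swap (θ ^ℚ n) θ (v T)) (sym (score-step T n)) ⟩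
    (θ ^ℚ suc n) * v T ℚ.+ score (suc n) ∅ (fresh (suc n)) T ∎
    where
    open ℚ.≤-Reasoning
    X = score n ∅ (fresh n)
    swap : ∀ a b c → a * (b * c) ≡ (b * a) * c
    swap = solve 3 (λ a b c → a :* (b :* c) := (b :* a) :* c) refl
      where open +-*-Solver

  expected-length : ∀ a → Known (enter full a end) →
    HasSum (IsGSAW (0 , a)) (λ W → pᵁ W * (+ ∣ W ∣ʷ / 1)) (x (enter full a end) ℚ.- 1ℚ)
  expected-length a k = gsaws-sum (0 , a) (x R ℚ.- 1ℚ) upper lower
    where
    R = enter full a end
    1+[x-1]≡x : ∀ x → 1ℚ ℚ.+ (x ℚ.- 1ℚ) ≡ x
    1+[x-1]≡x = solve 1 (λ x → con 1ℚ :+ (x :- con 1ℚ) := x) refl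
      where open +-*-Solver

    upper : ∀ f → expectedVisits f [] (0 , a) ℚ.≤ 1ℚ ℚ.+ (x R ℚ.- 1ℚ)
    upper f = subst (expectedVisits f [] (0 , a) ℚ.≤_) (sym (1+[x-1]≡x (x R)))
      (ℚ.≤-trans (expectedVisits≤score f a) (score≤x f R k))

    lower : ∀ ε → 0ℚ ℚ.< ε → ∃[ f ] 1ℚ ℚ.+ (x R ℚ.- 1ℚ) ℚ.≤ expectedVisits f [] (0 , a) ℚ.+ ε
    lower ε 0<ε = let n , small = powers-vanish 0≤θ θ<1 (0≤v R) 0<ε ; f , score≤ = score≤expectedVisits n a in
      f , (begin
        1ℚ ℚ.+ (x R ℚ.- 1ℚ)                          ≡⟨ 1+[x-1]≡x (x R) ⟩
        x R                                          ≤⟨ x≤score n R k ⟩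
        (θ ^ℚ n) * v R ℚ.+ score n ∅ (fresh n) R   ≤⟨ ℚ.+-mono-≤ small score≤ ⟩
        ε ℚ.+ expectedVisits f [] (0 , a)            ≡⟨ ℚ.+-comm ε (expectedVisits f [] (0 , a)) ⟩
        expectedVisits f [] (0 , a) ℚ.+ ε            ∎)
      where open ℚ.≤-Reasoning

-- Certificates

module _ {h : ℕ} where

  private
    _≟ᶜ_ : DecidableEquality (Column h)
    _≟ᶜ_ = ≡-dec Bool._≟_

  mutual
    _≟ᵗ_ : DecidableEquality (Test h)
    stop          ≟ᵗ stop             = yes refl
    stop          ≟ᵗ enter _ _ _      = no λ ()
    enter _ _ _   ≟ᵗ stop             = no λ ()
    enter c a g   ≟ᵗ enter c′ a′ g′ with c ≟ᶜ c′ | a Fin.≟ a′ | g ≟ᵍ g′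
    ... | yes refl | yes refl | yes refl = yes refl
    ... | no c≢    | _        | _        = no λ { refl → c≢ refl }
    ... | yes _    | no a≢    | _        = no λ { refl → a≢ refl }
    ... | yes _    | yes _    | no g≢    = no λ { refl → g≢ refl }

    _≟ᵍ_ : DecidableEquality (Goal h)
    end        ≟ᵍ end           = yes refl
    end        ≟ᵍ exit _ _ _    = no λ ()
    exit _ _ _ ≟ᵍ end           = no λ ()
    exit b μ T ≟ᵍ exit b′ μ′ T′ with b Fin.≟ b′ | μ ≟ᶜ μ′ | T ≟ᵗ T′
    ... | yes refl | yes refl | yes refl = yes refl
    ... | no b≢    | _        | _        = no λ { refl → b≢ refl }
    ... | yes _    | no μ≢    | _        = no λ { refl → μ≢ refl }
    ... | yes _    | yes _    | no T≢    = no λ { refl → T≢ refl }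

  bits : ∀ {n} → Column n → ℕ → ℕ
  bits []          m = m
  bits (true ∷ c)  m = bits c (suc (2 ℕ.* m))
  bits (false ∷ c) m = bits c (2 ℕ.* m)

  -- Only the speed of lookups depends on this code.
  mutual
    code : ℕ → Test h → ℕ
    code m stop          = m
    code m (enter c a g) = goalCode (bits c (toℕ a + 8 ℕ.* m)) g

    goalCode : ℕ → Goal h → ℕ
    goalCode m end          = 2 ℕ.* m
    goalCode m (exit b μ T) = code (suc (2 ℕ.* bits μ (toℕ b + 8 ℕ.* m))) T

  -- Storing step T lets the evaluator share its computation between the
  -- exploration and the check.
  record Entry (T : Test h) : Set where
    constructor entry
    field
      weight estimate : ℕ
      expansion     : Weighted (Test h)
      expansion≡    : expansion ≡ step T
  open Entry

  data Tree : Set where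
    leaf : Tree
    node : Tree → ℕ → (T : Test h) → Entry T → Tree → Tree

  cast? : ∀ {T U} → Dec (T ≡ U) → Entry T → Maybe (Entry U)
  cast? (yes refl) e = just e
  cast? (no _)     e = nothing

  find : Tree → ℕ → (U : Test h) → Maybe (Entry U)
  find leaf             m U = nothing
  find (node l n T e r) m U = if m <ᵇ n then find l m U else (if n <ᵇ m then find r m U else cast? (T ≟ᵗ U) e)

  has : Tree → ℕ → Bool
  has leaf             m = false
  has (node l n T e r) m = if m <ᵇ n then has l m else (if n <ᵇ m then has r m else true)

  insert : ℕ → (T : Test h) → Entry T → Tree → Tree
  insert m U f leaf             = node leaf m U f leaf
  insert m U f (node l n T e r) = if m <ᵇ n then node (insert m U f l) n T e r else node l n T e (insert m U f r)

  mutual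
    explore-all : List (ℕ × ℕ) → List (Test h) → Tree → Tree
    explore-all ns []       t = t
    explore-all ns (T ∷ Ts) t = discover ns T (code 1 T) Ts t

    -- The table is also the fuel: each new transcript takes one entry. A transcript left out
    -- because the table has run out has no numbers, so the check fails at every row that needs it.
    discover : List (ℕ × ℕ) → Test h → ℕ → List (Test h) → Tree → Tree
    discover []       T               m Ts t = t
    discover (n ∷ ns) stop            m Ts t = explore-all (n ∷ ns) Ts t
    discover (n ∷ ns) T@(enter _ _ _) m Ts t =
      if has t m then explore-all (n ∷ ns) Ts t else extend n ns m Ts t T (step T) refl

    extend : ℕ × ℕ → List (ℕ × ℕ) → ℕ → List (Test h) → Tree → ∀ T ws → ws ≡ step T → Tree
    extend (v , x) ns m Ts t T ws eq = explore-all ns (map proj₂ ws ++ Ts) (insert m T (entry v x ws eq) t)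

  every : (∀ T → Entry T → Bool) → Tree → Bool
  every p leaf             = true
  every p (node l n T e r) = p T e ∧ (every p l ∧ every p r)

  keys : Tree → List (Test h)
  keys leaf             = []
  keys (node l n T e r) = T ∷ keys l ++ keys r

  -- The transcript with numbers v and x gets the weight v / (dᵥ + 1) and the lower
  -- bound x / (dₓ + 1) on its score; the upper bound adds c v to x. The common
  -- denominator s + 1 of the coefficients clears fractions, and the weights have to
  -- contract by the factor p / (p + 1).
  module Checker (s dᵥ dₓ c p : ℕ) where

    numbers : Tree → Test h → Maybe (ℕ × ℕ)
    -- Both fractions are 1, the score of `stop`.
    numbers t stop            = just (suc dᵥ , suc dₓ)
    numbers t T@(enter _ _ _) with find t (code 1 T) T
    ... | just e  = just (weight e , estimate e)
    ... | nothing = nothing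

    -- The integer candidate for the coefficient (s + 1) / d; `add` rejects the row unless the
    -- division is exact.
    share : ℕ → ℕ
    share zero    = 0
    share (suc d) = suc s ℕ./ suc d

    add : ℕ → ℕ → Maybe (ℕ × ℕ) → Maybe (ℕ × ℕ) → Maybe (ℕ × ℕ)
    add d w (just (v , x)) (just (V , X)) = if w ℕ.* d ≡ᵇ suc s then just (w ℕ.* v + V , w ℕ.* x + X) else nothing
    add d w _              _              = nothing

    totals : Tree → Weighted (Test h) → Maybe (ℕ × ℕ)
    totals t []             = just (0 , 0)
    totals t ((d , U) ∷ ws) = add d (share d) (numbers t U) (totals t ws)

    -- The tests say that v contracts, that x is a subsolution, that x + c v is a supersolution, and
    -- that x vanishes wherever v does. A rounded x can pass the third test because the contraction
    -- of v leaves a slack of at least c (1 - θ) v, which absorbs the rounding errors.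
    accept : ℕ → ℕ → Maybe (ℕ × ℕ) → Bool
    accept v x nothing        = false
    accept v x (just (V , X)) =
      (suc p ℕ.* V ≤ᵇ p ℕ.* (suc s ℕ.* v)) ∧ ((suc s ℕ.* x ≤ᵇ X) ∧
      ((X + c ℕ.* V ≤ᵇ suc s ℕ.* (x + c ℕ.* v)) ∧ (x ≤ᵇ v ℕ.* suc dₓ)))

    check : Tree → ∀ T → Entry T → Bool
    check t T e = accept (weight e) (estimate e) (totals t (expansion e))

    rootIs : ℕ → ℕ → Maybe (ℕ × ℕ) → Bool
    rootIs v x nothing          = false
    rootIs v x (just (v′ , x′)) = (v ≡ᵇ v′) ∧ (x ≡ᵇ x′)

    consistent : Test h → ℕ → ℕ → Tree → Bool
    consistent R v x t = rootIs v x (numbers t R) ∧ every (check t) t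

    certificate : Test h → ℕ → ℕ → List (ℕ × ℕ) → Bool
    certificate R v x ns = consistent R v x (explore-all ns (R ∷ []) leaf)

-- Soundness of the certificates

∧-true : ∀ {p q} → p ∧ q ≡ true → p ≡ true × q ≡ true
∧-true {true} {true} _ = refl , refl

≤ᵇ-true : ∀ m n → (m ≤ᵇ n) ≡ true → m ≤ n
≤ᵇ-true m n eq = ℕ.≤ᵇ⇒≤ m n (subst Bool.T (sym eq) tt)

≡ᵇ-true : ∀ m n → (m ≡ᵇ n) ≡ true → m ≡ n
≡ᵇ-true m n eq = ℕ.≡ᵇ⇒≡ m n (subst Bool.T (sym eq) tt)

fraction : ℕ → ℕ → ℚ
fraction d n = + n / suc d

fraction-mono : ∀ d {m n} → m ≤ n → fraction d m ℚ.≤ fraction d n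
fraction-mono d {m} {n} m≤n = subst (fraction d m ℚ.≤_)
  (trans (/-+ m (n ∸ m) d) (cong (fraction d) (ℕ.m+[n∸m]≡n m≤n)))
  (subst (ℚ._≤ fraction d m ℚ.+ fraction d (n ∸ m)) (ℚ.+-identityʳ (fraction d m)) (ℚ.+-monoʳ-≤ (fraction d m) (0≤/ (n ∸ m) d)))

ι*fraction : ∀ w d n → ι w * fraction d n ≡ fraction d (w ℕ.* n)
ι*fraction w d n = trans (/-* w 0 n d) (/≡ (w ℕ.* n) (d + 0) (w ℕ.* n) d (cong (λ d → w ℕ.* n ℕ.* suc d) (sym (ℕ.+-identityʳ d))))

fraction-0 : ∀ d → fraction d 0 ≡ 0ℚ
fraction-0 d = /≡ 0 d 0 0 refl

fraction-1 : ∀ d → fraction d (suc d) ≡ 1ℚ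
fraction-1 d = /≡ (suc d) d 1 0 (trans (ℕ.*-identityʳ (suc d)) (sym (ℕ.*-identityˡ (suc d))))

0<ι : ∀ n → 0ℚ ℚ.< ι (suc n)
0<ι n = ℚ.positive⁻¹ (ι (suc n)) {{ℚ.normalize-pos (suc n) 1}}

*-cancelˡ-≤ : ∀ {p q r} → 0ℚ ℚ.< r → r * p ℚ.≤ r * q → p ℚ.≤ q
*-cancelˡ-≤ {r = r} 0<r = ℚ.*-cancelˡ-≤-pos r {{ℚ.positive 0<r}}

ι*1/′ : ∀ {w d s} → w ℕ.* d ≡ suc s → ι (suc s) * 1/′ d ≡ ι w
ι*1/′ {w} {zero}  {s} eq = contradiction (trans (sym eq) (ℕ.*-zeroʳ w)) λ ()
ι*1/′ {w} {suc d} {s} eq = trans (/-* (suc s) 0 1 d) (/≡ (suc s ℕ.* 1) (d + 0) w 0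
  (trans (ℕ.*-identityʳ (suc s ℕ.* 1)) (trans (ℕ.*-identityʳ (suc s)) (trans (sym eq) (cong (λ d → w ℕ.* suc d) (sym (ℕ.+-identityʳ d)))))))

-- `l` and `u` bound the expected number of vertices, whereas the series counts edges.
Bounds : ∀ {h} → Vertex h → ℚ → ℚ → Set
Bounds v l u = ∃[ q ] (HasSum (IsGSAW v) (λ W → pᵁ W * (+ ∣ W ∣ʷ / 1)) q × l ℚ.- 1ℚ ℚ.≤ q × q ℚ.≤ u ℚ.- 1ℚ)

module _ {h : ℕ} where

  open Entry {h}

  every-find : ∀ p (t : Tree {h}) → every p t ≡ true → ∀ m U {e} → find t m U ≡ just e → p U e ≡ true
  every-find p (node l n T e r) ok m U eq with ∧-true {p T e} ok
  ... | pe , ok′ with ∧-true {every p l} ok′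
  ...   | okₗ , okᵣ = go (m <ᵇ n) (n <ᵇ m) eq
    where
    here? : (T≟U : Dec (T ≡ U)) → ∀ {f} → cast? T≟U e ≡ just f → p U f ≡ true
    here? (yes refl) refl = pe
    go : ∀ b b′ {f} → (if b then find l m U else (if b′ then find r m U else cast? (T ≟ᵗ U) e)) ≡ just f → p U f ≡ true
    go true  b′    eq = every-find p l okₗ m U eq
    go false true  eq = every-find p r okᵣ m U eq
    go false false eq = here? (T ≟ᵗ U) eq

  find-keys : ∀ (t : Tree {h}) m U {e} → find t m U ≡ just e → U ∈ keys t
  find-keys (node l n T e r) m U = go (m <ᵇ n) (n <ᵇ m)
    where
    here? : (T≟U : Dec (T ≡ U)) → ∀ {f} → cast? T≟U e ≡ just f → U ∈ T ∷ keys l ++ keys r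
    here? (yes refl) eq = here refl
    go : ∀ b b′ {f} → (if b then find l m U else (if b′ then find r m U else cast? (T ≟ᵗ U) e)) ≡ just f →
      U ∈ T ∷ keys l ++ keys r
    go true  b′    eq = there (∈-++⁺ˡ (find-keys l m U eq))
    go false true  eq = there (∈-++⁺ʳ (keys l) (find-keys r m U eq))
    go false false eq = here? (T ≟ᵗ U) eq

  module Soundness (s dᵥ dₓ c p : ℕ) (t : Tree {h}) where

    open Checker {h} s dᵥ dₓ c p

    private
      S = suc s

    weightℕ valueℕ : Maybe (ℕ × ℕ) → ℕ
    weightℕ (just (v , _)) = v
    weightℕ nothing        = 0
    valueℕ (just (_ , x)) = x
    valueℕ nothing        = 0

    Known : Test h → Set
    Known T = ∃[ n ] numbers t T ≡ just n

    V X : Test h → ℕ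
    V T = weightℕ (numbers t T)
    X T = valueℕ (numbers t T)

    v lo hi : Test h → ℚ
    v  T = fraction dᵥ (V T)
    lo T = fraction dₓ (X T)
    hi T = fraction dₓ (X T + c ℕ.* V T)

    record Totals (ws : Weighted (Test h)) (n : ℕ × ℕ) : Set where
      field
        known  : ∀ {d U} → (d , U) ∈ ws → Known U
        -- Stated for all combinations a v + b x, so that (1, 0), (0, 1) and (c, 1) yield the totals
        -- of `v`, `lo` and `hi` by one induction.
        scaled : ∀ f (F : Test h → ℕ) a b → (∀ U → F U ≡ a ℕ.* V U + b ℕ.* X U) →
          ι S * ⟨ ws , (λ U → fraction f (F U)) ⟩ ≡ fraction f (a ℕ.* proj₁ n + b ℕ.* proj₂ n)
    open Totals

    totals-sound : ∀ ws {n} → totals t ws ≡ just n → Totals ws n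
    totals-sound [] refl .known ()
    totals-sound [] refl .scaled f F a b F≡ = trans (ℚ.*-zeroʳ (ι S))
      (sym (trans (cong (fraction f) (cong₂ _+_ (ℕ.*-zeroʳ a) (ℕ.*-zeroʳ b))) (fraction-0 f)))
    totals-sound ((d , U) ∷ ws) {n} eq = go (share d) (numbers t U) refl (totals t ws) refl eq
      where
      go : ∀ w nU → numbers t U ≡ nU → ∀ nws → totals t ws ≡ nws → add d w nU nws ≡ just n → Totals ((d , U) ∷ ws) n
      go w (just (v , x)) U≡ (just (v′ , x′)) ws≡ eq with w ℕ.* d ≡ᵇ S in exact
      go w (just (v , x)) U≡ (just (v′ , x′)) ws≡ refl | true = record { known = known′ ; scaled = scaled′ }
        where
        rest = totals-sound ws ws≡
        known′ : ∀ {d′ U′} → (d′ , U′) ∈ (d , U) ∷ ws → Known U′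
        known′ (here refl) = _ , U≡
        known′ (there U∈)  = known rest U∈

        arith : ∀ a b w → w ℕ.* (a ℕ.* v + b ℕ.* x) + (a ℕ.* v′ + b ℕ.* x′) ≡ a ℕ.* (w ℕ.* v + v′) + b ℕ.* (w ℕ.* x + x′)
        arith a b w = solve 7 (λ a b w v x v′ x′ →
          w :* (a :* v :+ b :* x) :+ (a :* v′ :+ b :* x′) := a :* (w :* v :+ v′) :+ b :* (w :* x :+ x′)) refl a b w v x v′ x′
          where open ℕ-Solver

        scaled′ : ∀ f (F : Test h → ℕ) a b → (∀ U → F U ≡ a ℕ.* V U + b ℕ.* X U) →
          ι S * ⟨ (d , U) ∷ ws , (λ U → fraction f (F U)) ⟩ ≡ fraction f (a ℕ.* (w ℕ.* v + v′) + b ℕ.* (w ℕ.* x + x′))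
        scaled′ f F a b F≡ = begin
          ι S * (1/′ d * fraction f (F U) ℚ.+ R)
            ≡⟨ ℚ.*-distribˡ-+ (ι S) (1/′ d * fraction f (F U)) R ⟩
          ι S * (1/′ d * fraction f (F U)) ℚ.+ ι S * R
            ≡⟨ cong₂ ℚ._+_ (sym (ℚ.*-assoc (ι S) (1/′ d) (fraction f (F U)))) (scaled rest f F a b F≡) ⟩
          (ι S * 1/′ d) * fraction f (F U) ℚ.+ fraction f (a ℕ.* v′ + b ℕ.* x′)
            ≡⟨ cong₂ (λ y m → y * fraction f m ℚ.+ fraction f (a ℕ.* v′ + b ℕ.* x′)) (ι*1/′ {w} {d} (≡ᵇ-true (w ℕ.* d) S exact))
                 (trans (F≡ U) (cong₂ (λ V X → a ℕ.* V + b ℕ.* X) (cong weightℕ U≡) (cong valueℕ U≡))) ⟩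
          ι w * fraction f (a ℕ.* v + b ℕ.* x) ℚ.+ fraction f (a ℕ.* v′ + b ℕ.* x′)
            ≡⟨ cong (ℚ._+ fraction f (a ℕ.* v′ + b ℕ.* x′)) (ι*fraction w f (a ℕ.* v + b ℕ.* x)) ⟩
          fraction f (w ℕ.* (a ℕ.* v + b ℕ.* x)) ℚ.+ fraction f (a ℕ.* v′ + b ℕ.* x′)
            ≡⟨ /-+ (w ℕ.* (a ℕ.* v + b ℕ.* x)) (a ℕ.* v′ + b ℕ.* x′) f ⟩
          fraction f (w ℕ.* (a ℕ.* v + b ℕ.* x) + (a ℕ.* v′ + b ℕ.* x′))
            ≡⟨ cong (fraction f) (arith a b w) ⟩
          fraction f (a ℕ.* (w ℕ.* v + v′) + b ℕ.* (w ℕ.* x + x′)) ∎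
          where
          open ≡-Reasoning
          R = ⟨ ws , (λ U → fraction f (F U)) ⟩

    θ : ℚ
    θ = fraction p p

    θ<1 : θ ℚ.< 1ℚ
    θ<1 = subst₂ ℚ._<_ (ℚ.+-identityʳ θ) (trans (/-+ p 1 p) (trans (cong (fraction p) (ℕ.+-comm p 1)) (fraction-1 p)))
      (ℚ.+-monoʳ-< θ (ℚ.positive⁻¹ (fraction p 1) {{ℚ.normalize-pos 1 (suc p)}}))

    module Accepted (ok : every (check t) t ≡ true) where

      record Row (T : Test h) : Set where
        field
          known′  : ∀ {d U} → (d , U) ∈ step T → Known U
          weight≤ : ⟨ step T , v ⟩ ℚ.≤ θ * v T
          lo≤     : lo T ℚ.≤ ⟨ step T , lo ⟩
          ≤hi     : ⟨ step T , hi ⟩ ℚ.≤ hi T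
          dead    : V T ≡ 0 → X T ≡ 0
      open Row

      lo≡ : ∀ T → X T ≡ 0 ℕ.* V T + 1 ℕ.* X T
      lo≡ T = sym (ℕ.*-identityˡ (X T))

      row : ∀ {λₗ a g n} → numbers t (enter λₗ a g) ≡ just n → Row (enter λₗ a g)
      row {λₗ} {a} {g} eq = fromFind _ refl eq
        where
        U = enter λₗ a g
        fromFind : ∀ me → find t (code 1 U) U ≡ me → ∀ {n} → numbers t U ≡ just n → Row U
        fromFind nothing  find≡ eq with find t (code 1 U) U
        fromFind nothing  refl () | .nothing
        fromFind (just (entry vU xU ws ws≡)) find≡ _ with totals t ws in totals≡ | every-find (check t) t ok (code 1 U) U find≡
        ... | just (V′ , X′) | accepted = record
          { known′ = λ {d} {T} U∈ → known tot (subst ((d , T) ∈_) (sym ws≡) U∈)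
          ; weight≤ = subst (λ ws → ⟨ ws , v ⟩ ℚ.≤ θ * v U) ws≡ w≤
          ; lo≤ = subst (λ ws → lo U ℚ.≤ ⟨ ws , lo ⟩) ws≡ l≤
          ; ≤hi = subst (λ ws → ⟨ ws , hi ⟩ ℚ.≤ hi U) ws≡ ≤h
          ; dead = λ V≡0 → ℕ.n≤0⇒n≡0 (subst (λ V → X U ≤ V ℕ.* suc dₓ) V≡0
              (subst₂ (λ x v → x ≤ v ℕ.* suc dₓ) (sym XU) (sym VU) (≤ᵇ-true xU (vU ℕ.* suc dₓ) (proj₂ ok₃))))
          }
          where
          tot = totals-sound ws totals≡
          ok₁ = ∧-true {suc p ℕ.* V′ ≤ᵇ p ℕ.* (S ℕ.* vU)} accepted
          ok₂ = ∧-true {S ℕ.* xU ≤ᵇ X′} (proj₂ ok₁)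
          ok₃ = ∧-true {X′ + c ℕ.* V′ ≤ᵇ S ℕ.* (xU + c ℕ.* vU)} (proj₂ ok₂)

          numbers≡ : numbers t U ≡ just (vU , xU)
          numbers≡ rewrite find≡ = refl
          VU : V U ≡ vU
          VU = cong weightℕ numbers≡
          XU : X U ≡ xU
          XU = cong valueℕ numbers≡

          v-total : ι S * ⟨ ws , v ⟩ ≡ fraction dᵥ V′
          v-total = trans (scaled tot dᵥ V 1 0 λ T → sym (trans (ℕ.+-identityʳ (1 ℕ.* V T)) (ℕ.*-identityˡ (V T))))
            (cong (fraction dᵥ) (trans (ℕ.+-identityʳ (1 ℕ.* V′)) (ℕ.*-identityˡ V′)))
          lo-total : ι S * ⟨ ws , lo ⟩ ≡ fraction dₓ X′
          lo-total = trans (scaled tot dₓ X 0 1 lo≡) (cong (fraction dₓ) (ℕ.*-identityˡ X′))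
          hi-total : ι S * ⟨ ws , hi ⟩ ≡ fraction dₓ (X′ + c ℕ.* V′)
          hi-total = trans (scaled tot dₓ (λ T → X T + c ℕ.* V T) c 1 λ T → flip+ (V T) (X T))
            (cong (fraction dₓ) (sym (flip+ V′ X′)))
            where
            flip+ : ∀ v x → x + c ℕ.* v ≡ c ℕ.* v + 1 ℕ.* x
            flip+ v x = trans (ℕ.+-comm x (c ℕ.* v)) (cong (λ y → c ℕ.* v + y) (sym (ℕ.*-identityˡ x)))

          w≤ : ⟨ ws , v ⟩ ℚ.≤ θ * v U
          w≤ = *-cancelˡ-≤ (0<ι p) (*-cancelˡ-≤ (0<ι s) (begin
            ι S * (ι (suc p) * ⟨ ws , v ⟩)        ≡⟨ swap (ι S) (ι (suc p)) ⟨ ws , v ⟩ ⟩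
            ι (suc p) * (ι S * ⟨ ws , v ⟩)        ≡⟨ cong (ι (suc p) *_) v-total ⟩
            ι (suc p) * fraction dᵥ V′              ≡⟨ ι*fraction (suc p) dᵥ V′ ⟩
            fraction dᵥ (suc p ℕ.* V′)                  ≤⟨ fraction-mono dᵥ (≤ᵇ-true (suc p ℕ.* V′) (p ℕ.* (S ℕ.* vU)) (proj₁ ok₁)) ⟩
            fraction dᵥ (p ℕ.* (S ℕ.* vU))                ≡⟨ ι*fraction p dᵥ (S ℕ.* vU) ⟨
            ι p * fraction dᵥ (S ℕ.* vU)              ≡⟨ cong (ι p *_) (trans (cong (λ n → ι S * fraction dᵥ n) VU) (ι*fraction S dᵥ vU)) ⟨
            ι p * (ι S * v U)                     ≡⟨ cong (λ y → y * (ι S * v U)) ι-θ ⟨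
            (ι (suc p) * θ) * (ι S * v U)       ≡⟨ regroup (ι S) (ι (suc p)) θ (v U) ⟩
            ι S * (ι (suc p) * (θ * v U))       ∎))
            where
            open ℚ.≤-Reasoning
            swap : ∀ a b c → a * (b * c) ≡ b * (a * c)
            swap = solve 3 (λ a b c → a :* (b :* c) := b :* (a :* c)) refl
              where open +-*-Solver
            regroup : ∀ a b c d → (b * c) * (a * d) ≡ a * (b * (c * d))
            regroup = solve 4 (λ a b c d → (b :* c) :* (a :* d) := a :* (b :* (c :* d))) refl
              where open +-*-Solver
            ι-θ : ι (suc p) * θ ≡ ι p
            ι-θ = trans (ι*fraction (suc p) p p) (/≡ (suc p ℕ.* p) p p 0 (trans (ℕ.*-identityʳ (suc p ℕ.* p)) (ℕ.*-comm (suc p) p)))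

          l≤ : lo U ℚ.≤ ⟨ ws , lo ⟩
          l≤ = *-cancelˡ-≤ (0<ι s) (subst₂ ℚ._≤_
            (sym (trans (cong (λ n → ι S * fraction dₓ n) XU) (ι*fraction S dₓ xU))) (sym lo-total)
            (fraction-mono dₓ (≤ᵇ-true (S ℕ.* xU) X′ (proj₁ ok₂))))

          ≤h : ⟨ ws , hi ⟩ ℚ.≤ hi U
          ≤h = *-cancelˡ-≤ (0<ι s) (subst₂ ℚ._≤_ (sym hi-total)
            (sym (trans (cong₂ (λ x v → ι S * fraction dₓ (x + c ℕ.* v)) XU VU) (ι*fraction S dₓ (xU + c ℕ.* vU))))
            (fraction-mono dₓ (≤ᵇ-true (X′ + c ℕ.* V′) (S ℕ.* (xU + c ℕ.* vU)) (proj₁ ok₃))))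

      -- `stop` is left out because its own row reproduces its value and does not contract; its
      -- value 1 is the boundary datum that makes the system inhomogeneous. Weight 0 is left out
      -- because the maximum principle divides by v.
      alive : Test h → Bool
      alive stop            = false
      alive T@(enter _ _ _) = 0 <ᵇ V T

      ks : List (Test h)
      ks = filterᵇ alive (keys t)

      alive-known : ∀ T → alive T ≡ true → Known T
      alive-known T@(enter _ _ _) eq with numbers t T
      ... | just n = n , refl

      0≤v : ∀ T → 0ℚ ℚ.≤ v T
      0≤v T = 0≤/ (V T) dᵥ

      row-∈ : ∀ {T} → T ∈ ks → Row T × 0 < V T
      row-∈ {T} T∈ with ∈-filterᵇ⁻ alive (keys t) T∈
      row-∈ {T@(enter _ _ _)} T∈ | _ , 0<V = row (proj₂ (alive-known T 0<V)) , ℕ.<ᵇ⇒< 0 (V T) (subst Bool.T (sym 0<V) tt)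

      contracting : All (Contracting _≟ᵗ_ step v 0≤v θ θ<1) ks
      contracting = All.tabulate λ {T} T∈ → positive T (proj₂ (row-∈ T∈)) , weight≤ (proj₁ (row-∈ T∈))
        where
        positive : ∀ T → 0 < V T → 0ℚ ℚ.< v T
        positive T 0<V with V T
        ... | suc n = ℚ.positive⁻¹ (fraction dᵥ (suc n)) {{ℚ.normalize-pos (suc n) (suc dᵥ)}}

      boundary : Test h → ℚ
      boundary stop          = 1ℚ
      boundary (enter _ _ _) = 0ℚ

      -- Transcripts outside the tree have no numbers and hence weight and estimate 0, so they fall
      -- under `null` as well.
      data Status : Test h → Set where
        final : Status stop
        live  : ∀ {T} → T ∈ ks → Status T
        null  : ∀ {λₗ a g} → V (enter λₗ a g) ≡ 0 → X (enter λₗ a g) ≡ 0 → Status (enter λₗ a g)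

      status : ∀ T → Status T
      status stop = final
      status T@(enter λₗ a g) = go (numbers t T) refl (0 <ᵇ V T) refl
        where
        zero? : ∀ n → (0 <ᵇ n) ≡ false → n ≡ 0
        zero? zero eq = refl
        key : ∀ me → find t (code 1 T) T ≡ me → ∀ {n} → numbers t T ≡ just n → T ∈ keys t
        key (just e) find≡ _ = find-keys t (code 1 T) T find≡
        key nothing  find≡ eq with find t (code 1 T) T
        key nothing  refl () | .nothing
        go : ∀ n → numbers t T ≡ n → ∀ b → (0 <ᵇ V T) ≡ b → Status T
        go nothing  eq b     b≡ = null (cong weightℕ eq) (cong valueℕ eq)
        go (just n) eq true  b≡ = live (∈-filterᵇ⁺ alive (key _ refl eq) b≡)
        go (just n) eq false b≡ = null (zero? (V T) b≡) (dead (row eq) (zero? (V T) b≡))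

      module Solved (x : Test h → ℚ) (x-live : ∀ {T} → T ∈ ks → x T ≡ ⟨ step T , x ⟩)
        (x-off : ∀ T → T ∈ ks ⊎ x T ≡ boundary T) where

        x-stop : x stop ≡ 1ℚ
        x-stop = go (x-off stop)
          where
          go : stop ∈ ks ⊎ x stop ≡ 1ℚ → x stop ≡ 1ℚ
          go (inj₂ eq) = eq
          go (inj₁ T∈) = case proj₂ (∈-filterᵇ⁻ alive (keys t) T∈) of λ ()

        compare : ∀ {y z} → (∀ {T} → T ∈ ks → y T ℚ.≤ ⟨ step T , y ⟩) → (∀ {T} → T ∈ ks → ⟨ step T , z ⟩ ℚ.≤ z T) →
          (∀ T → T ∈ ks ⊎ y T ℚ.≤ z T) → ∀ T → y T ℚ.≤ z T
        compare {y} {z} = maximum-principle _≟ᵗ_ step v 0≤v θ θ<1 contracting {y} {z}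

        0≤x : ∀ T → 0ℚ ℚ.≤ x T
        0≤x = compare (λ {T} _ → ⟨⟩-nonNeg (step T) λ _ → ℚ.≤-refl) (λ T∈ → ℚ.≤-reflexive (sym (x-live T∈))) λ T →
          case x-off T of λ { (inj₁ T∈) → inj₁ T∈ ; (inj₂ eq) → inj₂ (subst (0ℚ ℚ.≤_) (sym eq) (0≤boundary T)) }
          where
          0≤boundary : ∀ T → 0ℚ ℚ.≤ boundary T
          0≤boundary stop          = 0≤ι 1
          0≤boundary (enter _ _ _) = ℚ.≤-refl

        x-upper : ∀ z → (∀ {T} → T ∈ ks → ⟨ step T , z ⟩ ℚ.≤ z T) → 1ℚ ℚ.≤ z stop → (∀ T → 0ℚ ℚ.≤ z T) → ∀ T → x T ℚ.≤ z T
        x-upper z z-row 1≤z 0≤z = compare (λ T∈ → ℚ.≤-reflexive (x-live T∈)) z-row λ T →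
          case x-off T of λ { (inj₁ T∈) → inj₁ T∈ ; (inj₂ eq) → inj₂ (subst (ℚ._≤ z T) (sym eq) (boundary≤ T)) }
          where
          boundary≤ : ∀ T → boundary T ℚ.≤ z T
          boundary≤ stop            = 1≤z
          boundary≤ T@(enter _ _ _) = 0≤z T

        θ*≤ : ∀ {y} → 0ℚ ℚ.≤ y → θ * y ℚ.≤ y
        θ*≤ {y} 0≤y = subst (θ * y ℚ.≤_) (ℚ.*-identityˡ y) (ℚ.*-monoʳ-≤-nonNeg y {{ℚ.nonNegative 0≤y}} (ℚ.<⇒≤ θ<1))

        x≤v : ∀ T → x T ℚ.≤ v T
        x≤v = x-upper v (λ {T} T∈ → ℚ.≤-trans (weight≤ (proj₁ (row-∈ T∈))) (θ*≤ (0≤v T)))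
          (ℚ.≤-reflexive (sym (fraction-1 dᵥ))) 0≤v

        x≤hi : ∀ T → x T ℚ.≤ hi T
        x≤hi = x-upper hi (λ T∈ → ≤hi (proj₁ (row-∈ T∈)))
          (subst (ℚ._≤ hi stop) (fraction-1 dₓ) (fraction-mono dₓ (ℕ.m≤m+n (suc dₓ) (c ℕ.* suc dᵥ))))
          λ T → 0≤/ (X T + c ℕ.* V T) dₓ

        lo≤x : ∀ T → lo T ℚ.≤ x T
        lo≤x = compare (λ T∈ → lo≤ (proj₁ (row-∈ T∈))) (λ T∈ → ℚ.≤-reflexive (sym (x-live T∈))) off
          where
          off : ∀ T → T ∈ ks ⊎ lo T ℚ.≤ x T
          off T with status T
          ... | final       = inj₂ (ℚ.≤-reflexive (trans (fraction-1 dₓ) (sym x-stop)))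
          ... | live T∈     = inj₁ T∈
          ... | null _ X≡0  = inj₂ (subst (ℚ._≤ x T) (sym (trans (cong (fraction dₓ) X≡0) (fraction-0 dₓ))) (0≤x T))

        x-step : ∀ {T} → Known T → x T ≡ ⟨ step T , x ⟩
        x-step {T} (_ , eq) with status T
        ... | final = trans x-stop (sym (trans (1*-identity (x stop)) x-stop))
        ... | live T∈ = x-live T∈
        -- Both sides are 0: x lies between 0 and v, and the row lies between 0 and ⟨ step T , v ⟩ ≤
        -- θ v T.
        ... | null V≡0 _ = trans (ℚ.≤-antisym (subst (x T ℚ.≤_) v≡0 (x≤v T)) (0≤x T)) (sym (ℚ.≤-antisym
          (ℚ.≤-trans (⟨⟩-mono (step T) λ {_} {U} _ → x≤v U)
            (ℚ.≤-trans (weight≤ (row eq)) (ℚ.≤-reflexive (trans (cong (θ *_) v≡0) (ℚ.*-zeroʳ θ)))))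
          (⟨⟩-nonNeg (step T) 0≤x)))
          where
          v≡0 : v T ≡ 0ℚ
          v≡0 = trans (cong (fraction dᵥ) V≡0) (fraction-0 dᵥ)

        closed : ∀ {T} → Known T → ∀ {d U} → (d , U) ∈ step T → Known U
        closed {stop}        _        (here refl) = _ , refl
        closed {enter _ _ _} (_ , eq) U∈          = known′ (row eq) U∈

        solved-length : ∀ a → Known (enter full a end) →
          HasSum (IsGSAW (0 , a)) (λ W → pᵁ W * (+ ∣ W ∣ʷ / 1)) (x (enter full a end) ℚ.- 1ℚ)
        solved-length = expected-length Known (λ {T} → closed {T}) x v (0≤/ p p) θ<1 0≤v 0≤x x≤v x-stop x-step
          (λ (_ , eq) → weight≤ (row eq))

        bounded : ∀ a {n} → numbers t (enter full a end) ≡ just n →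
          Bounds (0 , a) (fraction dₓ (valueℕ (just n))) (fraction dₓ (valueℕ (just n) + c ℕ.* weightℕ (just n)))
        bounded a eq = x R ℚ.- 1ℚ , solved-length a (_ , eq) ,
          ℚ.+-monoˡ-≤ (ℚ.- 1ℚ) (subst (λ m → fraction dₓ (valueℕ m) ℚ.≤ x R) eq (lo≤x R)) ,
          ℚ.+-monoˡ-≤ (ℚ.- 1ℚ) (subst (λ m → x R ℚ.≤ fraction dₓ (valueℕ m + c ℕ.* weightℕ m)) eq (x≤hi R))
          where R = enter full a end

      solved : ∃ (Solves _≟ᵗ_ step v 0≤v θ θ<1 ks boundary) → ∀ a {n} → numbers t (enter full a end) ≡ just n →
        Bounds (0 , a) (fraction dₓ (valueℕ (just n))) (fraction dₓ (valueℕ (just n) + c ℕ.* weightℕ (just n)))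
      solved (x , x-live , x-off) = Solved.bounded x x-live x-off

module _ {h : ℕ} (s dᵥ dₓ c p : ℕ) (a : Fin h) (w y : ℕ) where

  private
    R = enter full a end

  -- The tree stays a variable here, so that type checking never evaluates it.
  certified-tree : (t : Tree {h}) → Checker.consistent s dᵥ dₓ c p R w y t ≡ true →
    Bounds (0 , a) (fraction dₓ y) (fraction dₓ (y + c ℕ.* w))
  certified-tree t ok = solved
    (solvable _≟ᵗ_ step v 0≤v θ θ<1 ks contracting boundary) a (agrees (numbers t R) (proj₁ both))
    where
    open Checker {h} s dᵥ dₓ c p
    open Soundness s dᵥ dₓ c p t
    both = ∧-true {rootIs w y (numbers t R)} ok
    open Accepted (proj₂ both)

    agrees : ∀ m → rootIs w y m ≡ true → m ≡ just (w , y)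
    agrees (just (w′ , y′)) eq = let w≡ , y≡ = ∧-true {w ≡ᵇ w′} eq in
      cong₂ (λ w y → just (w , y)) (sym (≡ᵇ-true w w′ w≡)) (sym (≡ᵇ-true y y′ y≡))

  -- A record, so that comparing its types does not evaluate the certificate.
  record Certificate (ns : List (ℕ × ℕ)) : Set where
    field
      accepted : Checker.certificate s dᵥ dₓ c p R w y ns ≡ true

  certified : ∀ ns → Certificate ns → Bounds (0 , a) (fraction dₓ y) (fraction dₓ (y + c ℕ.* w))
  certified ns cert = certified-tree (explore-all ns (R ∷ []) leaf) (Certificate.accepted cert)

-- The three certificates

-- A column visits at most five vertices, each with at most three options, so 6 ^ 5
-- clears the coefficients. The tables list the reachable transcripts in the order
-- of their discovery. The values are exact solutions of the linear system for h = 3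
-- and h = 4, so that c = 0, and come from fixed-point iteration for h = 5.
table₃ : List (ℕ × ℕ)
table₃ =
    (3344 , 9211177584) ∷ (3344 , 9211177584) ∷ (2263 , 6393687669) ∷ (2673 , 7471714050) ∷
    (49 , 186354729) ∷ (47 , 173824650) ∷ (27 , 109950072) ∷ (8 , 26042772) ∷ (9 , 29763168) ∷
    (24 , 89289504) ∷ (32 , 128413179) ∷ (9 , 28970775) ∷ (2194 , 6188452392) ∷ (833 , 2193528448) ∷
    (12 , 39684224) ∷ (2673 , 7471714050) ∷ (2263 , 6393687669) ∷ (47 , 173824650) ∷
    (49 , 186354729) ∷ (32 , 128413179) ∷ (9 , 28970775) ∷ (9 , 29763168) ∷ (24 , 89289504) ∷
    (27 , 109950072) ∷ (8 , 26042772) ∷ (1785 , 5119431219) ∷ (2194 , 6188452392) ∷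
    (12 , 39684224) ∷ (833 , 2193528448) ∷ []

-- Here 7776 = 6 ^ 5, weights are counted in hundredths, and 19 encodes the factor 19/20. The
-- denominator 455711166 is 18 times that of L₃ and makes all values of the solution integral.
certificate₃ : Certificate 7775 99 455711165 0 19 (fromℕ 2) 3344 9211177584 table₃
certificate₃ = record { accepted = refl }

table₄ : List (ℕ × ℕ)
table₄ =
    (4136 , 23701413595408165639576548472628829412958037153328732016942600256) ∷
    (4136 , 23701413595408165639576548472628829412958037153328732016942600256) ∷
    (3002 , 17515476163313651757359530207674705458921293466378430386862053160) ∷
    (3550 , 20559426117755778441654756752631158440730499251772913742618338224) ∷
    (46 , 375974054305904099791025672674381028578181641884025124582222424) ∷
    (41 , 301533272991081649676202553111813334245318655507063395428356400) ∷
    (22 , 180842110666520875891642650724643279477722143305494852331759680) ∷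
    (23 , 186372674249460864638977039242288955241208729714218444244710016) ∷
    (8 , 54902786375633945571599271135268083389300724179551645712854240) ∷
    (10 , 63138306279441181695541352949493512745588863249849855992338560) ∷
    (10 , 64015029249827330690735982621276473490470418511038548312638464) ∷
    (20 , 150538746187933509784100219914538147518686534146697021298457472) ∷
    (27 , 232757056882557429959044268326977996060385787103425365635693024) ∷
    (4 , 22362352103398155632911652561343334479134592050176295761551232) ∷
    (4 , 25926068645076214999860425704856419418986112463446891622125184) ∷
    (12 , 98865011824164274795527936695484345902759098258490774709284736) ∷ (0 , 0) ∷
    (3 , 16851682531775356860920837794634272969951734356106376086510400) ∷ (0 , 0) ∷
    (7 , 38247164632092519326996344318418006153025464748494809677930240) ∷
    (3 , 16594094431565774912363339087383671061708932334236697542938880) ∷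
    (17 , 135114103928961968257624086427327579250036769499801822202628096) ∷
    (6 , 37728732174294951603898861734546326858641129840215395749630656) ∷
    (3 , 15526811939306174183578062171494688975507344903285419427841024) ∷
    (3 , 16838529855060497403524852017300599859232132495800258704762240) ∷
    (11 , 82620587525405608885047631696375658421860117007962312063010816) ∷
    (14 , 107517454735963767555229914487071393504864890431730741857629840) ∷ (0 , 0) ∷
    (2 , 13926801546156302800249339811497151332939331562943424696578944) ∷
    (37 , 312317030007786862637160689239664880237503259054756185547347184) ∷
    (27 , 208412127809834825970938743050821629344699797120588078108819658) ∷
    (5 , 31828512149058618576932491717358074170339191414634469517437620) ∷ (0 , 0) ∷
    (6 , 40204436398810886623493673748241777899375820734275119390447520) ∷
    (17 , 143491876262561573184496667228504065794413833379755878999369568) ∷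
    (3 , 18675117201979651353572991748069606841654154962869486666195056) ∷
    (4 , 24551469821024928799620788403720599407387229884281320830416448) ∷
    (5 , 28402187171931548777462387143937863446424518944947402097505792) ∷
    (3 , 17806421038947890956636797738669305022022949783045573107566336) ∷
    (14 , 113294925712457737603726189534712445170162520383581052557297152) ∷
    (3 , 15175658277304508385989241365773741990956747147635162441218896) ∷
    (2 , 10909589108252115326948948446307567039937124558110384822665472) ∷
    (6 , 39625599255452121610534694631284439101897198899266342752897280) ∷
    (31 , 270977408830239038040248449625980535496403759718113782070394361) ∷ (0 , 0) ∷
    (4 , 27559747451698549731274826409122896494066332891094935651301882) ∷
    (3 , 20102218199405443311746836874120888949687910367137559695223760) ∷
    (5 , 30926523391104203789933548115834097136778463375384877990823808) ∷
    (2743 , 16120167776642872758202824323865331330215827055252819032717689112) ∷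
    (3130 , 18239605946543480026119125392146617485776281240210344475134889658) ∷
    (680 , 3734320179517932773567288235788742975939810100822390469887255680) ∷
    (736 , 3990231986068146163268390969564038380135764407622828557116732480) ∷
    (870 , 4878028509224712645422889076405576245512707794627329903379114336) ∷
    (3706 , 21390672267569306712373595739658548467875140721726929381719943015) ∷
    (2503 , 14803960013454938573398229529568051633193876229634258993533395472) ∷
    (24 , 145781775140042525251841882510668303082787370355859502325443584) ∷
    (16 , 99983409667677681600393498058087096082670930155211385446650880) ∷
    (7 , 40073605066441478811812922162303768858160468863143655510610944) ∷ (0 , 0) ∷
    (5 , 29954902300618101394290287947891663612255230646033864968019968) ∷
    (19 , 108695015475295957304367999489040187099198724316220965817229312) ∷
    (19 , 108392707284234152683247686622331909479890105585103032830203904) ∷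
    (17 , 98673840130133668130726199825040003774100257119771037861464192) ∷
    (4 , 24926045237205581712396130592224262401931509847170979663493120) ∷
    (4 , 23403429495155897767987894633815152096719425564545476841303040) ∷
    (6 , 36875657673737387546476645273283871862034392499680308038822400) ∷
    (6 , 36875657673737387546476645273283871862034392499680308038822400) ∷
    (5 , 28821876498229647733220672137280842796255287717720190461360896) ∷
    (17 , 98804715615380625047615502751116409956464153986255653807404928) ∷
    (5 , 30926523391104203789933548115834097136778463375384877990823808) ∷
    (3550 , 20559426117755778441654756752631158440730499251772913742618338224) ∷
    (3002 , 17515476163313651757359530207674705458921293466378430386862053160) ∷
    (41 , 301533272991081649676202553111813334245318655507063395428356400) ∷
    (46 , 375974054305904099791025672674381028578181641884025124582222424) ∷
    (27 , 208412127809834825970938743050821629344699797120588078108819658) ∷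
    (37 , 312317030007786862637160689239664880237503259054756185547347184) ∷
    (6 , 39625599255452121610534694631284439101897198899266342752897280) ∷
    (10 , 63138306279441181695541352949493512745588863249849855992338560) ∷
    (10 , 64015029249827330690735982621276473490470418511038548312638464) ∷
    (20 , 150538746187933509784100219914538147518686534146697021298457472) ∷
    (22 , 180842110666520875891642650724643279477722143305494852331759680) ∷
    (23 , 186372674249460864638977039242288955241208729714218444244710016) ∷
    (8 , 54902786375633945571599271135268083389300724179551645712854240) ∷
    (5 , 28402187171931548777462387143937863446424518944947402097505792) ∷
    (14 , 113294925712457737603726189534712445170162520383581052557297152) ∷
    (5 , 31828512149058618576932491717358074170339191414634469517437620) ∷
    (6 , 40204436398810886623493673748241777899375820734275119390447520) ∷
    (17 , 143491876262561573184496667228504065794413833379755878999369568) ∷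
    (4 , 24551469821024928799620788403720599407387229884281320830416448) ∷
    (3 , 17806421038947890956636797738669305022022949783045573107566336) ∷
    (2 , 10909589108252115326948948446307567039937124558110384822665472) ∷
    (6 , 37728732174294951603898861734546326858641129840215395749630656) ∷
    (17 , 135114103928961968257624086427327579250036769499801822202628096) ∷
    (3 , 18675117201979651353572991748069606841654154962869486666195056) ∷
    (3 , 15175658277304508385989241365773741990956747147635162441218896) ∷
    (7 , 38247164632092519326996344318418006153025464748494809677930240) ∷
    (3 , 15526811939306174183578062171494688975507344903285419427841024) ∷
    (4 , 25926068645076214999860425704856419418986112463446891622125184) ∷
    (3 , 16838529855060497403524852017300599859232132495800258704762240) ∷
    (3 , 16594094431565774912363339087383671061708932334236697542938880) ∷
    (11 , 82620587525405608885047631696375658421860117007962312063010816) ∷ (0 , 0) ∷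
    (27 , 232757056882557429959044268326977996060385787103425365635693024) ∷ (0 , 0) ∷
    (4 , 22362352103398155632911652561343334479134592050176295761551232) ∷
    (12 , 98865011824164274795527936695484345902759098258490774709284736) ∷
    (3 , 16851682531775356860920837794634272969951734356106376086510400) ∷
    (5 , 30926523391104203789933548115834097136778463375384877990823808) ∷ (0 , 0) ∷
    (2 , 13926801546156302800249339811497151332939331562943424696578944) ∷
    (14 , 107517454735963767555229914487071393504864890431730741857629840) ∷
    (31 , 270977408830239038040248449625980535496403759718113782070394361) ∷
    (4 , 27559747451698549731274826409122896494066332891094935651301882) ∷ (0 , 0) ∷
    (3 , 20102218199405443311746836874120888949687910367137559695223760) ∷
    (2503 , 14803960013454938573398229529568051633193876229634258993533395472) ∷
    (3130 , 18239605946543480026119125392146617485776281240210344475134889658) ∷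
    (2743 , 16120167776642872758202824323865331330215827055252819032717689112) ∷
    (24 , 145781775140042525251841882510668303082787370355859502325443584) ∷
    (16 , 99983409667677681600393498058087096082670930155211385446650880) ∷
    (7 , 40073605066441478811812922162303768858160468863143655510610944) ∷
    (5 , 29954902300618101394290287947891663612255230646033864968019968) ∷
    (19 , 108695015475295957304367999489040187099198724316220965817229312) ∷
    (19 , 108392707284234152683247686622331909479890105585103032830203904) ∷
    (17 , 98673840130133668130726199825040003774100257119771037861464192) ∷
    (4 , 23403429495155897767987894633815152096719425564545476841303040) ∷
    (6 , 36875657673737387546476645273283871862034392499680308038822400) ∷
    (6 , 36875657673737387546476645273283871862034392499680308038822400) ∷
    (5 , 28821876498229647733220672137280842796255287717720190461360896) ∷
    (4 , 24926045237205581712396130592224262401931509847170979663493120) ∷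
    (17 , 98804715615380625047615502751116409956464153986255653807404928) ∷
    (5 , 30926523391104203789933548115834097136778463375384877990823808) ∷
    (736 , 3990231986068146163268390969564038380135764407622828557116732480) ∷
    (680 , 3734320179517932773567288235788742975939810100822390469887255680) ∷
    (546 , 3031931280769282443648743757365264032233874389626180070368743488) ∷
    (68 , 351194449374325164959272239211739471852967855598105199759256096) ∷
    (90 , 468417954715639474635856244923844950419585637416102936473205504) ∷
    (401 , 2186533361707740083180118670390086235584011512299833332633276416) ∷
    (870 , 4878028509224712645422889076405576245512707794627329903379114336) ∷
    (3706 , 21390672267569306712373595739658548467875140721726929381719943015) ∷
    (2145 , 12798454930779168931563997687877565568527975876897571105063832657) ∷
    (546 , 3031931280769282443648743757365264032233874389626180070368743488) ∷
    (68 , 351194449374325164959272239211739471852967855598105199759256096) ∷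
    (3254 , 18787536074819437234926311204167009543397010884725311375553196826) ∷
    (2589 , 15178270224366942640735688247427829314564988017543074507818960976) ∷
    (645 , 3661822073152990477039644432206940760766480809032688694601020928) ∷
    (82 , 425819408614324792382586118036678119611435313884823762573197760) ∷
    (90 , 468417954715639474635856244923844950419585637416102936473205504) ∷
    (90 , 468417954715639474635856244923844950419585637416102936473205504) ∷
    (401 , 2186533361707740083180118670390086235584011512299833332633276416) ∷ (0 , 0) ∷
    (41 , 328153631819863070988278843400661192052644601929459565259667488) ∷
    (894 , 5007485180864999184742087783929741933269039341821196951256473638) ∷
    (645 , 3661822073152990477039644432206940760766480809032688694601020928) ∷ (0 , 0) ∷
    (82 , 425819408614324792382586118036678119611435313884823762573197760) ∷
    (90 , 468417954715639474635856244923844950419585637416102936473205504) ∷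
    (649 , 3673782674271929083360942100757527855188595305691549703020587108) ∷
    (13 , 102963128784912241002587359318145694788147077102724498112624608) ∷
    (2145 , 12798454930779168931563997687877565568527975876897571105063832657) ∷
    (2589 , 15178270224366942640735688247427829314564988017543074507818960976) ∷
    (3254 , 18787536074819437234926311204167009543397010884725311375553196826) ∷
    (41 , 328153631819863070988278843400661192052644601929459565259667488) ∷
    (894 , 5007485180864999184742087783929741933269039341821196951256473638) ∷
    (649 , 3673782674271929083360942100757527855188595305691549703020587108) ∷
    (13 , 102963128784912241002587359318145694788147077102724498112624608) ∷ []

-- The denominator of the values is 624 times that of L₄.
certificate₄ : Certificate 7775 99
  988585704018748166074950471937434571098106552355990137588526159 0 19 (fromℕ 3)
  4136 23701413595408165639576548472628829412958037153328732016942600256 table₄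
certificate₄ = record { accepted = refl }

table₅ : List (ℕ × ℕ)
table₅ =
    (5378 , 275182848507937226) ∷ (5378 , 275182848507937226) ∷ (3869 , 202834665198030349) ∷
    (4781 , 247257172956440715) ∷ (50 , 3625185546232190) ∷ (44 , 2446622969405187) ∷
    (23 , 1744657626364807) ∷ (23 , 1481545312354732) ∷ (9 , 481885694240650) ∷
    (13 , 588364725967465) ∷ (11 , 567480333127032) ∷ (20 , 1169854024264846) ∷
    (22 , 1773683455248172) ∷ (25 , 1814249699212463) ∷ (4 , 221580102760282) ∷
    (6 , 261334993809368) ∷ (5 , 263127987988246) ∷ (11 , 770042295652423) ∷ (0 , 0) ∷
    (4 , 165536073447264) ∷ (0 , 0) ∷ (0 , 0) ∷ (0 , 0) ∷ (0 , 0) ∷ (0 , 0) ∷ (0 , 0) ∷ (0 , 0) ∷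
    (0 , 0) ∷ (0 , 0) ∷ (0 , 0) ∷ (0 , 0) ∷ (0 , 0) ∷ (0 , 0) ∷ (0 , 0) ∷ (0 , 0) ∷ (0 , 0) ∷
    (0 , 0) ∷ (0 , 0) ∷ (0 , 0) ∷ (0 , 0) ∷ (9 , 401777988819281) ∷ (9 , 392320070949083) ∷
    (3 , 124391158098789) ∷ (19 , 1327353326052085) ∷ (7 , 334775574289441) ∷ (2 , 96448843845713) ∷
    (7 , 387943379826304) ∷ (6 , 316918919026142) ∷ (2 , 89768476650363) ∷ (0 , 0) ∷ (0 , 0) ∷
    (0 , 0) ∷ (0 , 0) ∷ (0 , 0) ∷ (0 , 0) ∷ (0 , 0) ∷ (0 , 0) ∷ (0 , 0) ∷ (0 , 0) ∷ (0 , 0) ∷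
    (0 , 0) ∷ (0 , 0) ∷ (0 , 0) ∷ (0 , 0) ∷ (0 , 0) ∷ (0 , 0) ∷ (0 , 0) ∷ (0 , 0) ∷ (0 , 0) ∷
    (3 , 114188181514701) ∷ (2 , 72449189846443) ∷ (3 , 118542497009469) ∷ (2 , 93086876008048) ∷
    (1 , 11474973327068) ∷ (5 , 206549519887234) ∷ (6 , 276299021198191) ∷ (0 , 0) ∷
    (1 , 15266607380297) ∷ (0 , 0) ∷ (3 , 122132859042380) ∷ (6 , 269382768172440) ∷
    (39 , 2365992703691972) ∷ (14 , 842815976673375) ∷ (12 , 810175021742435) ∷
    (3 , 153705356038167) ∷ (10 , 721312587610695) ∷ (0 , 0) ∷ (3 , 127267145750586) ∷
    (6 , 302979730484473) ∷ (5 , 228089387259582) ∷ (4 , 158638346044089) ∷ (4 , 172987048750886) ∷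
    (9 , 597470255967563) ∷ (0 , 0) ∷ (0 , 0) ∷ (0 , 0) ∷ (0 , 0) ∷ (0 , 0) ∷ (0 , 0) ∷ (0 , 0) ∷
    (0 , 0) ∷ (0 , 0) ∷ (0 , 0) ∷ (0 , 0) ∷ (0 , 0) ∷ (0 , 0) ∷ (0 , 0) ∷ (0 , 0) ∷ (0 , 0) ∷
    (0 , 0) ∷ (0 , 0) ∷ (0 , 0) ∷ (0 , 0) ∷ (43 , 3302647268640928) ∷ (26 , 1653465755279390) ∷
    (4 , 161269138795631) ∷ (1 , 14418462525836) ∷ (1 , 15266607380297) ∷ (19 , 1558025990308207) ∷
    (15 , 1069117930973986) ∷ (2 , 93315818028300) ∷ (6 , 336379619648125) ∷ (3 , 110037208845755) ∷
    (4 , 159222952920505) ∷ (4 , 171023900672677) ∷ (10 , 635054406310488) ∷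
    (28 , 2332667301950802) ∷ (4 , 209481834865434) ∷ (5 , 239533374021383) ∷
    (13 , 971263710473089) ∷ (0 , 0) ∷ (2 , 68998639861943) ∷ (4 , 158114698282175) ∷
    (2 , 68813530351461) ∷ (2 , 83179070054694) ∷ (16 , 1189381339440250) ∷ (4 , 197107322618554) ∷
    (2 , 107859017025703) ∷ (2 , 113031219190541) ∷ (7 , 432245848405372) ∷ (13 , 870896406031083) ∷
    (42 , 2747464374256876) ∷ (4 , 200371106545577) ∷ (2 , 68985993305917) ∷ (4 , 172245653257573) ∷
    (3 , 110037208845755) ∷ (2 , 96448843845713) ∷ (0 , 0) ∷ (2 , 70134489321035) ∷
    (3 , 117325392961760) ∷ (2 , 72901297513243) ∷ (8 , 597106562505384) ∷ (2 , 72753037296262) ∷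
    (17 , 1424479755081303) ∷ (3 , 174601850083434) ∷ (2 , 99906510098254) ∷ (1 , 62103012552655) ∷
    (2 , 75602501463535) ∷ (1 , 44251928361526) ∷ (7 , 483241335860113) ∷ (9 , 630326648924190) ∷
    (0 , 0) ∷ (2 , 89924186409122) ∷ (2 , 60836796331014) ∷ (0 , 0) ∷ (0 , 0) ∷
    (2 , 75237831007035) ∷ (3 , 137754621708682) ∷ (0 , 0) ∷ (2 , 82612554387895) ∷
    (1 , 57114460053725) ∷ (1 , 45149121220114) ∷ (1 , 47710699604571) ∷ (2 , 83179070054694) ∷
    (0 , 0) ∷ (13 , 845577869391159) ∷ (1 , 47710699604571) ∷ (3 , 158480848468977) ∷
    (39 , 3100253615839279) ∷ (28 , 2037341445090808) ∷ (0 , 0) ∷ (3 , 134929101867765) ∷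
    (7 , 356263474206291) ∷ (3 , 129109732365903) ∷ (2 , 80387569701148) ∷ (0 , 0) ∷
    (3 , 103274759943617) ∷ (17 , 1431833735329649) ∷ (0 , 0) ∷ (2 , 84128169985704) ∷
    (2 , 59271248504734) ∷ (4 , 234918221165118) ∷ (5 , 268692142681968) ∷ (0 , 0) ∷
    (2 , 79500824762890) ∷ (2 , 57094090757350) ∷ (15 , 1115948470028049) ∷ (0 , 0) ∷
    (2 , 67640932322004) ∷ (1 , 46543438004024) ∷ (0 , 0) ∷ (1 , 48955246274801) ∷
    (1 , 41962081586755) ∷ (0 , 0) ∷ (4 , 177411317312492) ∷ (3 , 138149510599095) ∷
    (33 , 2708103237005547) ∷ (0 , 0) ∷ (0 , 0) ∷ (1 , 7633303690148) ∷ (5 , 261433585889155) ∷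
    (0 , 0) ∷ (2 , 86073154910602) ∷ (2 , 61066429521190) ∷ (34 , 2731003148075993) ∷
    (11 , 582018348901599) ∷ (13 , 806439763210860) ∷ (8 , 540044448994070) ∷ (2 , 97676486650690) ∷
    (0 , 0) ∷ (0 , 0) ∷ (0 , 0) ∷ (0 , 0) ∷ (1 , 3943866349443) ∷ (1 , 5915799524164) ∷
    (3 , 88736992862475) ∷ (6 , 246168299218475) ∷ (3 , 103739793067204) ∷ (0 , 0) ∷
    (2 , 75354146127027) ∷ (3 , 97021014709935) ∷ (2 , 86133434663623) ∷ (2 , 68574722538513) ∷
    (6 , 420062539569619) ∷ (2 , 48910898108921) ∷ (3 , 112727897590644) ∷ (4 , 169419879728990) ∷
    (3 , 94804558945016) ∷ (1 , 5730930789034) ∷ (0 , 0) ∷ (2 , 81215311157664) ∷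
    (1 , 41467958807046) ∷ (2 , 78791728279072) ∷ (3 , 125010047440748) ∷ (0 , 0) ∷
    (7 , 442234138538287) ∷ (3 , 107577872290209) ∷ (3 , 125010047440748) ∷ (1 , 56753755666436) ∷
    (0 , 0) ∷ (0 , 0) ∷ (2 , 52510373311493) ∷ (5 , 342130256665144) ∷ (2 , 48564308117388) ∷
    (2 , 75523346187459) ∷ (3 , 125508247904105) ∷ (3 , 125508247904105) ∷ (0 , 0) ∷
    (3 , 105364889675375) ∷ (2 , 78462133894141) ∷ (1 , 45081439383674) ∷ (0 , 0) ∷
    (2 , 65117657767126) ∷ (3 , 98609574279895) ∷ (1 , 7059161655374) ∷ (9 , 651056182749240) ∷
    (2 , 109920111640921) ∷ (14 , 579214892444502) ∷ (19 , 1159853911073745) ∷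
    (6 , 289884871768200) ∷ (3 , 113781656431091) ∷ (2 , 77800555870674) ∷
    (3713 , 195598333777752667) ∷ (4369 , 227424829188004376) ∷ (910 , 44293705800556270) ∷
    (720 , 34323686046915684) ∷ (759 , 38207551226541710) ∷ (845 , 41824138010085568) ∷
    (557 , 28455390352889441) ∷ (815 , 40398041744736162) ∷ (4775 , 247369881160315847) ∷
    (3389 , 179955819346418741) ∷ (3867 , 202314883285400212) ∷ (20 , 958547973991517) ∷
    (44 , 1867284922181695) ∷ (27 , 1220511873928340) ∷ (39 , 1600392840911461) ∷
    (24 , 1094210947043214) ∷ (32 , 1352511724327259) ∷ (28 , 1237553036177039) ∷
    (33 , 1356547714369545) ∷ (3 , 139291315135304) ∷ (12 , 583780992433765) ∷
    (15 , 722515248673513) ∷ (0 , 0) ∷ (0 , 0) ∷ (0 , 0) ∷ (0 , 0) ∷ (0 , 0) ∷ (0 , 0) ∷ (0 , 0) ∷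
    (0 , 0) ∷ (0 , 0) ∷ (0 , 0) ∷ (0 , 0) ∷ (0 , 0) ∷ (0 , 0) ∷ (0 , 0) ∷ (0 , 0) ∷ (0 , 0) ∷
    (0 , 0) ∷ (0 , 0) ∷ (0 , 0) ∷ (0 , 0) ∷ (5 , 187383490778875) ∷ (0 , 0) ∷
    (6 , 237737708451292) ∷ (11 , 507547961625847) ∷ (12 , 513578275970556) ∷
    (10 , 460632648877995) ∷ (9 , 356481956151246) ∷ (30 , 1234992198849921) ∷
    (24 , 1090911989110999) ∷ (5 , 235039034320214) ∷ (6 , 303585192160210) ∷
    (3 , 137780946129366) ∷ (0 , 0) ∷ (2 , 82902123015421) ∷ (4 , 169438271081667) ∷
    (3 , 113178226228984) ∷ (3 , 99058370305512) ∷ (1 , 7059927961736) ∷ (0 , 0) ∷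
    (2 , 81240538727486) ∷ (3 , 94493445068619) ∷ (1 , 5739242962633) ∷ (1 , 5924379832395) ∷
    (3 , 88865697485932) ∷ (2 , 75498687418638) ∷ (3 , 125482517014901) ∷ (3 , 125482517014901) ∷
    (0 , 0) ∷ (2 , 78179094112891) ∷ (3 , 105971930993885) ∷ (4 , 177928054180156) ∷
    (3 , 163168765980644) ∷ (0 , 0) ∷ (10 , 408501682331536) ∷ (10 , 449529502111582) ∷
    (15 , 638865741265386) ∷ (10 , 449529502111582) ∷ (12 , 481513029026478) ∷
    (7 , 292081489009230) ∷ (15 , 638865741265386) ∷ (8 , 345151290391285) ∷ (3 , 114583643435157) ∷
    (4 , 179240377052666) ∷ (4 , 179240377052666) ∷ (3 , 135144562529458) ∷ (4 , 140548544080779) ∷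
    (2 , 88748922787036) ∷ (3 , 102301373155253) ∷ (3 , 135144562529458) ∷ (12 , 477385900699863) ∷
    (11 , 469422046362955) ∷ (10 , 424499283278517) ∷ (3 , 112962463268287) ∷
    (3 , 124421429358613) ∷ (7 , 334704031847327) ∷ (7 , 334704031847327) ∷ (0 , 0) ∷
    (3 , 125015589168912) ∷ (9 , 351917554609405) ∷ (22 , 875557600142215) ∷
    (26 , 1024018300914969) ∷ (28 , 1110899216096412) ∷ (28 , 1111151031427452) ∷
    (21 , 805417314241366) ∷ (26 , 1024449132700722) ∷ (20 , 805940772734935) ∷
    (19 , 735800486834085) ∷ (7 , 326329083210032) ∷ (7 , 286383256405703) ∷ (0 , 0) ∷ (0 , 0) ∷
    (2 , 108779177320429) ∷ (8 , 308221291919607) ∷ (11 , 469422046362955) ∷ (8 , 304953303869545) ∷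
    (7 , 317969416123362) ∷ (0 , 0) ∷ (7 , 269013743403795) ∷ (12 , 477385900699863) ∷
    (10 , 426451012931387) ∷ (9 , 344781115474209) ∷ (2 , 73129961109662) ∷ (3 , 112750662572328) ∷
    (7 , 334704031847327) ∷ (0 , 0) ∷ (3 , 111304325939424) ∷ (0 , 0) ∷ (5 , 192940223007291) ∷
    (5 , 183190620569127) ∷ (3 , 125015589168912) ∷ (0 , 0) ∷ (0 , 0) ∷ (0 , 0) ∷
    (8 , 306519712386103) ∷ (24 , 923292438081079) ∷ (22 , 867578688208033) ∷
    (5 , 193677226494427) ∷ (0 , 0) ∷ (1 , 6319338487888) ∷ (8 , 298806740667043) ∷
    (10 , 424499283278517) ∷ (2 , 91154609034846) ∷ (3 , 112962463268287) ∷ (3 , 124421429358613) ∷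
    (7 , 271772799419871) ∷ (10 , 426451012931387) ∷ (22 , 868269353805059) ∷ (1 , 6310186159109) ∷
    (7 , 288731690461141) ∷ (10 , 459458449694830) ∷ (9 , 361987380103241) ∷ (7 , 315726769708084) ∷
    (3 , 139291315135304) ∷ (0 , 0) ∷ (8 , 316789149082609) ∷ (9 , 361987380103241) ∷
    (7 , 374154536224700) ∷ (0 , 0) ∷ (0 , 0) ∷ (0 , 0) ∷ (3 , 139750970806043) ∷
    (3 , 118868854225646) ∷ (3381 , 179016287745661129) ∷ (606 , 30377649964311933) ∷
    (99 , 4535940375163576) ∷ (107 , 4837957067710510) ∷ (111 , 5050638770028531) ∷
    (107 , 4837957067710510) ∷ (347 , 16940756459576226) ∷ (67 , 3031417961781538) ∷
    (111 , 5050638770028531) ∷ (391 , 18818578466814355) ∷ (1185 , 59792757439297332) ∷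
    (5000 , 257986734441322624) ∷ (3051 , 163302989295087853) ∷ (0 , 0) ∷
    (4781 , 247257172956440715) ∷ (3869 , 202834665198030349) ∷ (44 , 2446622969405187) ∷
    (50 , 3625185546232190) ∷ (26 , 1653465755279390) ∷ (43 , 3302647268640928) ∷
    (7 , 356263474206291) ∷ (9 , 401777988819281) ∷ (9 , 392320070949083) ∷ (4 , 159222952920505) ∷
    (5 , 263127987988246) ∷ (6 , 261334993809368) ∷ (4 , 171023900672677) ∷ (3 , 124391158098789) ∷
    (11 , 567480333127032) ∷ (13 , 588364725967465) ∷ (19 , 1327353326052085) ∷
    (39 , 3100253615839279) ∷ (28 , 2037341445090808) ∷ (3 , 134929101867765) ∷
    (3 , 129109732365903) ∷ (2 , 80387569701148) ∷ (6 , 269382768172440) ∷ (39 , 2365992703691972) ∷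
    (4 , 161269138795631) ∷ (6 , 276299021198191) ∷ (5 , 206549519887234) ∷ (1 , 15266607380297) ∷
    (0 , 0) ∷ (3 , 122132859042380) ∷ (1 , 14418462525836) ∷ (1 , 15266607380297) ∷
    (23 , 1481545312354732) ∷ (23 , 1744657626364807) ∷ (7 , 334775574289441) ∷
    (4 , 158638346044089) ∷ (4 , 172987048750886) ∷ (2 , 96448843845713) ∷ (7 , 387943379826304) ∷
    (6 , 316918919026142) ∷ (16 , 1189381339440250) ∷ (0 , 0) ∷ (3 , 103274759943617) ∷
    (15 , 1069117930973986) ∷ (19 , 1558025990308207) ∷ (4 , 200371106545577) ∷
    (2 , 89768476650363) ∷ (20 , 1169854024264846) ∷ (9 , 481885694240650) ∷
    (13 , 845577869391159) ∷ (6 , 336379619648125) ∷ (3 , 110037208845755) ∷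
    (10 , 635054406310488) ∷ (0 , 0) ∷ (0 , 0) ∷ (0 , 0) ∷ (0 , 0) ∷ (0 , 0) ∷ (0 , 0) ∷ (0 , 0) ∷
    (0 , 0) ∷ (0 , 0) ∷ (0 , 0) ∷ (0 , 0) ∷ (0 , 0) ∷ (0 , 0) ∷ (0 , 0) ∷ (0 , 0) ∷ (0 , 0) ∷
    (0 , 0) ∷ (0 , 0) ∷ (0 , 0) ∷ (0 , 0) ∷ (22 , 1773683455248172) ∷ (25 , 1814249699212463) ∷
    (0 , 0) ∷ (4 , 221580102760282) ∷ (11 , 770042295652423) ∷ (4 , 165536073447264) ∷
    (5 , 228089387259582) ∷ (6 , 302979730484473) ∷ (4 , 172245653257573) ∷ (2 , 70134489321035) ∷
    (3 , 117325392961760) ∷ (2 , 75602501463535) ∷ (2 , 96448843845713) ∷ (2 , 68985993305917) ∷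
    (3 , 118542497009469) ∷ (2 , 93086876008048) ∷ (3 , 114188181514701) ∷ (2 , 72449189846443) ∷
    (0 , 0) ∷ (1 , 11474973327068) ∷ (7 , 483241335860113) ∷ (2 , 93315818028300) ∷
    (2 , 72753037296262) ∷ (17 , 1424479755081303) ∷ (0 , 0) ∷ (2 , 99906510098254) ∷
    (8 , 597106562505384) ∷ (2 , 75237831007035) ∷ (3 , 137754621708682) ∷ (0 , 0) ∷
    (3 , 110037208845755) ∷ (2 , 82612554387895) ∷ (1 , 44251928361526) ∷ (2 , 107859017025703) ∷
    (2 , 113031219190541) ∷ (7 , 432245848405372) ∷ (28 , 2332667301950802) ∷ (0 , 0) ∷ (0 , 0) ∷
    (1 , 3943866349443) ∷ (1 , 5915799524164) ∷ (3 , 88736992862475) ∷ (6 , 246168299218475) ∷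
    (3 , 97021014709935) ∷ (4 , 158114698282175) ∷ (3 , 105364889675375) ∷ (0 , 0) ∷
    (2 , 78791728279072) ∷ (5 , 239533374021383) ∷ (0 , 0) ∷ (2 , 68574722538513) ∷
    (2 , 86133434663623) ∷ (2 , 52510373311493) ∷ (3 , 94804558945016) ∷ (1 , 5730930789034) ∷
    (0 , 0) ∷ (3 , 103739793067204) ∷ (9 , 597470255967563) ∷ (14 , 842815976673375) ∷
    (12 , 810175021742435) ∷ (0 , 0) ∷ (3 , 153705356038167) ∷ (10 , 721312587610695) ∷
    (3 , 127267145750586) ∷ (0 , 0) ∷ (0 , 0) ∷ (0 , 0) ∷ (0 , 0) ∷ (0 , 0) ∷ (0 , 0) ∷ (0 , 0) ∷
    (0 , 0) ∷ (0 , 0) ∷ (0 , 0) ∷ (0 , 0) ∷ (0 , 0) ∷ (0 , 0) ∷ (0 , 0) ∷ (0 , 0) ∷ (0 , 0) ∷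
    (0 , 0) ∷ (0 , 0) ∷ (0 , 0) ∷ (0 , 0) ∷ (2 , 81215311157664) ∷ (1 , 41467958807046) ∷
    (2 , 83179070054694) ∷ (2 , 75354146127027) ∷ (0 , 0) ∷ (5 , 342130256665144) ∷
    (13 , 870896406031083) ∷ (42 , 2747464374256876) ∷ (4 , 197107322618554) ∷
    (3 , 158480848468977) ∷ (1 , 47710699604571) ∷ (5 , 268692142681968) ∷ (15 , 1115948470028049) ∷
    (17 , 1431833735329649) ∷ (4 , 234918221165118) ∷ (2 , 79500824762890) ∷ (1 , 48955246274801) ∷
    (0 , 0) ∷ (0 , 0) ∷ (2 , 57094090757350) ∷ (1 , 41962081586755) ∷ (2 , 84128169985704) ∷
    (2 , 67640932322004) ∷ (0 , 0) ∷ (0 , 0) ∷ (2 , 59271248504734) ∷ (1 , 46543438004024) ∷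
    (34 , 2731003148075993) ∷ (33 , 2708103237005547) ∷ (5 , 261433585889155) ∷
    (4 , 177411317312492) ∷ (0 , 0) ∷ (3 , 138149510599095) ∷ (0 , 0) ∷ (2 , 86073154910602) ∷
    (0 , 0) ∷ (0 , 0) ∷ (0 , 0) ∷ (1 , 7633303690148) ∷ (2 , 61066429521190) ∷
    (11 , 582018348901599) ∷ (13 , 806439763210860) ∷ (8 , 540044448994070) ∷ (2 , 97676486650690) ∷
    (0 , 0) ∷ (4 , 209481834865434) ∷ (13 , 971263710473089) ∷ (0 , 0) ∷ (2 , 68998639861943) ∷
    (3 , 125508247904105) ∷ (0 , 0) ∷ (2 , 78462133894141) ∷ (3 , 112727897590644) ∷
    (4 , 169419879728990) ∷ (2 , 75523346187459) ∷ (3 , 125508247904105) ∷ (0 , 0) ∷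
    (2 , 68813530351461) ∷ (1 , 45081439383674) ∷ (6 , 420062539569619) ∷ (2 , 48910898108921) ∷
    (2 , 65117657767126) ∷ (3 , 98609574279895) ∷ (1 , 7059161655374) ∷ (0 , 0) ∷
    (1 , 56753755666436) ∷ (2 , 48564308117388) ∷ (3 , 107577872290209) ∷ (3 , 125010047440748) ∷
    (3 , 125010047440748) ∷ (0 , 0) ∷ (7 , 442234138538287) ∷ (9 , 651056182749240) ∷
    (2 , 109920111640921) ∷ (3 , 174601850083434) ∷ (0 , 0) ∷ (2 , 60836796331014) ∷
    (1 , 45149121220114) ∷ (9 , 630326648924190) ∷ (0 , 0) ∷ (2 , 89924186409122) ∷ (0 , 0) ∷
    (1 , 57114460053725) ∷ (2 , 83179070054694) ∷ (2 , 72901297513243) ∷ (1 , 47710699604571) ∷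
    (1 , 62103012552655) ∷ (0 , 0) ∷ (14 , 579214892444502) ∷ (19 , 1159853911073745) ∷
    (6 , 289884871768200) ∷ (3 , 113781656431091) ∷ (2 , 77800555870674) ∷
    (3389 , 179955819346418741) ∷ (3094 , 165681137929715053) ∷ (511 , 24923025252672327) ∷
    (782 , 38549772217313834) ∷ (86 , 4008313112725961) ∷ (4369 , 227424829188004376) ∷
    (3713 , 195598333777752667) ∷ (44 , 1867284922181695) ∷ (20 , 958547973991517) ∷
    (15 , 722515248673513) ∷ (12 , 583780992433765) ∷ (9 , 361987380103241) ∷
    (32 , 1352511724327259) ∷ (28 , 1237553036177039) ∷ (33 , 1356547714369545) ∷
    (27 , 1220511873928340) ∷ (39 , 1600392840911461) ∷ (24 , 1094210947043214) ∷
    (10 , 408501682331536) ∷ (10 , 449529502111582) ∷ (15 , 638865741265386) ∷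
    (10 , 449529502111582) ∷ (12 , 481513029026478) ∷ (7 , 292081489009230) ∷
    (15 , 638865741265386) ∷ (8 , 345151290391285) ∷ (11 , 507547961625847) ∷
    (12 , 513578275970556) ∷ (10 , 460632648877995) ∷ (3 , 114583643435157) ∷
    (4 , 179240377052666) ∷ (4 , 179240377052666) ∷ (4 , 140548544080779) ∷ (9 , 356481956151246) ∷
    (30 , 1234992198849921) ∷ (24 , 1090911989110999) ∷ (5 , 235039034320214) ∷
    (6 , 303585192160210) ∷ (3 , 137780946129366) ∷ (0 , 0) ∷ (2 , 82902123015421) ∷
    (4 , 169438271081667) ∷ (3 , 113178226228984) ∷ (3 , 99058370305512) ∷ (1 , 7059927961736) ∷
    (0 , 0) ∷ (2 , 81240538727486) ∷ (1 , 5924379832395) ∷ (3 , 88865697485932) ∷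
    (3 , 94493445068619) ∷ (1 , 5739242962633) ∷ (2 , 75498687418638) ∷ (3 , 125482517014901) ∷
    (3 , 125482517014901) ∷ (0 , 0) ∷ (2 , 78179094112891) ∷ (3 , 105971930993885) ∷
    (4 , 177928054180156) ∷ (0 , 0) ∷ (3 , 163168765980644) ∷ (10 , 459458449694830) ∷
    (3 , 139291315135304) ∷ (5 , 187383490778875) ∷ (6 , 237737708451292) ∷ (9 , 361987380103241) ∷
    (7 , 315726769708084) ∷ (2 , 88748922787036) ∷ (0 , 0) ∷ (3 , 139291315135304) ∷
    (26 , 1024449132700722) ∷ (28 , 1111151031427452) ∷ (28 , 1110899216096412) ∷
    (20 , 805940772734935) ∷ (26 , 1024018300914969) ∷ (21 , 805417314241366) ∷
    (19 , 735800486834085) ∷ (8 , 308221291919607) ∷ (11 , 469422046362955) ∷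
    (12 , 477385900699863) ∷ (11 , 469422046362955) ∷ (10 , 424499283278517) ∷
    (9 , 351917554609405) ∷ (22 , 875557600142215) ∷ (7 , 269013743403795) ∷
    (12 , 477385900699863) ∷ (10 , 426451012931387) ∷ (9 , 344781115474209) ∷ (0 , 0) ∷
    (3 , 112750662572328) ∷ (0 , 0) ∷ (7 , 334704031847327) ∷ (7 , 334704031847327) ∷ (0 , 0) ∷
    (0 , 0) ∷ (3 , 125015589168912) ∷ (3 , 124421429358613) ∷ (7 , 334704031847327) ∷
    (3 , 111304325939424) ∷ (5 , 192940223007291) ∷ (0 , 0) ∷ (0 , 0) ∷ (0 , 0) ∷
    (5 , 183190620569127) ∷ (3 , 125015589168912) ∷ (7 , 317969416123362) ∷ (2 , 73129961109662) ∷
    (8 , 306519712386103) ∷ (24 , 923292438081079) ∷ (22 , 867578688208033) ∷ (1 , 6319338487888) ∷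
    (5 , 193677226494427) ∷ (0 , 0) ∷ (7 , 326329083210032) ∷ (2 , 108779177320429) ∷
    (8 , 298806740667043) ∷ (10 , 424499283278517) ∷ (8 , 304953303869545) ∷ (3 , 112962463268287) ∷
    (2 , 91154609034846) ∷ (3 , 124421429358613) ∷ (3 , 112962463268287) ∷ (7 , 271772799419871) ∷
    (10 , 426451012931387) ∷ (0 , 0) ∷ (7 , 286383256405703) ∷ (0 , 0) ∷ (22 , 868269353805059) ∷
    (1 , 6310186159109) ∷ (7 , 288731690461141) ∷ (3 , 135144562529458) ∷ (3 , 102301373155253) ∷
    (3 , 135144562529458) ∷ (8 , 316789149082609) ∷ (7 , 374154536224700) ∷ (0 , 0) ∷
    (3 , 139750970806043) ∷ (0 , 0) ∷ (3 , 118868854225646) ∷ (720 , 34323686046915684) ∷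
    (910 , 44293705800556270) ∷ (511 , 24923025252672327) ∷ (782 , 38549772217313834) ∷
    (86 , 4008313112725961) ∷ (107 , 4837957067710510) ∷ (111 , 5050638770028531) ∷
    (391 , 18818578466814355) ∷ (759 , 38207551226541710) ∷ (4223 , 221207489045149994) ∷
    (3094 , 165681137929715053) ∷ (3051 , 163302989295087853) ∷ (38 , 1707597943685575) ∷
    (49 , 2209542484429462) ∷ (3867 , 202314883285400212) ∷ (3381 , 179016287745661129) ∷
    (815 , 40398041744736162) ∷ (4775 , 247369881160315847) ∷ (38 , 1707597943685575) ∷
    (49 , 2209542484429462) ∷ (2630 , 141712926436327085) ∷ (616 , 31328619030235609) ∷
    (4223 , 221207489045149994) ∷ (606 , 30377649964311933) ∷ (557 , 28455390352889441) ∷ (0 , 0) ∷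
    (67 , 3031417961781538) ∷ (111 , 5050638770028531) ∷ (50 , 2276332226721504) ∷
    (291 , 14319596618503778) ∷ (616 , 31328619030235609) ∷ (3798 , 197614796306594767) ∷ (0 , 0) ∷
    (3198 , 168163836220093297) ∷ (820 , 42308891390749154) ∷ (4247 , 222000384943996719) ∷
    (2649 , 143341259719140161) ∷ (700 , 34769605384373721) ∷ (37 , 1702899719168233) ∷ (0 , 0) ∷
    (25 , 1104771242214731) ∷ (700 , 34769605384373721) ∷ (0 , 0) ∷ (37 , 1702899719168233) ∷
    (25 , 1104771242214731) ∷ (4558 , 234955614455645784) ∷ (0 , 0) ∷ (347 , 16940756459576226) ∷
    (45 , 2054538226871591) ∷ (50 , 2276332226721504) ∷ (31 , 1387153271653513) ∷
    (28 , 1310579920536223) ∷ (31 , 1387153271653513) ∷ (72 , 3439466098153050) ∷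
    (845 , 41824138010085568) ∷ (99 , 4535940375163576) ∷ (107 , 4837957067710510) ∷
    (65 , 2902120503049588) ∷ (0 , 0) ∷ (39 , 1779579658701699) ∷ (98 , 4609358554598910) ∷
    (101 , 4744939515786334) ∷ (72 , 3423556582030028) ∷ (0 , 0) ∷ (30 , 1324114341232676) ∷
    (65 , 2902120503049588) ∷ (29 , 1290557709773948) ∷ (217 , 10491776957079242) ∷
    (1185 , 59792757439297332) ∷ (4000 , 208748811354431529) ∷ (452 , 23370595029562163) ∷
    (72 , 3439466098153050) ∷ (611 , 30469200108107665) ∷ (4210 , 216794185868383985) ∷
    (3198 , 168163836220093297) ∷ (820 , 42308891390749154) ∷ (4558 , 234955614455645784) ∷
    (786 , 40558727648076579) ∷ (287 , 13899626309024926) ∷ (88 , 4160125172452852) ∷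
    (101 , 4744939515786334) ∷ (98 , 4609358554598910) ∷ (101 , 4744939515786334) ∷
    (72 , 3423556582030028) ∷ (444 , 22179198345688595) ∷ (45 , 3173992185563094) ∷
    (777 , 39063176118549626) ∷ (53 , 2542397661663638) ∷ (45 , 2054538226871591) ∷
    (50 , 2276332226721504) ∷ (50 , 2276332226721504) ∷ (31 , 1387153271653513) ∷
    (291 , 14319596618503778) ∷ (28 , 1240701074145992) ∷ (28 , 1310579920536223) ∷
    (31 , 1387153271653513) ∷ (0 , 0) ∷ (0 , 0) ∷ (567 , 28761057300713453) ∷
    (13 , 809496526944215) ∷ (11 , 779433154434064) ∷ (37 , 2835152426105112) ∷
    (4 , 169419879728990) ∷ (8 , 602361402426582) ∷ (0 , 0) ∷ (2 , 88535876003741) ∷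
    (11 , 743217973647643) ∷ (11 , 532004575719186) ∷ (28 , 2344498900999132) ∷
    (18 , 1230286827866142) ∷ (10 , 490453780383302) ∷ (2 , 105958525387516) ∷
    (7 , 414516945089195) ∷ (40 , 2712013070357543) ∷ (12 , 796133331181552) ∷
    (39 , 2500986507788880) ∷ (25 , 1849848763646049) ∷ (8 , 431082153355746) ∷
    (12 , 782632189234085) ∷ (8 , 560090188030963) ∷ (2 , 91563892808340) ∷ (0 , 0) ∷
    (3 , 105901768967216) ∷ (3 , 123261070060234) ∷ (3 , 123261070060234) ∷ (0 , 0) ∷
    (7 , 422995387352633) ∷ (0 , 0) ∷ (8 , 591970287201552) ∷ (2 , 102081521990000) ∷
    (3798 , 197614796306594767) ∷ (786 , 40558727648076579) ∷ (287 , 13899626309024926) ∷ (0 , 0) ∷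
    (88 , 4160125172452852) ∷ (101 , 4744939515786334) ∷ (444 , 22179198345688595) ∷
    (4210 , 216794185868383985) ∷ (64 , 3074377383968900) ∷ (98 , 4609358554598910) ∷
    (73 , 3454920461500505) ∷ (461 , 22961574718575401) ∷ (0 , 0) ∷ (30 , 1306193084606342) ∷
    (0 , 0) ∷ (65 , 2902120503049588) ∷ (65 , 2902120503049588) ∷ (0 , 0) ∷
    (29 , 1290557709773948) ∷ (39 , 1779579658701699) ∷ (30 , 1324114341232676) ∷
    (65 , 2902120503049588) ∷ (217 , 10491776957079242) ∷ (29 , 1290557709773948) ∷
    (25 , 1138202413699241) ∷ (55 , 2455531864455290) ∷ (39 , 1779579658701699) ∷ (0 , 0) ∷
    (0 , 0) ∷ (333 , 16729619333166118) ∷ (1003 , 51236521500222515) ∷ (3171 , 167861006916035995) ∷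
    (2630 , 141712926436327085) ∷ (452 , 23370595029562163) ∷ (0 , 0) ∷ (53 , 2542397661663638) ∷
    (0 , 0) ∷ (28 , 1240701074145992) ∷ (956 , 48886573073516779) ∷ (0 , 0) ∷ (0 , 0) ∷
    (1 , 4206790772739) ∷ (964 , 49056674996474441) ∷ (4000 , 208748811354431529) ∷
    (3681 , 190839942462451178) ∷ (0 , 0) ∷ (0 , 0) ∷ (0 , 0) ∷ (1 , 4206790772739) ∷
    (330 , 16697279119256873) ∷ (64 , 3074377383968900) ∷ (98 , 4609358554598910) ∷
    (73 , 3454920461500505) ∷ (3 , 123261070060234) ∷ (0 , 0) ∷ (7 , 422995387352633) ∷
    (45 , 3173992185563094) ∷ (11 , 779433154434064) ∷ (37 , 2835152426105112) ∷
    (4 , 169419879728990) ∷ (13 , 809496526944215) ∷ (11 , 743217973647643) ∷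
    (28 , 2344498900999132) ∷ (11 , 532004575719186) ∷ (10 , 490453780383302) ∷
    (18 , 1230286827866142) ∷ (8 , 560090188030963) ∷ (2 , 91563892808340) ∷ (2 , 105958525387516) ∷
    (7 , 414516945089195) ∷ (40 , 2712013070357543) ∷ (12 , 796133331181552) ∷
    (39 , 2500986507788880) ∷ (25 , 1849848763646049) ∷ (8 , 431082153355746) ∷
    (12 , 782632189234085) ∷ (0 , 0) ∷ (0 , 0) ∷ (3 , 105901768967216) ∷ (3 , 123261070060234) ∷
    (8 , 591970287201552) ∷ (2 , 102081521990000) ∷ (8 , 602361402426582) ∷ (0 , 0) ∷
    (2 , 88535876003741) ∷ (461 , 22961574718575401) ∷ (0 , 0) ∷ (30 , 1306193084606342) ∷
    (65 , 2902120503049588) ∷ (55 , 2455531864455290) ∷ (39 , 1779579658701699) ∷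
    (25 , 1138202413699241) ∷ (29 , 1290557709773948) ∷ (0 , 0) ∷ (333 , 16729619333166118) ∷
    (777 , 39063176118549626) ∷ (567 , 28761057300713453) ∷ (611 , 30469200108107665) ∷
    (1003 , 51236521500222515) ∷ (4247 , 222000384943996719) ∷ (3171 , 167861006916035995) ∷
    (964 , 49056674996474441) ∷ (3681 , 190839942462451178) ∷ (330 , 16697279119256873) ∷ (0 , 0) ∷
    (0 , 0) ∷ (1185 , 59801441570567041) ∷ (21 , 908107861615278) ∷ (1184 , 59788821198248823) ∷
    (835 , 42922720559872967) ∷ (956 , 48886573073516779) ∷ (652 , 33995090450399606) ∷ (0 , 0) ∷
    (0 , 0) ∷ (0 , 0) ∷ (794 , 40644366865393817) ∷ (276 , 13557164619915212) ∷ (0 , 0) ∷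
    (3 , 153382776485140) ∷ (89 , 4244560583619700) ∷ (72 , 3423556582030028) ∷ (0 , 0) ∷ (0 , 0) ∷
    (30 , 1324114341232676) ∷ (65 , 3104539985933328) ∷ (73 , 3454920461500505) ∷
    (930 , 47272574732272270) ∷ (630 , 32042510892376547) ∷ (460 , 23624797521494250) ∷
    (74 , 3510332613086539) ∷ (54 , 2568129889609601) ∷ (21 , 908107861615278) ∷
    (1185 , 59801441570567041) ∷ (1184 , 59788821198248823) ∷ (835 , 42922720559872967) ∷
    (652 , 33995090450399606) ∷ (0 , 0) ∷ (0 , 0) ∷ (0 , 0) ∷ (794 , 40644366865393817) ∷
    (3 , 153382776485140) ∷ (276 , 13557164619915212) ∷ (0 , 0) ∷ (89 , 4244560583619700) ∷
    (72 , 3423556582030028) ∷ (30 , 1324114341232676) ∷ (0 , 0) ∷ (65 , 3104539985933328) ∷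
    (73 , 3454920461500505) ∷ (930 , 47272574732272270) ∷ (630 , 32042510892376547) ∷
    (460 , 23624797521494250) ∷ (74 , 3510332613086539) ∷ (54 , 2568129889609601) ∷ []

-- Values have 16 decimals. With c = 8 the bounds at the root differ by 8 · 5378 units of the last
-- place, about 4.3 · 10⁻¹², so both give the same tenth decimal after rounding.
certificate₅ : Certificate 7775 99 9999999999999999 8 19 (fromℕ 4)
  5378 275182848507937226 table₅
certificate₅ = record { accepted = refl }

-- Rounding

floor≡ : ∀ n r → ι n ℚ.≤ r → r ℚ.< ι (suc n) → ℚ.floor r ≡ + n
floor≡ n r@(ℚ.mkℚ m d _) n≤r r<1+n = ℤ.≤-antisym
  (≤-of-<suc (ℤ.*-cancelʳ-<-nonNeg D (ℤ.≤-<-trans (ℤ.[n/d]*d≤n m D) below)))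
  (≤-of-<suc (ℤ.*-cancelʳ-<-nonNeg D (ℤ.≤-<-trans above
    (subst (λ k → m ℤ.< ℤ.suc k ℤ.* D) (sym (ℤ.div-pos-is-/ℕ m (suc d))) (ℤ.n<s[n/ℕd]*d m (suc d))))))
  where
  D = + suc d
  ≤-of-<suc : ∀ {i j} → i ℤ.< ℤ.suc j → i ℤ.≤ j
  ≤-of-<suc {i} {j} i< = subst (i ℤ.≤_) (ℤ.pred-suc j) (ℤ.i<j⇒i≤pred[j] i<)
  above : + n ℤ.* D ℤ.≤ m
  above with ℚᵘ.≤-respˡ-≃ (ℚ.toℚᵘ-fromℚᵘ (ℚᵘ.mkℚᵘ (+ n) 0)) (ℚ.toℚᵘ-mono-≤ n≤r)
  ... | ℚᵘ.*≤* le = subst (+ n ℤ.* D ℤ.≤_) (ℤ.*-identityʳ m) le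
  below : m ℤ.< ℤ.suc (+ n) ℤ.* D
  below with ℚᵘ.<-respʳ-≃ (ℚ.toℚᵘ-fromℚᵘ (ℚᵘ.mkℚᵘ (+ suc n) 0)) (ℚ.toℚᵘ-mono-< r<1+n)
  ... | ℚᵘ.*<* lt = subst (ℤ._< + suc n ℤ.* D) (ℤ.*-identityʳ m) lt

-- `round` takes the floor of p + ½ only for positive p, hence the first hypothesis.
round≡ : ∀ n p → 0ℚ ℚ.< p → ι n ℚ.≤ p ℚ.+ ℚ.½ → p ℚ.+ ℚ.½ ℚ.< ι (suc n) → round p ≡ + n
round≡ n p 0<p n≤ <1+n with p ℚ.≤ᵇ 0ℚ in eq
... | true  = ⊥-elim (ℚ.<-irrefl refl (ℚ.<-≤-trans 0<p (ℚ.≤ᵇ⇒≤ (subst Bool.T (sym eq) tt))))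
... | false = floor≡ n (p ℚ.+ ℚ.½) n≤ <1+n

-1-cancel : ∀ {x y} → x ≡ y ℚ.+ 1ℚ → x ℚ.- 1ℚ ≡ y
-1-cancel {x} {y} eq = trans (cong (ℚ._- 1ℚ) eq) (ring y)
  where
  ring : ∀ y → y ℚ.+ 1ℚ ℚ.- 1ℚ ≡ y
  ring = solve 1 (λ y → y :+ con 1ℚ :- con 1ℚ := y) refl
    where open +-*-Solver

fraction-shift : ∀ d y e a → y ℕ.* suc e ≡ (a + suc e) ℕ.* suc d → fraction d y ≡ fraction e a ℚ.+ 1ℚ
fraction-shift d y e a eq = trans (/≡ y d (a + suc e) e eq)
  (trans (sym (/-+ a (suc e) e)) (cong (fraction e a ℚ.+_) (fraction-1 e)))

exact : ∀ d y e a → y ℕ.* suc e ≡ (a + suc e) ℕ.* suc d → ∀ {h} {v : Vertex h} →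
  Bounds v (fraction d y) (fraction d y) → HasSum (IsGSAW v) (λ W → pᵁ W * (+ ∣ W ∣ʷ / 1)) (fraction e a)
exact d y e a eq {v = v} (q , sum , ≤q , q≤) =
  subst (HasSum (IsGSAW v) (λ W → pᵁ W * (+ ∣ W ∣ʷ / 1)))
    (trans (ℚ.≤-antisym q≤ ≤q) (-1-cancel (fraction-shift d y e a eq))) sum

module _ (l u M : ℚ) (n : ℕ) (0<M : 0ℚ ℚ.< M) (0<l : 0ℚ ℚ.< l ℚ.- 1ℚ)
  (n≤ : ι n ℚ.≤ (l ℚ.- 1ℚ) * M ℚ.+ ℚ.½) (<1+n : (u ℚ.- 1ℚ) * M ℚ.+ ℚ.½ ℚ.< ι (suc n)) where

  rounded : ∀ {h} {v : Vertex h} → Bounds v l u →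
    ∃[ q ] (HasSum (IsGSAW v) (λ W → pᵁ W * (+ ∣ W ∣ʷ / 1)) q × round (q * M) ≡ + n)
  rounded (q , sum , l≤q , q≤u) = q , sum , round≡ n (q * M) (*-pos (ℚ.<-≤-trans 0<l l≤q) 0<M)
    (ℚ.≤-trans n≤ (ℚ.+-monoˡ-≤ ℚ.½ (scale-≤ l≤q))) (ℚ.≤-<-trans (ℚ.+-monoˡ-≤ ℚ.½ (scale-≤ q≤u)) <1+n)
    where
    scale-≤ : ∀ {a b} → a ℚ.≤ b → a * M ℚ.≤ b * M
    scale-≤ = ℚ.*-monoʳ-≤-nonNeg M {{ℚ.nonNegative (ℚ.<⇒≤ 0<M)}}

mainTheorem6 : (L 3 ≔ (+ 486414801 / 25317287))
    × (L 4 ≔ (+ 36398762646457399797278201924184927631185786219507599165631529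
    / 1584271961568506676402164217848452838298247680057676502545715))
    × (∃[ q ] ((L 5 ≔ q) × round (q * (+ (10 ^ 10) / 1)) ≡ + 265182848508))
mainTheorem6 =
  exact 455711165 9211177584 25317286 486414801 refl
    (certified 7775 99 455711165 0 19 (fromℕ 2) 3344 9211177584 table₃ certificate₃) ,
  exact 988585704018748166074950471937434571098106552355990137588526159
    23701413595408165639576548472628829412958037153328732016942600256
    1584271961568506676402164217848452838298247680057676502545714
    36398762646457399797278201924184927631185786219507599165631529 refl
    (certified 7775 99 988585704018748166074950471937434571098106552355990137588526159 0 19 (fromℕ 3)
      4136 23701413595408165639576548472628829412958037153328732016942600256 table₄ certificate₄) ,
  -- The upper end 275182848507980250 is 275182848507937226 + 8 · 5378.
  rounded (fraction 9999999999999999 275182848507937226) (fraction 9999999999999999 275182848507980250) (ι (10 ^ 10)) 265182848508 (0<ι 9999999999)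
    (toWitness {a? = _ ℚ.<? _} tt) (toWitness {a? = _ ℚ.≤? _} tt) (toWitness {a? = _ ℚ.<? _} tt)
    (certified 7775 99 9999999999999999 8 19 (fromℕ 4) 5378 275182848507937226 table₅ certificate₅)
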